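{- Every graph of maximum degree at most three has slope parameter at most seven.
   Context: For a set $P$ of points in the plane and a set $\Sigma$ of slopes, $G(P,\Sigma)$ denotes the graph with vertex set $P$ in which $p,q\in P$ are adjacent if and only if the slope of the line $pq$ belongs to $\Sigma$. The slope parameter $s(G)$ of a graph $G$ is the size of the smallest set $\Sigma$ of slopes such that $G$ is isomorphic to $G(P,\Sigma)$ for some finite point set $P$. -}

module Defs where

open import Level using (0ℓ)
open import Data.Nat using (ℕ; _≤_)
open import Data.Bool using (Bool; true; false)
open import Data.Fin using (Fin)
open import Data.List using (List; length; filterᵇ; allFin)
open import Data.List.Membership.Propositional using (_∈_)
open import Data.Maybe using (Maybe; just; nothing)
open import Data.Product using (Σ; ∃; _×_; _,_; Σ-syntax)
open import Relation.Nullary using (¬_)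
open import Relation.Binary.PropositionalEquality using (_≡_; _≢_)
open import Algebra.Structures using (IsCommutativeRing)
open import Relation.Binary.Structures using (IsTotalOrder)

-- The real numbers, axiomatised as a (Dedekind-)complete ordered field.
-- Classically any two such structures are isomorphic to ℝ, so
-- quantifying over every such structure is the same as speaking of ℝ.

record RealField : Set₁ where
  infixl 6 _+_
  infixl 7 _*_
  infix 4 _≤ᵣ_
  field
    ℝ   : Set
    _+_ _*_ : ℝ → ℝ → ℝ
    -_  : ℝ → ℝ
    0ᵣ 1ᵣ : ℝ
    _⁻¹ : ℝ → ℝ
    _≤ᵣ_ : ℝ → ℝ → Set
    isCommutativeRing : IsCommutativeRing _≡_ _+_ _*_ -_ 0ᵣ 1ᵣ
    0≢1 : 0ᵣ ≢ 1ᵣ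
    ⁻¹-inverse : ∀ x → x ≢ 0ᵣ → x * (x ⁻¹) ≡ 1ᵣ
    isTotalOrder : IsTotalOrder _≡_ _≤ᵣ_
    +-mono-≤ : ∀ x y z → x ≤ᵣ y → x + z ≤ᵣ y + z
    *-nonneg : ∀ x y → 0ᵣ ≤ᵣ x → 0ᵣ ≤ᵣ y → 0ᵣ ≤ᵣ x * y
    complete : (S : ℝ → Set) → (∃ λ x → S x) →
               (∃ λ b → ∀ x → S x → x ≤ᵣ b) →
               ∃ λ s → (∀ x → S x → x ≤ᵣ s) ×
                       (∀ b → (∀ x → S x → x ≤ᵣ b) → s ≤ᵣ b)

module Plane (R : RealField) where
  open RealField R

  _-ᵣ_ : ℝ → ℝ → ℝ
  x -ᵣ y = x + (- y)

  Point : Set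
  Point = ℝ × ℝ

  -- a slope: either a real number, or 'nothing' for the vertical direction
  Slope : Set
  Slope = Maybe ℝ

  -- the line through p and q (p ≠ q) has slope σ
  HasSlope : Point → Point → Slope → Set
  HasSlope (x₁ , y₁) (x₂ , y₂) nothing  = x₁ ≡ x₂
  HasSlope (x₁ , y₁) (x₂ , y₂) (just m) =
    x₁ ≢ x₂ × (y₂ -ᵣ y₁) ≡ m * (x₂ -ᵣ x₁)

  SlopeIn : List Slope → Point → Point → Set
  SlopeIn Σs p q = Σ[ σ ∈ Slope ] (σ ∈ Σs × HasSlope p q σ)

record Graph (n : ℕ) : Set where
  field
    E     : Fin n → Fin n → Bool
    sym   : ∀ u v → E u v ≡ E v u
    irrefl : ∀ v → E v v ≡ false

degree : ∀ {n} → Graph n → Fin n → ℕ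
degree {n} G v = length (filterᵇ (Graph.E G v) (allFin n))

MaxDegreeAtMost : ∀ {n} → Graph n → ℕ → Set
MaxDegreeAtMost G d = ∀ v → degree G v ≤ d

open import Function.Bundles using (_⇔_)
open import Function.Definitions using (Injective)

-- G is isomorphic to G(P, Σs) for some finite point set P:
-- an injective placement pos of the vertices (P = image of pos) such that
-- distinct u, v are adjacent iff the slope of the line pos u pos v lies in Σs.
RealizedBy : (R : RealField) → ∀ {n} → Graph n → List (Plane.Slope R) → Set
RealizedBy R {n} G Σs =
  Σ[ pos ∈ (Fin n → Plane.Point R) ]
    (Injective _≡_ _≡_ pos ×
     (∀ u v → u ≢ v → (Graph.E G u v ≡ true) ⇔ Plane.SlopeIn R Σs (pos u) (pos v)))

SlopeParamAtMost : (R : RealField) → ∀ {n} → Graph n → ℕ → Set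
SlopeParamAtMost R G k =
  Σ[ Σs ∈ List (Plane.Slope R) ] (length Σs ≤ k × RealizedBy R G Σs)

{-# OPTIONS --safe #-}
-- Delete the edges of the K₄ components and order the vertices so that the total weight of
-- consecutive edges is maximal, edges in triangles being heavier. Consecutive adjacent vertices form
-- paths, drawn with four steep slopes used cyclically; by maximality the remaining edges form stars
-- and double stars, drawn with the slopes ∞, N and N / 2.
--
-- As N → ∞ the abscissae become constant on the components of the remaining edges, so that a limit
-- drawing is given by an abscissa for each such class and a vertical shift for each path. Each
-- coincidence to be avoided is the vanishing of a linear form in these data, at order 0 or at order
-- 1 / N. A form is not identically zero because it is seen by the shift of some path or by the
-- abscissa of some class: a class has at most three inner vertices on paths, too few for the turns
-- between the four slopes to cancel. Finitely many nonzero forms have a common nonzero, and for large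
-- N an exact integer solution of the homogeneous line equations stays close enough to the limit.
--
-- The K₄ components, collapsed to points, are finally spread along short lines of slope 1.
module Submission where

open import Defs
import Algebra.Properties.Ring as RingProperties
open import Data.Bool using (true; false; Bool; _∧_; if_then_else_)
import Data.Bool.Properties as Boolₚ
open import Data.Empty using (⊥-elim; ⊥)
open import Data.Fin as Fin using (Fin; zero; suc; toℕ)
import Data.Fin.Properties as Finₚ
open import Data.Integer as ℤ using (ℤ; ∣_∣; 0ℤ; 1ℤ; -1ℤ)
import Data.Integer.Properties as ℤₚ
open import Data.List as List using (List; []; _∷_; length; _++_; head; allFin; cartesianProductWith; map; upTo)
import Data.List.Membership.DecPropositional as DecMembership
open import Data.List.Membership.Propositional using (_∈_)
open import Data.List.Membership.Propositional.Properties using (∈-map⁺; ∈-cartesianProductWith⁺; ∈-filter⁺; ∈-filter⁻; ∈-allFin; ∈-++⁺ˡ; ∈-++⁺ʳ; ∈-upTo⁺)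
open import Data.List.Properties using (length-++)
open import Data.List.Relation.Binary.Permutation.Propositional using (_↭_)
open import Data.List.Relation.Unary.All as All using (All; []; _∷_)
open import Data.List.Relation.Unary.AllPairs using ([]; _∷_)
open import Data.List.Relation.Unary.Any as Any using (here; there)
import Data.List.Relation.Unary.Unique.DecPropositional as DecUnique
open import Data.List.Relation.Unary.Unique.Propositional using (Unique)
open import Data.List.Relation.Unary.Unique.Propositional.Properties using (allFin⁺)
open import Data.Maybe as Maybe using (Maybe; just; nothing)
open import Data.Maybe.Properties using (just-injective)
open import Data.Nat as ℕ using (ℕ; zero; suc; s≤s; _≤_; _<_; z≤n; _≤?_; _<?_)
import Data.Nat.Properties as ℕₚ
import Data.Nat.Tactic.RingSolver as ℕSolver
open import Data.Product using (∃; _×_; _,_; proj₁; proj₂; ∃₂)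
open import Data.Sum using ([_,_]′; inj₁; inj₂; _⊎_)
import Data.Vec as Vec
open import Relation.Binary.Definitions using (tri<; tri≈; tri>)
import Relation.Binary.PropositionalEquality as ≡
open import Relation.Nullary using (¬_; yes; no; ¬?; Dec; _×-dec_; does)

-- The steep slopes are 1, 2, 2 + B and 2 + B + B²: the turns from one to the next are 1, B, B² and
-- minus their sum, so a sum of turns with small natural coefficients is read off in base B and
-- vanishes only if all four coefficients agree. Rearranging an order may cost three gaps to gain
-- one edge, so each edge weight must exceed three times the one below: 1, 4, 13. K₄ must go first
-- because the three links of a path through it leave a triangle with a single link. Elsewhere
-- maximality forbids this, so that a link inside a class can only join two leaves of a double star,
-- one at each centre. Such a link has length 0 in the limit. This is the only reason why steep
-- slopes need forms of order 1 / N, and only for segments of two or three links. For near-vertical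
-- lines within a class order 1 / N always decides, since the limit abscissae agree. No determinant
-- is computed: n equations for n abscissae and a common factor d have a nonzero integer solution,
-- and the error estimate itself shows that d is not zero.

-- Integer linear algebra: generic vectors and homogeneous systems.

module LinAlg where
  open import Data.Integer using (+_; -_; _+_; _*_; _-_)
  open import Data.Integer.Tactic.RingSolver using (solve-∀)
  open import Data.List.Relation.Unary.Any using (Any)
  open import Data.Vec using (Vec; []; _∷_)
  open import Relation.Binary.PropositionalEquality

  *≢0 : ∀ {i j} → i ≢ 0ℤ → j ≢ 0ℤ → i * j ≢ 0ℤ
  *≢0 {i} i≢0 j≢0 eq = [ i≢0 , j≢0 ]′ (ℤₚ.i*j≡0⇒i≡0∨j≡0 i eq)

  -- A nonzero multiple of `d` has absolute value at least that of `d`, so `b` cannot cancel it.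
  -- Every "for a large enough factor" of the proof, whether the factor is `t`, `B`, `N`, `d` or
  -- `scale`, is an application of this.
  dominant : ∀ d a b → a ≢ 0ℤ → ∣ b ∣ ℕ.< ∣ d ∣ → d * a + b ≢ 0ℤ
  dominant d a b a≢0 b<d eq = ℕₚ.<⇒≢ lt (sym ∣da∣≡∣b∣)
    where
    ∣da∣≡∣b∣ : ∣ d * a ∣ ≡ ∣ b ∣
    ∣da∣≡∣b∣ = trans (cong ∣_∣ (trans (ring (d * a) b) (trans (cong (_- b) eq) (ℤₚ.+-identityˡ (- b))))) (ℤₚ.∣-i∣≡∣i∣ b)
      where
      ring : ∀ x y → x ≡ (x + y) - y
      ring = solve-∀
    1≤∣a∣ : 1 ℕ.≤ ∣ a ∣
    1≤∣a∣ = ℕₚ.n≢0⇒n>0 (λ ∣a∣≡0 → a≢0 (ℤₚ.∣i∣≡0⇒i≡0 ∣a∣≡0))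
    lt : ∣ b ∣ ℕ.< ∣ d * a ∣
    lt = ℕₚ.<-≤-trans b<d (subst₂ ℕ._≤_ (ℕₚ.*-identityʳ ∣ d ∣) (sym (ℤₚ.abs-* d a)) (ℕₚ.*-monoʳ-≤ ∣ d ∣ 1≤∣a∣))

  -- The single operation `comb t v w`, read as t v + w, carries no laws. Only values of functionals
  -- are ever compared, so the vectors may be functions on ℕ, whose equality would need
  -- extensionality.
  module Linear {V : Set} (comb : ℤ → V → V → V) where

    record Functional : Set where
      constructor functional
      field
        apply  : V → ℤ
        linear : ∀ t v w → apply (comb t v w) ≡ t * apply v + apply w
    open Functional public

    abstract
      ⊞-linear : ∀ {f g : V → ℤ} t v w → f (comb t v w) ≡ t * f v + f w → g (comb t v w) ≡ t * g v + g w →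
                 f (comb t v w) + g (comb t v w) ≡ t * (f v + g v) + (f w + g w)
      ⊞-linear {f} {g} t v w lf lg = trans (cong₂ _+_ lf lg) (ring t (f v) (f w) (g v) (g w))
        where
        ring : ∀ t a b c d → (t * a + b) + (t * c + d) ≡ t * (a + c) + (b + d)
        ring = solve-∀

      ⊟-linear : ∀ {f g : V → ℤ} t v w → f (comb t v w) ≡ t * f v + f w → g (comb t v w) ≡ t * g v + g w →
                 f (comb t v w) - g (comb t v w) ≡ t * (f v - g v) + (f w - g w)
      ⊟-linear {f} {g} t v w lf lg = trans (cong₂ _-_ lf lg) (ring t (f v) (f w) (g v) (g w))
        where
        ring : ∀ t a b c d → (t * a + b) - (t * c + d) ≡ t * (a - c) + (b - d)
        ring = solve-∀

      ⊡-linear : ∀ {f : V → ℤ} c t v w → f (comb t v w) ≡ t * f v + f w → c * f (comb t v w) ≡ t * (c * f v) + c * f w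
      ⊡-linear {f} c t v w lf = trans (cong (c *_) lf) (ring t (f v) (f w) c)
        where
        ring : ∀ t a b c → c * (t * a + b) ≡ t * (c * a) + c * b
        ring = solve-∀

    infixl 6 _⊞_ _⊟_
    infixl 7 _⊡_
    _⊞_ _⊟_ : Functional → Functional → Functional
    functional f lf ⊞ functional g lg = functional (λ v → f v + g v) λ t v w → ⊞-linear {f} {g} t v w (lf t v w) (lg t v w)
    functional f lf ⊟ functional g lg = functional (λ v → f v - g v) λ t v w → ⊟-linear {f} {g} t v w (lf t v w) (lg t v w)

    _⊡_ : ℤ → Functional → Functional
    c ⊡ functional f lf = functional (λ v → c * f v) λ t v w → ⊡-linear {f} c t v w (lf t v w)

    Generic : List V → V → Functional → Set
    Generic basis w f = All (λ b → apply f b ≢ 0ℤ → apply f w ≢ 0ℤ) basis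

    private
      weight : V → List Functional → ℕ
      weight b [] = 0
      weight b (f ∷ fs) = ∣ apply f b ∣ ℕ.+ weight b fs

      perturb : ∀ basis b w t fs → weight b fs ℕ.< ∣ t ∣ →
                All (Generic basis w) fs → All (Generic basis (comb t w b)) fs
      perturb basis b w t [] _ [] = []
      perturb basis b w t (f ∷ fs) small (gen ∷ gens) =
        All.map (λ imp fb eq → dominant t (apply f w) (apply f b) (imp fb)
                   (ℕₚ.≤-<-trans (ℕₚ.m≤m+n _ _) small)
                   (trans (sym (linear f t w b)) eq)) gen
        ∷ perturb basis b w t fs (ℕₚ.≤-<-trans (ℕₚ.m≤n+m _ _) small) gens

    -- Induction on the forms. If the new form vanishes at `w` but not at a basis vector `b`, pass
    -- to t w + b: the new form takes its value at `b`, and since t exceeds the sum of the absolute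
    -- values at `b` of the earlier forms, none of those loses a nonzero value.
    generic : V → (basis : List V) (fs : List Functional) → ∃ λ w → All (Generic basis w) fs
    generic v₀ basis [] = v₀ , []
    generic v₀ basis (f ∷ fs) with generic v₀ basis fs
    ... | w , gens with Any.any? (λ b → ¬? (apply f b ℤₚ.≟ 0ℤ)) basis
    ... | no none = w , (All.tabulate λ b∈ fb≢0 → ⊥-elim (none (Any.map (λ eq → subst (λ b → apply f b ≢ 0ℤ) eq fb≢0) b∈))) ∷ gens
    ... | yes some with apply f w ℤₚ.≟ 0ℤ
    ...   | no fw≢0 = w , All.tabulate (λ _ _ → fw≢0) ∷ gens
    ...   | yes fw≡0 = comb t w b , All.tabulate (λ _ _ eq → fb≢0 (trans (sym (fw′ (apply f b))) (trans (sym (linear f t w b)) eq)))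
                       ∷ perturb basis b w t fs ℕₚ.≤-refl gens
      where
      b = proj₁ (Any.satisfied some)
      fb≢0 = proj₂ (Any.satisfied some)
      t = + suc (weight b fs)
      fw′ : ∀ y → t * apply f w + y ≡ y
      fw′ y = trans (cong (λ z → t * z + y) fw≡0) (trans (cong (_+ y) (ℤₚ.*-zeroʳ t)) (ℤₚ.+-identityˡ y))

  vcomb : ∀ {m} → ℤ → Vec ℤ m → Vec ℤ m → Vec ℤ m
  vcomb t = Vec.zipWith (λ x y → t * x + y)

  module Homogeneous where
    private
      module L {m} = Linear (vcomb {m})
      Fun : ℕ → Set
      Fun m = L.Functional {m}
    open L

    private
      0v : ∀ {m} → Vec ℤ m
      0v = Vec.replicate _ 0ℤ

      comb-0v : ∀ {m} t → vcomb {m} t 0v 0v ≡ 0v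
      comb-0v {zero} t = refl
      comb-0v {suc m} t = cong₂ _∷_ (trans (ℤₚ.+-identityʳ _) (ℤₚ.*-zeroʳ t)) (comb-0v t)

      scale : ∀ {m} → ℤ → Vec ℤ m → Vec ℤ m
      scale t v = vcomb t v 0v

      apply-0v : ∀ {m} (f : Fun m) → apply f 0v ≡ 0ℤ
      apply-0v f = cancel (trans (sym (cong (apply f) (comb-0v 1ℤ))) (linear f 1ℤ 0v 0v))
        where
        cancel : ∀ {x} → x ≡ 1ℤ * x + x → x ≡ 0ℤ
        cancel {x} eq = trans (ring x) (trans (cong (_- x) (sym eq)) (ℤₚ.+-inverseʳ x))
          where
          ring : ∀ x → x ≡ (1ℤ * x + x) - x
          ring = solve-∀

      apply-scale : ∀ {m} (f : Fun m) t v → apply f (scale t v) ≡ t * apply f v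
      apply-scale f t v = trans (linear f t v 0v) (trans (cong (_+_ (t * apply f v)) (apply-0v f)) (ℤₚ.+-identityʳ _))

      e₀ : ∀ {m} → Vec ℤ (suc m)
      e₀ = 1ℤ ∷ 0v

      comb-identity : ∀ {m} (v : Vec ℤ m) h → vcomb h 0v v ≡ v
      comb-identity [] h = refl
      comb-identity (x ∷ v) h = cong₂ _∷_ (trans (cong (_+ x) (ℤₚ.*-zeroʳ h)) (ℤₚ.+-identityˡ x)) (comb-identity v h)

      apply-∷ : ∀ {m} (f : Fun (suc m)) h v → apply f (h ∷ v) ≡ h * apply f e₀ + apply f (0ℤ ∷ v)
      apply-∷ f h v = trans (cong (apply f) (cong₂ _∷_ (sym (trans (ℤₚ.+-identityʳ _) (ℤₚ.*-identityʳ h))) (sym (comb-identity v h)))) (linear f h e₀ (0ℤ ∷ v))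

      tailᶠ : ∀ {m} → Fun (suc m) → Fun m
      tailᶠ f = functional (λ v → apply f (0ℤ ∷ v)) λ t v w →
        trans (cong (λ z → apply f (z ∷ vcomb t v w)) (sym (trans (ℤₚ.+-identityʳ _) (ℤₚ.*-zeroʳ t)))) (linear f t (0ℤ ∷ v) (0ℤ ∷ w))

      -- Cross-multiplication removes the first unknown without division, which keeps everything in
      -- ℤ.
      eliminate : ∀ {m} → Fun (suc m) → Fun (suc m) → Fun m
      eliminate p f = (apply p e₀ ⊡ tailᶠ f) ⊟ (apply f e₀ ⊡ tailᶠ p)

      Nonzero : ∀ {m} → Vec ℤ m → Set
      Nonzero v = ¬ (v ≡ 0v)

      data Pivot {m} (Fs : List (Fun (suc m))) : Set where
        none : All (λ f → apply f e₀ ≡ 0ℤ) Fs → Pivot Fs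
        some : (p : Fun (suc m)) → apply p e₀ ≢ 0ℤ → (Gs : List (Fun (suc m))) → length Fs ≡ suc (length Gs) →
               (∀ {x : Vec ℤ (suc m)} → apply p x ≡ 0ℤ → All (λ f → apply f x ≡ 0ℤ) Gs → All (λ f → apply f x ≡ 0ℤ) Fs) → Pivot Fs

      pivot : ∀ {m} (Fs : List (Fun (suc m))) → Pivot Fs
      pivot [] = none []
      pivot (f ∷ Fs) with apply f e₀ ℤₚ.≟ 0ℤ
      ... | no f≢0 = some f f≢0 Fs refl (λ fx all → fx ∷ all)
      ... | yes f≡0 with pivot Fs
      ...   | none all = none (f≡0 ∷ all)
      ...   | some p p≢0 Gs len back = some p p≢0 (f ∷ Gs) (cong suc len) λ { px (fx ∷ all) → fx ∷ back px all }

      length-map-eliminate : ∀ {m} (p : Fun (suc m)) Gs → length (List.map (eliminate p) Gs) ≡ length Gs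
      length-map-eliminate p [] = refl
      length-map-eliminate p (_ ∷ Gs) = cong suc (length-map-eliminate p Gs)

    -- Induction on the number of unknowns. If no equation involves the first unknown, the first
    -- unit vector is a solution. Otherwise a solution `y` of the eliminated system is scaled by the
    -- leading coefficient `P` of the pivot, so that the first unknown is the integer - Q instead of
    -- - Q / P.
    solve : ∀ {m} (Fs : List (Fun m)) → length Fs ℕ.< m → ∃ λ x → Nonzero x × All (λ f → apply f x ≡ 0ℤ) Fs
    solve {suc m} Fs (s≤s len) with pivot Fs
    ... | none all = e₀ , (λ ()) , all
    ... | some p p≢0 Gs eq back = x , nonzero , back px (extend Gs (proj₂ (proj₂ rec)))
      where
      rec = solve {m} (List.map (eliminate p) Gs) (subst (ℕ._≤ m) (trans eq (cong suc (sym (length-map-eliminate p Gs)))) len)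
      y = proj₁ rec
      P = apply p e₀
      Q = apply p (0ℤ ∷ y)
      x : Vec ℤ (suc m)
      x = - Q ∷ scale P y
      value : ∀ f → apply f x ≡ - Q * apply f e₀ + P * apply f (0ℤ ∷ y)
      value f = trans (apply-∷ f (- Q) (scale P y)) (cong (_+_ (- Q * apply f e₀)) (apply-scale (tailᶠ f) P y))
      px : apply p x ≡ 0ℤ
      px = trans (value p) (ring P Q)
        where
        ring : ∀ P Q → - Q * P + P * Q ≡ 0ℤ
        ring = solve-∀
      extend : ∀ Gs → All (λ f → apply f y ≡ 0ℤ) (List.map (eliminate p) Gs) → All (λ f → apply f x ≡ 0ℤ) Gs
      extend [] [] = []
      extend (f ∷ Gs) (fy ∷ all) = trans (value f) (trans (ring P Q (apply f e₀) (apply f (0ℤ ∷ y))) fy) ∷ extend Gs all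
        where
        ring : ∀ P Q a b → - Q * a + P * b ≡ P * b - a * Q
        ring = solve-∀
      scale-nonzero : ∀ {m} (v : Vec ℤ m) → scale P v ≡ 0v → v ≡ 0v
      scale-nonzero [] _ = refl
      scale-nonzero (z ∷ v) e = cong₂ _∷_
        ([ (λ P≡0 → ⊥-elim (p≢0 P≡0)) , (λ z≡0 → z≡0) ]′ (ℤₚ.i*j≡0⇒i≡0∨j≡0 P (trans (sym (ℤₚ.+-identityʳ _)) (cong Vec.head e))))
        (scale-nonzero v (cong Vec.tail e))
      nonzero : ¬ (x ≡ 0v)
      nonzero e = proj₁ (proj₂ rec) (scale-nonzero y (cong Vec.tail e))

-- From integer drawings to point sets over the real field.

module Transfer where
  open import Data.Integer.Tactic.RingSolver using (solve-∀)
  open import Algebra.Bundles using (CommutativeRing)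
  open import Data.List.Membership.Propositional.Properties using (∈-map⁻)
  open import Function.Bundles using (mk⇔)
  open import Function.Definitions using (Injective)
  open import Relation.Binary.PropositionalEquality
  open import Relation.Binary.Structures using (IsTotalOrder)

  Hits : Maybe ℕ → ℤ × ℤ → ℤ × ℤ → Set
  Hits nothing  (x₁ , _)  (x₂ , _)  = x₁ ≡ x₂
  Hits (just m) (x₁ , y₁) (x₂ , y₂) = y₂ ℤ.- y₁ ≡ ℤ.+ m ℤ.* (x₂ ℤ.- x₁)

  record IntegerDrawing {n} (G : Graph n) (slopes : List (Maybe ℕ)) : Set where
    field
      pos      : Fin n → ℤ × ℤ
      distinct : ∀ {u v} → u ≢ v → pos u ≢ pos v
      edge     : ∀ {u v} → Graph.E G u v ≡ true → ∃ λ σ → σ ∈ slopes × Hits σ (pos u) (pos v)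
      nonedge  : ∀ {u v} → u ≢ v → Graph.E G u v ≡ false → ∀ {σ} → σ ∈ slopes → ¬ Hits σ (pos u) (pos v)

  module _ (R : RealField) where
    open RealField R
    open Plane R

    private
      ring : CommutativeRing _ _
      ring = record { isCommutativeRing = isCommutativeRing }

      module C = CommutativeRing ring
      open RingProperties C.ring using (-‿distribˡ-*; -‿involutive; +-cancelˡ; +-cancelʳ)
      module O = IsTotalOrder isTotalOrder

    -- Embedding the natural numbers suffices: a drawing is first translated to nonnegative
    -- coordinates, by the sums of the absolute values, and the line equations are rewritten without
    -- subtraction. What is needed of `ι` is then that it is an injective semiring homomorphism.
    ι : ℕ → ℝ
    ι zero = 0ᵣ
    ι (suc n) = 1ᵣ + ι n

    ι-+ : ∀ m n → ι (m ℕ.+ n) ≡ ι m + ι n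
    ι-+ zero n = sym (C.+-identityˡ (ι n))
    ι-+ (suc m) n = trans (cong (1ᵣ +_) (ι-+ m n)) (sym (C.+-assoc 1ᵣ (ι m) (ι n)))

    ι-* : ∀ m n → ι (m ℕ.* n) ≡ ι m * ι n
    ι-* zero n = sym (C.zeroˡ (ι n))
    ι-* (suc m) n = trans (ι-+ n (m ℕ.* n)) (trans (cong (ι n +_) (ι-* m n))
      (sym (trans (C.distribʳ (ι n) 1ᵣ (ι m)) (cong (_+ ι m * ι n) (C.*-identityˡ (ι n))))))

    private
      0≤1 : 0ᵣ ≤ᵣ 1ᵣ
      0≤1 with O.total 0ᵣ 1ᵣ
      ... | inj₁ p = p
      ... | inj₂ p = subst (0ᵣ ≤ᵣ_) sq (*-nonneg (- 1ᵣ) (- 1ᵣ) q q)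
        where
        q : 0ᵣ ≤ᵣ - 1ᵣ
        q = subst₂ _≤ᵣ_ (C.-‿inverseʳ 1ᵣ) (C.+-identityˡ (- 1ᵣ)) (+-mono-≤ 1ᵣ 0ᵣ (- 1ᵣ) p)
        sq : (- 1ᵣ) * (- 1ᵣ) ≡ 1ᵣ
        sq = trans (sym (-‿distribˡ-* 1ᵣ (- 1ᵣ))) (trans (cong -_ (C.*-identityˡ (- 1ᵣ))) (-‿involutive 1ᵣ))

      0≤ι : ∀ n → 0ᵣ ≤ᵣ ι n
      0≤ι zero = O.reflexive refl
      0≤ι (suc n) = O.trans 0≤1 (subst₂ _≤ᵣ_ (C.+-identityˡ 1ᵣ) (C.+-comm (ι n) 1ᵣ) (+-mono-≤ 0ᵣ (ι n) 1ᵣ (0≤ι n)))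

      -- Characteristic zero comes from the order: 1 is nonnegative, being a square if nothing else,
      -- hence 1 ≤ ι (suc n).
      ιsuc≢0 : ∀ n → ι (suc n) ≢ 0ᵣ
      ιsuc≢0 n eq = 0≢1 (O.antisym 0≤1 (subst (1ᵣ ≤ᵣ_) eq
        (subst₂ _≤ᵣ_ (C.+-identityˡ 1ᵣ) (C.+-comm (ι n) 1ᵣ) (+-mono-≤ 0ᵣ (ι n) 1ᵣ (0≤ι n)))))

    ι-injective : ∀ {m n} → ι m ≡ ι n → m ≡ n
    ι-injective {zero} {zero} _ = refl
    ι-injective {zero} {suc n} eq = ⊥-elim (ιsuc≢0 n (sym eq))
    ι-injective {suc m} {zero} eq = ⊥-elim (ιsuc≢0 m eq)
    ι-injective {suc m} {suc n} eq = cong suc (ι-injective (+-cancelˡ 1ᵣ _ _ eq))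

    private
      restore : ∀ a b → (a + - b) + b ≡ a
      restore a b = trans (C.+-assoc a (- b) b) (trans (cong (a +_) (C.-‿inverseˡ b)) (C.+-identityʳ a))

      regroup : ∀ b c d m → m * (c + - d) + (b + m * d) ≡ b + m * c
      regroup b c d m = trans (sym (C.+-assoc (m * (c + - d)) b (m * d)))
        (trans (cong (_+ m * d) (C.+-comm (m * (c + - d)) b))
        (trans (C.+-assoc b (m * (c + - d)) (m * d))
        (cong (b +_) (trans (sym (C.distribˡ m (c + - d) d)) (cong (m *_) (restore c d))))))

      unsubtract : ∀ {a b c d m} → a -ᵣ b ≡ m * (c -ᵣ d) → a + m * d ≡ b + m * c
      unsubtract {a} {b} {c} {d} {m} eq = trans (cong (_+ m * d) (sym (restore a b)))
        (trans (C.+-assoc (a + - b) b (m * d)) (trans (cong (_+ (b + m * d)) eq) (regroup b c d m)))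

      subtract : ∀ {a b c d m} → a + m * d ≡ b + m * c → a -ᵣ b ≡ m * (c -ᵣ d)
      subtract {a} {b} {c} {d} {m} eq = +-cancelʳ (b + m * d) _ _
        (trans (sym (C.+-assoc (a + - b) b (m * d))) (trans (cong (_+ m * d) (restore a b)) (trans eq (sym (regroup b c d m)))))

      sumAbs : ∀ {n} → (Fin n → ℤ) → ℕ
      sumAbs {zero} f = 0
      sumAbs {suc n} f = ∣ f Fin.zero ∣ ℕ.+ sumAbs (λ i → f (Fin.suc i))

      ≤sumAbs : ∀ {n} (f : Fin n → ℤ) i → ∣ f i ∣ ℕ.≤ sumAbs f
      ≤sumAbs f Fin.zero = ℕₚ.m≤m+n _ _
      ≤sumAbs f (Fin.suc i) = ℕₚ.≤-trans (≤sumAbs (λ i → f (Fin.suc i)) i) (ℕₚ.m≤n+m _ _)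

      natural : ∀ x C → ∣ x ∣ ℕ.≤ C → ∃ λ k → ℤ.+ k ≡ x ℤ.+ ℤ.+ C
      natural (ℤ.+ a) C le = a ℕ.+ C , refl
      natural (ℤ.-[1+ a ]) C le = C ℕ.∸ suc a , sym (ℤₚ.⊖-≥ le)

    realize : ∀ {n} {G : Graph n} {slopes} → IntegerDrawing G slopes → RealizedBy R G (List.map (Maybe.map ι) slopes)
    realize {n} {G} {slopes} D = place , injective , λ u v u≢v → mk⇔ (to u v u≢v) (from u v u≢v)
      where
      open IntegerDrawing D
      X Y : Fin n → ℤ
      X v = proj₁ (pos v)
      Y v = proj₂ (pos v)
      Cx = sumAbs X
      Cy = sumAbs Y
      nX nY : Fin n → ℕ
      nX v = proj₁ (natural (X v) Cx (≤sumAbs X v))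
      nY v = proj₁ (natural (Y v) Cy (≤sumAbs Y v))
      nX≡ : ∀ v → ℤ.+ nX v ≡ X v ℤ.+ ℤ.+ Cx
      nX≡ v = proj₂ (natural (X v) Cx (≤sumAbs X v))
      nY≡ : ∀ v → ℤ.+ nY v ≡ Y v ℤ.+ ℤ.+ Cy
      nY≡ v = proj₂ (natural (Y v) Cy (≤sumAbs Y v))
      unshift : ∀ {x y} c → x ℤ.+ c ≡ y ℤ.+ c → x ≡ y
      unshift {x} {y} c eq = trans (e x c) (trans (cong (ℤ._- c) eq) (sym (e y c)))
        where
        e : ∀ x c → x ≡ (x ℤ.+ c) ℤ.- c
        e = solve-∀
      nX-inj : ∀ u v → nX u ≡ nX v → X u ≡ X v
      nX-inj u v eq = unshift (ℤ.+ Cx) (trans (sym (nX≡ u)) (trans (cong ℤ.+_ eq) (nX≡ v)))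
      nY-inj : ∀ u v → nY u ≡ nY v → Y u ≡ Y v
      nY-inj u v eq = unshift (ℤ.+ Cy) (trans (sym (nY≡ u)) (trans (cong ℤ.+_ eq) (nY≡ v)))
      nX-cong : ∀ u v → X u ≡ X v → nX u ≡ nX v
      nX-cong u v eq = ℤₚ.+-injective (trans (nX≡ u) (trans (cong (ℤ._+ ℤ.+ Cx) eq) (sym (nX≡ v))))
      place : Fin n → Point
      place v = ι (nX v) , ι (nY v)
      injective : Injective _≡_ _≡_ place
      injective {u} {v} eq with u Fin.≟ v
      ... | yes u≡v = u≡v
      ... | no u≢v = ⊥-elim (distinct u≢v (cong₂ _,_ (nX-inj u v (ι-injective (cong proj₁ eq))) (nY-inj u v (ι-injective (cong proj₂ eq)))))
      hits⇒ : ∀ u v m → Hits (just m) (pos u) (pos v) → nY v ℕ.+ m ℕ.* nX u ≡ nY u ℕ.+ m ℕ.* nX v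
      hits⇒ u v m h = ℤₚ.+-injective (trans (lift v u) (trans (e₁ (Y v) (Y u) (X u) (ℤ.+ m) (ℤ.+ Cx) (ℤ.+ Cy))
        (trans (cong (λ z → z ℤ.+ (Y u ℤ.+ ℤ.+ Cy ℤ.+ ℤ.+ m ℤ.* (X u ℤ.+ ℤ.+ Cx))) h) (trans (e₂ (Y u) (X v) (X u) (ℤ.+ m) (ℤ.+ Cx) (ℤ.+ Cy)) (sym (lift u v))))))
        where
        lift : ∀ a b → ℤ.+ (nY a ℕ.+ m ℕ.* nX b) ≡ (Y a ℤ.+ ℤ.+ Cy) ℤ.+ ℤ.+ m ℤ.* (X b ℤ.+ ℤ.+ Cx)
        lift a b = trans (cong (λ z → ℤ.+ nY a ℤ.+ z) (ℤₚ.pos-* m (nX b))) (cong₂ (λ y x → y ℤ.+ ℤ.+ m ℤ.* x) (nY≡ a) (nX≡ b))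
        e₁ : ∀ a b d m s t → (a ℤ.+ t) ℤ.+ m ℤ.* (d ℤ.+ s) ≡ (a ℤ.- b) ℤ.+ (b ℤ.+ t ℤ.+ m ℤ.* (d ℤ.+ s))
        e₁ = solve-∀
        e₂ : ∀ b c d m s t → m ℤ.* (c ℤ.- d) ℤ.+ (b ℤ.+ t ℤ.+ m ℤ.* (d ℤ.+ s)) ≡ (b ℤ.+ t) ℤ.+ m ℤ.* (c ℤ.+ s)
        e₂ = solve-∀
      ⇒hits : ∀ u v m → nY v ℕ.+ m ℕ.* nX u ≡ nY u ℕ.+ m ℕ.* nX v → Hits (just m) (pos u) (pos v)
      ⇒hits u v m eq = trans (e₁ (Y v) (Y u) (X u) (ℤ.+ m) (ℤ.+ Cx) (ℤ.+ Cy))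
        (trans (cong (λ z → z ℤ.- (Y u ℤ.+ ℤ.+ Cy ℤ.+ ℤ.+ m ℤ.* (X u ℤ.+ ℤ.+ Cx))) (trans (sym (lift v u)) (trans (cong ℤ.+_ eq) (lift u v))))
          (e₂ (Y u) (X v) (X u) (ℤ.+ m) (ℤ.+ Cx) (ℤ.+ Cy)))
        where
        lift : ∀ a b → ℤ.+ (nY a ℕ.+ m ℕ.* nX b) ≡ (Y a ℤ.+ ℤ.+ Cy) ℤ.+ ℤ.+ m ℤ.* (X b ℤ.+ ℤ.+ Cx)
        lift a b = trans (cong (λ z → ℤ.+ nY a ℤ.+ z) (ℤₚ.pos-* m (nX b))) (cong₂ (λ y x → y ℤ.+ ℤ.+ m ℤ.* x) (nY≡ a) (nX≡ b))
        e₁ : ∀ a b d m s t → a ℤ.- b ≡ ((a ℤ.+ t) ℤ.+ m ℤ.* (d ℤ.+ s)) ℤ.- (b ℤ.+ t ℤ.+ m ℤ.* (d ℤ.+ s))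
        e₁ = solve-∀
        e₂ : ∀ b c d m s t → ((b ℤ.+ t) ℤ.+ m ℤ.* (c ℤ.+ s)) ℤ.- (b ℤ.+ t ℤ.+ m ℤ.* (d ℤ.+ s)) ≡ m ℤ.* (c ℤ.- d)
        e₂ = solve-∀
      ι-affine : ∀ a m x → ι (a ℕ.+ m ℕ.* x) ≡ ι a + ι m * ι x
      ι-affine a m x = trans (ι-+ a (m ℕ.* x)) (cong (ι a +_) (ι-* m x))
      slope⇒ : ∀ u v → u ≢ v → ∀ σ → Hits σ (pos u) (pos v) → HasSlope (place u) (place v) (Maybe.map ι σ)
      slope⇒ u v u≢v nothing h = cong ι (nX-cong u v h)
      slope⇒ u v u≢v (just m) h = x≢ , subtract (trans (sym (ι-affine (nY v) m (nX u))) (trans (cong ι (hits⇒ u v m h)) (ι-affine (nY u) m (nX v))))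
        where
        -- A finite slope demands distinct abscissae. If they agreed, the line equation would make
        -- the ordinates agree too, against `distinct`.
        x≢ : ι (nX u) ≢ ι (nX v)
        x≢ eq = distinct u≢v (cong₂ _,_ Xeq (nY-inj u v (sym (ℕₚ.+-cancelʳ-≡ (m ℕ.* nX u) (nY v) (nY u) (trans (hits⇒ u v m h) (cong (λ z → nY u ℕ.+ m ℕ.* z) (sym nXeq)))))))
          where
          nXeq = ι-injective {nX u} {nX v} eq
          Xeq = nX-inj u v nXeq
      ⇒slope : ∀ u v σ → HasSlope (place u) (place v) (Maybe.map ι σ) → Hits σ (pos u) (pos v)
      ⇒slope u v nothing h = nX-inj u v (ι-injective h)
      ⇒slope u v (just m) (_ , h) = ⇒hits u v m (ι-injective (trans (ι-affine (nY v) m (nX u)) (trans (unsubtract h) (sym (ι-affine (nY u) m (nX v))))))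
      to : ∀ u v → u ≢ v → Graph.E G u v ≡ true → SlopeIn (List.map (Maybe.map ι) slopes) (place u) (place v)
      to u v u≢v e with edge e
      ... | σ , σ∈ , h = Maybe.map ι σ , ∈-map⁺ (Maybe.map ι) σ∈ , slope⇒ u v u≢v σ h
      from : ∀ u v → u ≢ v → SlopeIn (List.map (Maybe.map ι) slopes) (place u) (place v) → Graph.E G u v ≡ true
      from u v u≢v (τ , τ∈ , h) with Graph.E G u v in eq | ∈-map⁻ (Maybe.map ι) τ∈
      ... | true | _ = refl
      ... | false | σ , σ∈ , refl = ⊥-elim (nonedge u≢v eq σ∈ (⇒slope u v σ h))

-- Vertex orders of maximum total weight.

module Order where
  open import Data.Nat using (_+_; _*_)
  open import Data.Nat.Properties
  open import Data.List using (reverse; last; filter; [_])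
  open import Data.List.Properties using (++-assoc; unfold-reverse; ++-identityʳ)
  open import Data.List.Extrema.Nat using (argmax; argmax-all; f[xs]≤f[argmax])
  open import Data.List.Membership.Propositional.Properties using (∈-cartesianProductWith⁻)
  open import Data.List.Relation.Binary.Permutation.Propositional using (refl; prep; swap; trans; ↭-sym)
  open import Data.List.Relation.Binary.Permutation.Propositional.Properties using (∈-resp-↭; ↭-length; ++⁺ˡ; ++⁺ʳ; ++-comm; ↭-reverse; All-resp-↭)
  open import Data.Nat.Tactic.RingSolver using (solve-∀)
  open import Relation.Binary.PropositionalEquality using (_≡_; cong; cong₂; sym; subst; subst₂)

  at : ∀ {A : Set} → List A → ℕ → Maybe A
  at [] _ = nothing
  at (x ∷ xs) zero = just x
  at (x ∷ xs) (suc i) = at xs i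

  before : ∀ {A : Set} → List A → ℕ → Maybe A
  before xs zero = nothing
  before xs (suc i) = at xs i

  at-++ : ∀ {A : Set} (xs ys : List A) → at (xs ++ ys) (length xs) ≡ head ys
  at-++ [] [] = ≡.refl
  at-++ [] (y ∷ ys) = ≡.refl
  at-++ (x ∷ xs) ys = at-++ xs ys

  before-++ : ∀ {A : Set} (xs ys : List A) → before (xs ++ ys) (length xs) ≡ last xs
  before-++ [] ys = ≡.refl
  before-++ (x ∷ []) ys = ≡.refl
  before-++ (x ∷ y ∷ xs) ys = before-++ (y ∷ xs) ys

  at-< : ∀ {A : Set} (xs : List A) i {x} → at xs i ≡ just x → i < length xs
  at-< (_ ∷ xs) zero _ = s≤s z≤n
  at-< (_ ∷ xs) (suc i) eq = s≤s (at-< xs i eq)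

  at-∈ : ∀ {A : Set} (xs : List A) i {x} → at xs i ≡ just x → x ∈ xs
  at-∈ (_ ∷ xs) zero ≡.refl = here ≡.refl
  at-∈ (_ ∷ xs) (suc i) eq = there (at-∈ xs i eq)

  ∈-at : ∀ {A : Set} {xs : List A} {x} → x ∈ xs → ∃ λ i → at xs i ≡ just x
  ∈-at (here ≡.refl) = 0 , ≡.refl
  ∈-at (there x∈) = suc (proj₁ (∈-at x∈)) , proj₂ (∈-at x∈)

  at-injective : ∀ {A : Set} {xs : List A} → Unique xs → ∀ i j {x} → at xs i ≡ just x → at xs j ≡ just x → i ≡ j
  at-injective {xs = _ ∷ xs} (x∉ ∷ u) zero zero _ _ = ≡.refl
  at-injective {xs = _ ∷ xs} (x∉ ∷ u) zero (suc j) ≡.refl eq = ⊥-elim (All.lookup x∉ (at-∈ xs j eq) ≡.refl)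
  at-injective {xs = _ ∷ xs} (x∉ ∷ u) (suc i) zero eq ≡.refl = ⊥-elim (All.lookup x∉ (at-∈ xs i eq) ≡.refl)
  at-injective {xs = _ ∷ xs} (x∉ ∷ u) (suc i) (suc j) e f = cong suc (at-injective u i j e f)

  split : ∀ {A : Set} (xs : List A) a → a ≤ length xs → ∃₂ λ P Q → xs ≡ P ++ Q × length P ≡ a
  split xs zero _ = [] , xs , ≡.refl , ≡.refl
  split (x ∷ xs) (suc a) (s≤s le) with split xs a le
  ... | P , Q , ≡.refl , ≡.refl = x ∷ P , Q , ≡.refl , ≡.refl

  split₃ : ∀ {A : Set} (xs : List A) a b → a < b → b ≤ length xs →
           ∃ λ P → ∃₂ λ z Q → ∃ λ S → xs ≡ P ++ (z ∷ Q) ++ S × length P ≡ a × length (P ++ z ∷ Q) ≡ b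
  split₃ (x ∷ xs) zero (suc b) _ (s≤s le) with split xs b le
  ... | Q , S , ≡.refl , ≡.refl = [] , x , Q , S , ≡.refl , ≡.refl , ≡.refl
  split₃ (x ∷ xs) (suc a) (suc b) (s≤s lt) (s≤s le) with split₃ xs a b lt le
  ... | P , z , Q , S , ≡.refl , ≡.refl , e = x ∷ P , z , Q , S , ≡.refl , ≡.refl , cong suc e

  Unique-resp-↭ : ∀ {A : Set} {xs ys : List A} → xs ↭ ys → Unique xs → Unique ys
  Unique-resp-↭ refl u = u
  Unique-resp-↭ (prep x p) (x∉ ∷ u) = All-resp-↭ p x∉ ∷ Unique-resp-↭ p u
  Unique-resp-↭ (swap x y p) ((x≢y ∷ x∉) ∷ y∉ ∷ u) = ((λ e → x≢y (sym e)) ∷ All-resp-↭ p y∉) ∷ All-resp-↭ p x∉ ∷ Unique-resp-↭ p u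
  Unique-resp-↭ (trans p q) u = Unique-resp-↭ q (Unique-resp-↭ p u)

  module Weighted {A : Set} (w : A → A → ℕ) (w-sym : ∀ x y → w x y ≡ w y x) where

    gapᵐ : Maybe A → Maybe A → ℕ
    gapᵐ (just x) (just y) = w x y
    gapᵐ _ _ = 0

    joint : List A → List A → ℕ
    joint P Q = gapᵐ (last P) (head Q)

    -- Gap i lies between the positions i - 1 and i. At both ends of the list it weighs 0, so a
    -- missing neighbour counts as a weak gap and needs no case of its own.
    gap : List A → ℕ → ℕ
    gap xs i = gapᵐ (before xs i) (at xs i)

    total : List A → ℕ
    total [] = 0
    total (x ∷ xs) = joint [ x ] xs + total xs

    total-++ : ∀ P Q → total (P ++ Q) ≡ total P + joint P Q + total Q
    total-++ [] Q = ≡.refl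
    total-++ (x ∷ []) Q = ≡.refl
    total-++ (x ∷ y ∷ P) Q = ≡.trans (cong (w x y +_) (total-++ (y ∷ P) Q))
      (≡.trans (sym (+-assoc (w x y) (total (y ∷ P) + joint (y ∷ P) Q) (total Q)))
        (cong (_+ total Q) (sym (+-assoc (w x y) (total (y ∷ P)) (joint (y ∷ P) Q)))))

    gap-++ : ∀ P Q → gap (P ++ Q) (length P) ≡ joint P Q
    gap-++ P Q = cong₂ gapᵐ (before-++ P Q) (at-++ P Q)

    last-∷ʳ : ∀ (P : List A) x → last (P ++ [ x ]) ≡ just x
    last-∷ʳ [] x = ≡.refl
    last-∷ʳ (y ∷ []) x = ≡.refl
    last-∷ʳ (y ∷ z ∷ P) x = last-∷ʳ (z ∷ P) x

    last-reverse : ∀ P → last (reverse P) ≡ head P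
    last-reverse [] = ≡.refl
    last-reverse (x ∷ P) = ≡.trans (cong last (unfold-reverse x P)) (last-∷ʳ (reverse P) x)

    head-++ : ∀ (P : List A) Q {x} → head P ≡ just x → head (P ++ Q) ≡ just x
    head-++ (y ∷ P) Q eq = eq

    head-reverse : ∀ P {x} → last P ≡ just x → head (reverse P) ≡ just x
    head-reverse (x ∷ []) eq = eq
    head-reverse (x ∷ y ∷ P) eq = ≡.trans (cong head (unfold-reverse x (y ∷ P))) (head-++ (reverse (y ∷ P)) [ x ] (head-reverse (y ∷ P) eq))

    last-++ : ∀ (P : List A) z Q → last (P ++ z ∷ Q) ≡ last (z ∷ Q)
    last-++ [] z Q = ≡.refl
    last-++ (x ∷ []) z Q = ≡.refl
    last-++ (x ∷ y ∷ P) z Q = last-++ (y ∷ P) z Q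

    total-reverse : ∀ P → total (reverse P) ≡ total P
    total-reverse [] = ≡.refl
    total-reverse (x ∷ P) = ≡.trans (cong total (unfold-reverse x P)) (≡.trans (total-++ (reverse P) [ x ])
      (≡.trans (cong₂ _+_ (cong₂ _+_ (total-reverse P) (turn P)) ≡.refl) (ring (total P) (joint [ x ] P))))
      where
      turn : ∀ P → joint (reverse P) [ x ] ≡ joint [ x ] P
      turn [] = ≡.refl
      turn (y ∷ P) = ≡.trans (cong (λ l → gapᵐ l (just x)) (last-reverse (y ∷ P))) (w-sym y x)
      ring : ∀ a b → a + b + 0 ≡ b + a
      ring = solve-∀

    module _ {xs : List A} (maximal : ∀ {ys} → ys ↭ xs → total ys ≤ total xs) where

      private
        total₃ : ∀ P z Q S → total (P ++ (z ∷ Q) ++ S) ≡ total P + joint P (z ∷ Q) + (total (z ∷ Q) + joint (z ∷ Q) S + total S)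
        total₃ P z Q S = ≡.trans (total-++ P ((z ∷ Q) ++ S)) (cong (total P + joint P (z ∷ Q) +_) (total-++ (z ∷ Q) S))

        total₃≥ : ∀ P Q S → total P + joint P Q + (total Q + total S) ≤ total (P ++ Q ++ S)
        total₃≥ P [] S = subst₂ _≤_ (cong (_+ total S) (sym (≡.trans (cong (total P +_) joint-[]) (+-identityʳ (total P))))) (sym (total-++ P S))
          (+-monoˡ-≤ (total S) (m≤m+n (total P) (joint P S)))
          where
          joint-[] : joint P [] ≡ 0
          joint-[] with last P
          ... | nothing = ≡.refl
          ... | just _ = ≡.refl
        total₃≥ P (z ∷ Q) S = subst (total P + joint P (z ∷ Q) + (total (z ∷ Q) + total S) ≤_) (sym (total₃ P z Q S))
          (+-monoʳ-≤ (total P + joint P (z ∷ Q)) (+-monoˡ-≤ (total S) (m≤m+n (total (z ∷ Q)) (joint (z ∷ Q) S))))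

        -- The balance of an exchange: the parts keep their totals a, b, c, the joints j and k are
        -- cut, and a new joint g is gained.
        cancel₃ : ∀ {a b c j k g t} → t ≡ a + j + (b + k + c) → a + g + (b + c) ≤ t → g ≤ j + k
        cancel₃ {a} {b} {c} {j} {k} {g} ≡.refl le = +-cancelˡ-≤ (a + b + c) g (j + k) (subst₂ _≤_ (r₁ a b c g) (r₂ a b c j k) le)
          where
          r₁ : ∀ a b c g → a + g + (b + c) ≡ a + b + c + g
          r₁ = solve-∀
          r₂ : ∀ a b c j k → a + j + (b + k + c) ≡ a + b + c + (j + k)
          r₂ = solve-∀

        reverse-middle : ∀ (P Q S : List A) → P ++ reverse Q ++ S ↭ P ++ Q ++ S
        reverse-middle P Q S = ++⁺ˡ P (++⁺ʳ S (↭-reverse Q))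

        -- The four names tell on which side of x and of y the order is cut. With both cuts on the
        -- right, reversing the part that ends in y brings y next to x.
        right-right : ∀ P z Q S {x y} → xs ≡ P ++ (z ∷ Q) ++ S → last P ≡ just x → last (z ∷ Q) ≡ just y →
                      w x y ≤ joint P (z ∷ Q) + joint (z ∷ Q) S
        right-right P z Q S {x} {y} ≡.refl lP lQ = cancel₃ {total P} {total (z ∷ Q)} {total S} (total₃ P z Q S)
          (≤-trans (subst (_≤ total (P ++ reverse (z ∷ Q) ++ S))
              (cong₂ (λ g b → total P + g + (b + total S)) (cong₂ gapᵐ lP (head-reverse (z ∷ Q) lQ)) (total-reverse (z ∷ Q)))
              (total₃≥ P (reverse (z ∷ Q)) S))
            (maximal (reverse-middle P (z ∷ Q) S)))

        left-left : ∀ P z Q S {y} → xs ≡ P ++ (z ∷ Q) ++ S → head S ≡ just y →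
                    w z y ≤ joint P (z ∷ Q) + joint (z ∷ Q) S
        left-left P z Q S {y} ≡.refl hS = cancel₃ {total P} {total (z ∷ Q)} {total S} (total₃ P z Q S)
          (≤-trans bound (maximal (reverse-middle P (z ∷ Q) S)))
          where
          open ≤-Reasoning
          R = reverse (z ∷ Q)
          bound : total P + w z y + (total (z ∷ Q) + total S) ≤ total (P ++ R ++ S)
          bound = begin
            total P + w z y + (total (z ∷ Q) + total S)
              ≡⟨ cong₂ (λ g b → total P + g + (b + total S)) (sym (cong₂ gapᵐ (last-reverse (z ∷ Q)) hS)) (sym (total-reverse (z ∷ Q))) ⟩
            total P + joint R S + (total R + total S) ≡⟨ ring (total P) (joint R S) (total R) (total S) ⟩
            total P + (total R + joint R S + total S) ≡⟨ cong (total P +_) (sym (total-++ R S)) ⟩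
            total P + total (R ++ S) ≤⟨ +-monoˡ-≤ (total (R ++ S)) (m≤m+n (total P) (joint P (R ++ S))) ⟩
            total P + joint P (R ++ S) + total (R ++ S) ≡⟨ sym (total-++ P (R ++ S)) ⟩
            total (P ++ R ++ S) ∎
            where
            ring : ∀ p j r s → p + j + (r + s) ≡ p + (r + j + s)
            ring = solve-∀

        -- Both cuts lie between x and y; moving the part between them to the end of the order makes
        -- x and y neighbours.
        right-left : ∀ P z Q S {x y} → xs ≡ P ++ (z ∷ Q) ++ S → last P ≡ just x → head S ≡ just y →
                     w x y ≤ joint P (z ∷ Q) + joint (z ∷ Q) S
        right-left P z Q [] ≡.refl lP ()
        right-left P z Q S@(s ∷ S′) {x} ≡.refl lP ≡.refl = cancel₃ {total P} {total (z ∷ Q)} {total S} (total₃ P z Q S)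
          (≤-trans (subst (_≤ total (P ++ S ++ z ∷ Q)) (≡.trans (cong (λ g → total P + g + (total S + total (z ∷ Q))) (cong (λ l → gapᵐ l (just s)) lP))
               (cong (total P + w x s +_) (+-comm (total S) (total (z ∷ Q)))))
               (total₃≥ P S (z ∷ Q)))
            (maximal (++⁺ˡ P (++-comm S (z ∷ Q)))))

        -- With the cuts outside x and y, a third cut between them is needed: swapping the two inner
        -- parts puts y directly before x. The loss of three joints is the origin of the factor 3 in
        -- `no-weak-gap`.
        left-right : ∀ P z Q s S T {y} → xs ≡ P ++ (z ∷ Q) ++ (s ∷ S) ++ T → last (s ∷ S) ≡ just y →
                     w z y ≤ joint P (z ∷ Q) + joint (z ∷ Q) (s ∷ S) + joint (s ∷ S) T
        left-right P z Q s S T {y} ≡.refl lS = +-cancelˡ-≤ (total P + total B + total C + total T) _ _ (begin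
          (total P + total B + total C + total T) + w z y ≡⟨ cong (total P + total B + total C + total T +_) (≡.trans (w-sym z y) (cong (λ l → gapᵐ l (just z)) (sym lS))) ⟩
          (total P + total B + total C + total T) + joint C B ≡⟨ r₁ (total P) (total B) (total C) (total T) (joint C B) ⟩
          total P + (total C + joint C B + (total B + total T)) ≤⟨ +-monoʳ-≤ (total P) (total₃≥ C B T) ⟩
          total P + total (C ++ B ++ T) ≤⟨ +-monoˡ-≤ (total (C ++ B ++ T)) (m≤m+n (total P) (joint P (C ++ B ++ T))) ⟩
          total P + joint P (C ++ B ++ T) + total (C ++ B ++ T) ≡⟨ sym (total-++ P (C ++ B ++ T)) ⟩
          total (P ++ C ++ B ++ T) ≤⟨ maximal (++⁺ˡ P (subst₂ _↭_ (++-assoc C B T) (++-assoc B C T) (++⁺ʳ T (++-comm C B)))) ⟩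
          total (P ++ B ++ C ++ T) ≡⟨ total₃ P z Q (C ++ T) ⟩
          total P + joint P B + (total B + joint B C + total (C ++ T)) ≡⟨ cong (λ t → total P + joint P B + (total B + joint B C + t)) (total-++ C T) ⟩
          total P + joint P B + (total B + joint B C + (total C + joint C T + total T)) ≡⟨ r₂ (total P) (total B) (total C) (total T) (joint P B) (joint B C) (joint C T) ⟩
          (total P + total B + total C + total T) + (joint P B + joint B C + joint C T) ∎)
          where
          open ≤-Reasoning
          B = z ∷ Q
          C = s ∷ S
          r₁ : ∀ p b c t j → (p + b + c + t) + j ≡ p + (c + j + (b + t))
          r₁ = solve-∀
          r₂ : ∀ p b c t i j k → p + i + (b + j + (c + k + t)) ≡ (p + b + c + t) + (i + j + k)
          r₂ = solve-∀

        gap₃ : ∀ P z Q S → xs ≡ P ++ (z ∷ Q) ++ S →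
               gap xs (length P) ≡ joint P (z ∷ Q) × gap xs (length (P ++ z ∷ Q)) ≡ joint (z ∷ Q) S
        gap₃ P z Q S ≡.refl = gap-++ P ((z ∷ Q) ++ S) ,
          ≡.trans (cong (λ l → gap l (length (P ++ z ∷ Q))) (sym (++-assoc P (z ∷ Q) S)))
            (≡.trans (gap-++ (P ++ z ∷ Q) S) (cong (λ l → gapᵐ l (head S)) (last-++ P z Q)))

      at-last : ∀ P R {i x} → xs ≡ P ++ R → length P ≡ suc i → at xs i ≡ just x → last P ≡ just x
      at-last P R {i} ≡.refl eq ax = ≡.trans (sym (≡.trans (sym (cong (before (P ++ R)) eq)) (before-++ P R))) ax

      at-head : ∀ P R {i x} → xs ≡ P ++ R → length P ≡ i → at xs i ≡ just x → head R ≡ just x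
      at-head P R {i} ≡.refl eq ax = ≡.trans (sym (at-++ P R)) (≡.trans (cong (at (P ++ R)) eq) ax)

      two-weak : ∀ {i j x y h} a b → a < b → b ≤ length xs → suc i < j → at xs i ≡ just x → at xs j ≡ just y →
                 (a ≡ suc i × b ≡ suc j) ⊎ (a ≡ i × b ≡ j) ⊎ (a ≡ suc i × b ≡ j) →
                 gap xs a ≤ h → gap xs b ≤ h → w x y ≤ 2 * h
      two-weak {i} {j} {x} {y} {h} a b a<b b≤ i<j ax ay form ga gb with split₃ xs a b a<b b≤
      ... | P , z , Q , S , eq , lP , lPQ = ≤-trans (bound form) (+-mono-≤ ja (≤-trans jb (≤-reflexive (sym (+-identityʳ h)))))
        where
        ja : joint P (z ∷ Q) ≤ h
        ja = subst (_≤ h) (≡.trans (cong (gap xs) (sym lP)) (proj₁ (gap₃ P z Q S eq))) ga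
        jb : joint (z ∷ Q) S ≤ h
        jb = subst (_≤ h) (≡.trans (cong (gap xs) (sym lPQ)) (proj₂ (gap₃ P z Q S eq))) gb
        eq′ : xs ≡ (P ++ z ∷ Q) ++ S
        eq′ = ≡.trans eq (sym (++-assoc P (z ∷ Q) S))
        bound : _ → w x y ≤ joint P (z ∷ Q) + joint (z ∷ Q) S
        bound (inj₁ (≡.refl , ≡.refl)) = right-right P z Q S eq (at-last P _ eq lP ax)
          (≡.trans (sym (last-++ P z Q)) (at-last (P ++ z ∷ Q) S eq′ lPQ ay))
        bound (inj₂ (inj₁ (≡.refl , ≡.refl))) with at-head P _ eq lP ax
        ... | ≡.refl = left-left P z Q S eq (at-head (P ++ z ∷ Q) S eq′ lPQ ay)
        bound (inj₂ (inj₂ (≡.refl , ≡.refl))) = right-left P z Q S eq (at-last P _ eq lP ax) (at-head (P ++ z ∷ Q) S eq′ lPQ ay)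

      three-weak : ∀ {i j x y h} c → i < c → c ≤ j → at xs i ≡ just x → at xs j ≡ just y →
                   gap xs i ≤ h → gap xs c ≤ h → gap xs (suc j) ≤ h → w x y ≤ 3 * h
      three-weak {i} {j} {x} {y} {h} c i<c c≤j ax ay gi gc gj
        with split₃ xs c (suc j) (s≤s c≤j) (at-< xs j ay)
      ... | PQ , s , S , T , eq , lPQ , lS with split₃ PQ i c i<c (≤-reflexive (sym lPQ))
      ...   | P , z , Q , R , ≡.refl , lP , lR = finish R eq lR lPQ lS
        where
        finish : ∀ R → xs ≡ (P ++ (z ∷ Q) ++ R) ++ (s ∷ S) ++ T → length (P ++ z ∷ Q) ≡ c → length (P ++ (z ∷ Q) ++ R) ≡ c →
                 length ((P ++ (z ∷ Q) ++ R) ++ s ∷ S) ≡ suc j → w x y ≤ 3 * h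
        finish (r ∷ R) eq lR lPQ lS = ⊥-elim (m+1+n≢m _ (≡.trans (sym (length-++ (P ++ z ∷ Q) {r ∷ R})) (≡.trans (cong length (++-assoc P (z ∷ Q) (r ∷ R))) (≡.trans lPQ (sym lR)))))
        finish [] eq _ lPQ lS with at-head P _ eq₂ lP ax
          where
          eq₂ : xs ≡ P ++ ((z ∷ Q) ++ []) ++ (s ∷ S) ++ T
          eq₂ = ≡.trans eq (++-assoc P ((z ∷ Q) ++ []) ((s ∷ S) ++ T))
        ... | ≡.refl = ≤-trans (left-right P z Q s S T eq₁ (≡.trans (sym (last-++ (P ++ z ∷ Q) s S)) (at-last ((P ++ z ∷ Q) ++ s ∷ S) T eq₃ lS′ ay)))
            (≤-trans (+-mono-≤ (+-mono-≤ j₁ j₂) j₃) (≤-reflexive (ring h)))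
          where
          eq₁ : xs ≡ P ++ (z ∷ Q) ++ (s ∷ S) ++ T
          eq₁ = ≡.trans eq (≡.trans (cong (λ l → (P ++ l) ++ (s ∷ S) ++ T) (++-identityʳ (z ∷ Q))) (++-assoc P (z ∷ Q) ((s ∷ S) ++ T)))
          eq₄ : xs ≡ (P ++ z ∷ Q) ++ (s ∷ S) ++ T
          eq₄ = ≡.trans eq₁ (sym (++-assoc P (z ∷ Q) ((s ∷ S) ++ T)))
          eq₃ : xs ≡ ((P ++ z ∷ Q) ++ s ∷ S) ++ T
          eq₃ = ≡.trans eq₄ (sym (++-assoc (P ++ z ∷ Q) (s ∷ S) T))
          unnil : ∀ {l} → P ++ (z ∷ Q) ++ [] ≡ l → P ++ z ∷ Q ≡ l
          unnil = ≡.trans (cong (P ++_) (sym (++-identityʳ (z ∷ Q))))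
          lPQ′ : length (P ++ z ∷ Q) ≡ c
          lPQ′ = ≡.trans (cong length (unnil ≡.refl)) lPQ
          lS′ : length ((P ++ z ∷ Q) ++ s ∷ S) ≡ suc j
          lS′ = ≡.trans (cong (λ l → length (l ++ s ∷ S)) (unnil ≡.refl)) lS
          j₁ : joint P (z ∷ Q) ≤ h
          j₁ = subst (_≤ h) (≡.trans (cong (gap xs) (sym lP)) (proj₁ (gap₃ P z Q ((s ∷ S) ++ T) eq₁))) gi
          j₂ : joint (z ∷ Q) (s ∷ S) ≤ h
          j₂ = subst (_≤ h) (≡.trans (cong (gap xs) (sym lPQ′)) (proj₂ (gap₃ P z Q ((s ∷ S) ++ T) eq₁))) gc
          j₃ : joint (s ∷ S) T ≤ h
          j₃ = subst (_≤ h) (≡.trans (cong (gap xs) (sym lS′)) (proj₂ (gap₃ (P ++ z ∷ Q) s S T eq₄))) gj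
          ring : ∀ h → h + h + h ≡ 3 * h
          ring = solve-∀

      -- Otherwise reversing or moving the part between the two ends would join x to y and increase the total weight.
      no-weak-gap : ∀ {i j x y} h → suc i < j → at xs i ≡ just x → at xs j ≡ just y → 3 * h < w x y →
                    gap xs i ≤ h ⊎ gap xs (suc i) ≤ h → gap xs j ≤ h ⊎ gap xs (suc j) ≤ h →
                    ∀ c → i < c → c ≤ j → h < gap xs c
      no-weak-gap {i} {j} {x} {y} h i<j ax ay heavy wi wj c i<c c≤j with gap xs c ≤? h
      ... | no gc≰h = ≰⇒> gc≰h
      ... | yes gc≤h = ⊥-elim (go wi wj)
        where
        j<len = at-< xs j ay
        2h≤3h = *-monoˡ-≤ h {2} {3} (s≤s (s≤s z≤n))
        clash : w x y ≤ 2 * h → ⊥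
        clash le = <⇒≱ heavy (≤-trans le 2h≤3h)
        go : gap xs i ≤ h ⊎ gap xs (suc i) ≤ h → gap xs j ≤ h ⊎ gap xs (suc j) ≤ h → ⊥
        go (inj₁ gi) (inj₁ gj) = clash (two-weak i j (<-trans (n<1+n i) i<j) (<⇒≤ j<len) i<j ax ay (inj₂ (inj₁ (≡.refl , ≡.refl))) gi gj)
        go (inj₂ gi) (inj₁ gj) = clash (two-weak (suc i) j i<j (<⇒≤ j<len) i<j ax ay (inj₂ (inj₂ (≡.refl , ≡.refl))) gi gj)
        go (inj₂ gi) (inj₂ gj) = clash (two-weak (suc i) (suc j) (s≤s (<-trans (n<1+n i) i<j)) j<len i<j ax ay (inj₁ (≡.refl , ≡.refl)) gi gj)
        go (inj₁ gi) (inj₂ gj) = <⇒≱ heavy (three-weak c i<c c≤j ax ay gi gc≤h gj)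

  module _ {n : ℕ} where
    open DecMembership (Fin._≟_ {n}) using (_∈?_)

    words : ℕ → List (List (Fin n))
    words zero = [ [] ]
    words (suc k) = cartesianProductWith _∷_ (allFin n) (words k)

    ∈-words : ∀ xs → xs ∈ words (length xs)
    ∈-words [] = here ≡.refl
    ∈-words (x ∷ xs) = ∈-cartesianProductWith⁺ _∷_ (∈-allFin x) (∈-words xs)

    length-words : ∀ k {xs} → xs ∈ words k → length xs ≡ k
    length-words zero (here ≡.refl) = ≡.refl
    length-words (suc k) xs∈ with ∈-cartesianProductWith⁻ _∷_ (allFin n) (words k) xs∈
    ... | x , ys , _ , ys∈ , ≡.refl = cong suc (length-words k ys∈)

    private
      Complete : List (Fin n) → Set
      Complete xs = Unique xs × (∀ v → v ∈ xs)

      complete? : ∀ xs → Dec (Complete xs)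
      complete? xs = DecUnique.unique? Fin._≟_ xs ×-dec Finₚ.all? (λ v → v ∈? xs)

      Complete-resp-↭ : ∀ {xs ys} → xs ↭ ys → Complete xs → Complete ys
      Complete-resp-↭ p (u , c) = Unique-resp-↭ p u , λ v → ∈-resp-↭ p (c v)

    best-order : (f : List (Fin n) → ℕ) → ∃ λ xs → Unique xs × (∀ v → v ∈ xs) × (∀ {ys} → ys ↭ xs → f ys ≤ f xs)
    best-order f = best , proj₁ complete , proj₂ complete , λ {ys} p →
        All.lookup (f[xs]≤f[argmax] {f = f} (allFin n) candidates)
          (∈-filter⁺ complete? (subst (λ k → ys ∈ words k) (≡.trans (↭-length p) len) (∈-words ys)) (Complete-resp-↭ (↭-sym p) complete))
      where
      candidates = filter complete? (words (length (allFin n)))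
      best = argmax f (allFin n) candidates
      complete : Complete best
      complete = argmax-all f {P = Complete} {allFin n} {candidates} (allFin⁺ n , ∈-allFin)
        (All.tabulate λ {xs} xs∈ → proj₂ (∈-filter⁻ complete? {v = xs} {xs = words (length (allFin n))} xs∈))
      len : length best ≡ length (allFin n)
      len = argmax-all f {P = λ xs → length xs ≡ length (allFin n)} {allFin n} {candidates} ≡.refl
        (All.tabulate λ {xs} xs∈ → length-words _ (proj₁ (∈-filter⁻ complete? {v = xs} {xs = words (length (allFin n))} xs∈)))

-- Weights from triangles, and what maximality says about the edges left over.

module Arrange where
  open Order
  open import Data.Nat using (_*_; _≟_)
  open import Data.Nat.Properties
  open import Data.Bool using (T)
  open import Data.List using (filterᵇ)
  open import Data.List.Membership.Propositional.Properties using (∈-∃++; ∈-++⁻)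
  open import Data.List.Relation.Unary.Unique.Propositional.Properties using (filter⁺)
  open import Relation.Nullary.Decidable using (T?)
  open import Relation.Binary.PropositionalEquality using (_≡_; _≢_; refl; sym; trans; cong; cong₂; subst)

  unique-length : ∀ {A : Set} {ys xs : List A} → Unique ys → (∀ {y} → y ∈ ys → y ∈ xs) → length ys ≤ length xs
  unique-length {ys = []} _ _ = z≤n
  unique-length {ys = y ∷ ys} (y∉ ∷ u) sub with ∈-∃++ (sub (here refl))
  ... | P , Q , refl = subst (suc (length ys) ≤_) (sym (trans (length-++ P) (trans (+-suc (length P) (length Q)) (cong suc (sym (length-++ P))))))
      (s≤s (unique-length u sub′))
    where
    sub′ : ∀ {z} → z ∈ ys → z ∈ P ++ Q
    sub′ z∈ with ∈-++⁻ P (sub (there z∈))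
    ... | inj₁ z∈P = ∈-++⁺ˡ z∈P
    ... | inj₂ (here refl) = ⊥-elim (All.lookup y∉ z∈ refl)
    ... | inj₂ (there z∈Q) = ∈-++⁺ʳ P z∈Q

  module _ {n : ℕ} (p : Fin n → Bool) where

    members : List (Fin n)
    members = filterᵇ p (allFin n)

    ∈-members : ∀ {x} → p x ≡ true → x ∈ members
    ∈-members {x} px = ∈-filter⁺ (λ y → T? (p y)) (∈-allFin x) (subst T (sym px) _)

    members-∈ : ∀ {x} → x ∈ members → p x ≡ true
    members-∈ {x} x∈ = T⇒≡ (proj₂ (∈-filter⁻ (λ y → T? (p y)) {xs = allFin n} x∈))
      where
      T⇒≡ : ∀ {b} → T b → b ≡ true
      T⇒≡ {true} _ = refl

    members-unique : Unique members
    members-unique = filter⁺ (λ y → T? (p y)) (allFin⁺ n)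

  members-cong : ∀ {n} {p q : Fin n → Bool} → (∀ x → p x ≡ q x) → ∀ xs → filterᵇ p xs ≡ filterᵇ q xs
  members-cong pq [] = refl
  members-cong {p = p} {q} pq (x ∷ xs) with p x | q x | pq x
  ... | true | true | refl = cong (x ∷_) (members-cong pq xs)
  ... | false | false | refl = members-cong pq xs

  module Links (A : ℕ → ℕ → Set) where

    Lk : ℕ → Set
    Lk l = A l (suc l)

    Inner : ℕ → Set
    Inner zero = ⊥
    Inner (suc u) = Lk u × Lk (suc u)

    R : ℕ → ℕ → Set
    R u v = A u v × v ≢ suc u × u ≢ suc v

  -- All that the drawing uses of the graph, stated on positions. The last two fields are the yield
  -- of maximality: a remaining edge between two vertices that are not inner joins the ends of one
  -- path, and a triangle containing a link contains a second one.
  record Layout (n : ℕ) (A : ℕ → ℕ → Set) : Set where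
    open Links A
    field
      A?     : ∀ i j → Dec (A i j)
      A-sym  : ∀ {i j} → A i j → A j i
      A-irr  : ∀ {i} → ¬ A i i
      A-<    : ∀ {i j} → A i j → i < n
      deg≤3  : ∀ {v a b c d} → A v a → A v b → A v c → A v d →
               a ≢ b → a ≢ c → a ≢ d → b ≢ c → b ≢ d → c ≢ d → ⊥
      ends-same-path : ∀ {u v} → R u v → u < v → ¬ Inner u → ¬ Inner v → ∀ l → u ≤ l → l < v → Lk l
      triangle-links : ∀ {i z} → Lk i → R z i → R z (suc i) → ⊥

  module _ {n : ℕ} (G : Graph n) (deg : MaxDegreeAtMost G 3)
           (K₄-free : ∀ {a b c d} → Graph.E G a b ≡ true → Graph.E G a c ≡ true → Graph.E G a d ≡ true →
                      Graph.E G b c ≡ true → Graph.E G b d ≡ true → Graph.E G c d ≡ true → ⊥) where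

    open Graph G renaming (sym to E-sym)

    private
      common : Fin n → Fin n → Fin n → Bool
      common x y t = E x t ∧ E y t

      count : Fin n → Fin n → ℕ
      count x y = length (members (common x y))

      -- Each value exceeds three times the previous one, starting from 0 for non-edges, as
      -- `no-weak-gap` requires for h = 0, 1, 4. In degree three, adjacent vertices have at most two
      -- common neighbours, so the last clause means two.
      grade : ℕ → ℕ
      grade 0 = 1
      grade 1 = 4
      grade _ = 13

    -- Edges in triangles are heavier, and edges in two triangles heavier still, so that
    -- an order of maximum total weight contains two edges of every triangle.
    weight : Fin n → Fin n → ℕ
    weight x y = if E x y then grade (count x y) else 0

    weight-sym : ∀ x y → weight x y ≡ weight y x
    weight-sym x y rewrite E-sym x y =
      cong (λ l → if E y x then grade (length l) else 0) (members-cong (λ t → Boolₚ.∧-comm (E x t) (E y t)) (allFin n))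

    private
      both : ∀ {a b} → a ∧ b ≡ true → a ≡ true × b ≡ true
      both {true} {true} _ = refl , refl

      1≤grade : ∀ k → 1 ≤ grade k
      1≤grade 0 = s≤s z≤n
      1≤grade 1 = s≤s z≤n
      1≤grade (suc (suc k)) = s≤s z≤n

      weight>0 : ∀ {x y} → 0 < weight x y → E x y ≡ true
      weight>0 {x} {y} lt with E x y
      ... | true = refl

      edge-weight : ∀ {x y} → E x y ≡ true → 0 < weight x y
      edge-weight {x} {y} e rewrite e = 1≤grade (count x y)

      weight>1 : ∀ {x y} → 1 < weight x y → E x y ≡ true × ∃ λ t → E x t ≡ true × E y t ≡ true
      weight>1 {x} {y} lt with E x y | members (common x y) in eq
      weight>1 {x} {y} (s≤s ()) | true | []
      ... | true | t ∷ _ = refl , t , both (members-∈ (common x y) (subst (t ∈_) (sym eq) (here refl)))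

      weight>4 : ∀ {x y} → 4 < weight x y → E x y ≡ true × ∃₂ λ t t′ → t ≢ t′ × (E x t ≡ true × E y t ≡ true) × (E x t′ ≡ true × E y t′ ≡ true)
      weight>4 {x} {y} lt with E x y | members (common x y) in eq | members-unique (common x y)
      weight>4 {x} {y} (s≤s ()) | true | [] | _
      weight>4 {x} {y} (s≤s (s≤s (s≤s (s≤s ())))) | true | _ ∷ [] | _
      ... | true | t ∷ t′ ∷ _ | (t≢t′ ∷ _) ∷ _ = refl , t , t′ , t≢t′ ,
        both (members-∈ (common x y) (subst (t ∈_) (sym eq) (here refl))) ,
        both (members-∈ (common x y) (subst (t′ ∈_) (sym eq) (there (here refl))))

      triangle-weight : ∀ {x y t} → E x y ≡ true → E x t ≡ true → E y t ≡ true → 3 < weight x y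
      triangle-weight {x} {y} {t} e et et′ rewrite e =
        mono (unique-length {ys = t ∷ []} ([] ∷ []) λ { (here refl) → ∈-members (common x y) (cong₂ _∧_ et et′) })
        where
        mono : ∀ {k} → 1 ≤ k → 3 < grade k
        mono {suc zero} _ = ≤-refl
        mono {suc (suc k)} _ = s≤s (s≤s (s≤s (s≤s z≤n)))

      diamond-weight : ∀ {x y t t′} → E x y ≡ true → t ≢ t′ → E x t ≡ true → E y t ≡ true → E x t′ ≡ true → E y t′ ≡ true → 12 < weight x y
      diamond-weight {x} {y} {t} {t′} e t≢t′ a b c d rewrite e =
        mono (unique-length {ys = t ∷ t′ ∷ []} ((t≢t′ ∷ []) ∷ [] ∷ [])
          λ { (here refl) → ∈-members (common x y) (cong₂ _∧_ a b) ; (there (here refl)) → ∈-members (common x y) (cong₂ _∧_ c d) })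
        where
        mono : ∀ {k} → 2 ≤ k → 12 < grade k
        mono {suc (suc k)} _ = ≤-refl
        mono {suc zero} (s≤s ())

      module W = Weighted weight weight-sym

    module Positions (xs : List (Fin n)) (xs-unique : Unique xs) (xs-complete : ∀ v → v ∈ xs)
                     (xs-maximal : ∀ {ys} → ys ↭ xs → W.total ys ≤ W.total xs) where

      Adj : ℕ → ℕ → Set
      Adj i j = ∃₂ λ x y → at xs i ≡ just x × at xs j ≡ just y × E x y ≡ true

      private
        same : ∀ {i x y} → at xs i ≡ just x → at xs i ≡ just y → x ≡ y
        same p q = just-injective (trans (sym p) q)

        index : Fin n → ℕ
        index v = proj₁ (∈-at (xs-complete v))

        at-index : ∀ v → at xs (index v) ≡ just v
        at-index v = proj₂ (∈-at (xs-complete v))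

        distinct : ∀ {i j x y} → at xs i ≡ just x → at xs j ≡ just y → i ≢ j → x ≢ y
        distinct p q i≢j refl = i≢j (at-injective xs-unique _ _ p q)

        adj? : ∀ i j → Dec (Adj i j)
        adj? i j with at xs i | at xs j
        ... | nothing | _ = no λ ()
        ... | just x | nothing = no λ ()
        ... | just x | just y with E x y in eq
        ...   | true = yes (x , y , refl , refl , eq)
        ...   | false = no λ { (_ , _ , refl , refl , e) → case-false (trans (sym eq) e) }
          where
          case-false : false ≡ true → ⊥
          case-false ()

        adj-sym : ∀ {i j} → Adj i j → Adj j i
        adj-sym (x , y , p , q , e) = y , x , q , p , trans (E-sym y x) e

        adj-irr : ∀ {i} → ¬ Adj i i
        adj-irr (x , y , p , q , e) with same p q
        ... | refl with trans (sym e) (irrefl x)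
        ...   | ()

        adj-deg : ∀ {v a b c d} → Adj v a → Adj v b → Adj v c → Adj v d →
                  a ≢ b → a ≢ c → a ≢ d → b ≢ c → b ≢ d → c ≢ d → ⊥
        adj-deg (x , a , p , qa , ea) (_ , b , pb , qb , eb) (_ , c , pc , qc , ec) (_ , d , pd , qd , ed) ab ac ad bc bd cd
          with same p pb | same p pc | same p pd
        ... | refl | refl | refl = <⇒≱ (unique-length {ys = a ∷ b ∷ c ∷ d ∷ []}
            ((distinct qa qb ab ∷ distinct qa qc ac ∷ distinct qa qd ad ∷ []) ∷ (distinct qb qc bc ∷ distinct qb qd bd ∷ []) ∷ (distinct qc qd cd ∷ []) ∷ [] ∷ [])
            λ { (here refl) → ∈-members (E x) ea ; (there (here refl)) → ∈-members (E x) eb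
              ; (there (there (here refl))) → ∈-members (E x) ec ; (there (there (there (here refl)))) → ∈-members (E x) ed })
            (deg x)

        adj-K₄ : ∀ {a b c d} → Adj a b → Adj a c → Adj a d → Adj b c → Adj b d → Adj c d → ⊥
        adj-K₄ (a , b , pa , pb , ab) (_ , c , pa′ , pc , ac) (_ , d , pa″ , pd , ad) (_ , _ , pb′ , pc′ , bc) (_ , _ , pb″ , pd′ , bd) (_ , _ , pc″ , pd″ , cd)
          with same pa pa′ | same pa pa″ | same pb pb′ | same pb pb″ | same pc pc′ | same pc pc″ | same pd pd′ | same pd pd″
        ... | refl | refl | refl | refl | refl | refl | refl | refl = K₄-free ab ac ad bc bd cd

        third : ∀ {v a b c t} → Adj v a → Adj v b → Adj v c → a ≢ b → a ≢ c → b ≢ c → Adj v t → t ≡ a ⊎ t ≡ b ⊎ t ≡ c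
        third {a = a} {b} {c} {t} va vb vc ab ac bc vt with t ≟ a | t ≟ b | t ≟ c
        ... | yes e | _ | _ = inj₁ e
        ... | no _ | yes e | _ = inj₂ (inj₁ e)
        ... | no _ | no _ | yes e = inj₂ (inj₂ e)
        ... | no ta | no tb | no tc = ⊥-elim (adj-deg va vb vc vt ab ac (λ e → ta (sym e)) bc (λ e → tb (sym e)) (λ e → tc (sym e)))

        Adj≢ : ∀ {i j} → Adj i j → i ≢ j
        Adj≢ a refl = adj-irr a

        gap-pair : ∀ {i} → 0 < W.gap xs (suc i) → ∃₂ λ x y → at xs i ≡ just x × at xs (suc i) ≡ just y × W.gap xs (suc i) ≡ weight x y
        gap-pair {i} lt with at xs i | at xs (suc i)
        ... | just x | just y = x , y , refl , refl , refl

        gap>0 : ∀ {i} → 0 < W.gap xs (suc i) → Adj i (suc i)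
        gap>0 lt with gap-pair lt
        ... | x , y , p , q , eq = x , y , p , q , weight>0 (subst (0 <_) eq lt)

        gap>1 : ∀ {i} → 1 < W.gap xs (suc i) → Adj i (suc i) × ∃ λ t → Adj i t × Adj (suc i) t
        gap>1 lt with gap-pair (<-trans (s≤s z≤n) lt)
        ... | x , y , p , q , eq with weight>1 (subst (1 <_) eq lt)
        ...   | e , t , a , b = (x , y , p , q , e) , index t , (x , t , p , at-index t , a) , (y , t , q , at-index t , b)

        gap>4 : ∀ {i} → 4 < W.gap xs (suc i) → Adj i (suc i) × ∃₂ λ t t′ → t ≢ t′ × (Adj i t × Adj (suc i) t) × (Adj i t′ × Adj (suc i) t′)
        gap>4 lt with gap-pair (<-trans (s≤s z≤n) lt)
        ... | x , y , p , q , eq with weight>4 (subst (4 <_) eq lt)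
        ...   | e , t , t′ , t≢ , (a , b) , (c , d) = (x , y , p , q , e) , index t , index t′ ,
                (λ e′ → t≢ (same (at-index t) (trans (cong (at xs) e′) (at-index t′)))) ,
                ((x , t , p , at-index t , a) , (y , t , q , at-index t , b)) , ((x , t′ , p , at-index t′ , c) , (y , t′ , q , at-index t′ , d))

        strong-between : ∀ {i j} h → suc i < j → (a : Adj i j) → 3 * h < weight (proj₁ a) (proj₁ (proj₂ a)) →
                      W.gap xs i ≤ h ⊎ W.gap xs (suc i) ≤ h → W.gap xs j ≤ h ⊎ W.gap xs (suc j) ≤ h →
                      ∀ c → i < c → c ≤ j → h < W.gap xs c
        strong-between h i<j (x , y , p , q , e) heavy wi wj c = W.no-weak-gap xs-maximal h i<j p q heavy wi wj c

        -- The neighbours of `a` are b, s, s′, so `c` is one of s, s′. The two common neighbours of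
        -- `a` and `c` are then the other two neighbours of `a`, which makes s adjacent to s′ and
        -- completes a K₄ on a, b, s, s′.
        two-diamonds : ∀ {a b c s s′ t t′} → Adj a b → Adj a c → b ≢ c → s ≢ s′ → Adj a s → Adj b s → Adj a s′ → Adj b s′ →
                       t ≢ t′ → Adj a t → Adj c t → Adj a t′ → Adj c t′ → ⊥
        two-diamonds {a} {b} {c} {s} {s′} {t} {t′} ab ac b≢c s≢s′ as bs as′ bs′ t≢t′ at₁ ct at₂ ct′
          with third ab as as′ (Adj≢ bs) (Adj≢ bs′) s≢s′ ac
        ... | inj₁ c≡b = b≢c (sym c≡b)
        ... | inj₂ (inj₁ refl) = adj-K₄ ab as as′ bs bs′ (go (third ab as as′ (Adj≢ bs) (Adj≢ bs′) s≢s′ at₁) (third ab as as′ (Adj≢ bs) (Adj≢ bs′) s≢s′ at₂))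
          where
          go : t ≡ b ⊎ t ≡ s ⊎ t ≡ s′ → t′ ≡ b ⊎ t′ ≡ s ⊎ t′ ≡ s′ → Adj s s′
          go (inj₂ (inj₂ refl)) _ = ct
          go _ (inj₂ (inj₂ refl)) = ct′
          go (inj₂ (inj₁ refl)) _ = ⊥-elim (adj-irr ct)
          go _ (inj₂ (inj₁ refl)) = ⊥-elim (adj-irr ct′)
          go (inj₁ refl) (inj₁ refl) = ⊥-elim (t≢t′ refl)
        ... | inj₂ (inj₂ refl) = adj-K₄ ab as′ as bs′ bs (go (third ab as as′ (Adj≢ bs) (Adj≢ bs′) s≢s′ at₁) (third ab as as′ (Adj≢ bs) (Adj≢ bs′) s≢s′ at₂))
          where
          go : t ≡ b ⊎ t ≡ s ⊎ t ≡ s′ → t′ ≡ b ⊎ t′ ≡ s ⊎ t′ ≡ s′ → Adj s′ s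
          go (inj₂ (inj₁ refl)) _ = ct
          go _ (inj₂ (inj₁ refl)) = ct′
          go (inj₂ (inj₂ refl)) _ = ⊥-elim (adj-irr ct)
          go _ (inj₂ (inj₂ refl)) = ⊥-elim (adj-irr ct′)
          go (inj₁ refl) (inj₁ refl) = ⊥-elim (t≢t′ refl)

        open Links Adj renaming (R to Rem)

        Rem-sym : ∀ {u v} → Rem u v → Rem v u
        Rem-sym (a , p , q) = adj-sym a , q , p

        diamond-heavy : ∀ {a b s s′} (ab : Adj a b) → s ≢ s′ → Adj a s → Adj b s → Adj a s′ → Adj b s′ → 12 < weight (proj₁ ab) (proj₁ (proj₂ ab))
        diamond-heavy (x , y , p , q , e) s≢s′ (_ , s , p₁ , r₁ , e₁) (_ , _ , q₁ , r₁′ , f₁) (_ , s′ , p₂ , r₂ , e₂) (_ , _ , q₂ , r₂′ , f₂)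
          with same p p₁ | same p p₂ | same q q₁ | same q q₂ | same r₁ r₁′ | same r₂ r₂′
        ... | refl | refl | refl | refl | refl | refl = diamond-weight e (distinct r₁ r₂ s≢s′) e₁ f₁ e₂ f₂

        triangle-heavy : ∀ {a b s} (ab : Adj a b) → Adj a s → Adj b s → 3 < weight (proj₁ ab) (proj₁ (proj₂ ab))
        triangle-heavy (x , y , p , q , e) (_ , s , p₁ , r₁ , e₁) (_ , _ , q₁ , r₁′ , f₁) with same p p₁ | same q q₁ | same r₁ r₁′
        ... | refl | refl | refl = triangle-weight e e₁ f₁

        -- Such an edge has weight 13, more than three times 4. The gaps after `a` and before `b`
        -- weigh at most 4, since a second edge at `a` or `b` in two triangles is excluded by
        -- `two-diamonds`; but then every gap between would have to weigh more than 4.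
        double-linked< : ∀ {a b s s′} → Rem a b → a < b → s ≢ s′ → Adj a s → Adj b s → Adj a s′ → Adj b s′ → ⊥
        double-linked< {a} {b@(suc b′)} {s} {s′} (ab , b≢ , a≢) a<b s≢s′ as bs as′ bs′ =
          <⇒≱ (strong-between 4 (≤∧≢⇒< a<b (λ e → b≢ (sym e))) ab (diamond-heavy ab s≢s′ as bs as′ bs′) (inj₂ weak-a) (inj₁ weak-b) (suc a) ≤-refl a<b) weak-a
          where
          weak-a : W.gap xs (suc a) ≤ 4
          weak-a = ≮⇒≥ λ lt → let (l , t , t′ , t≢ , (p , q) , (p′ , q′)) = gap>4 lt in
            two-diamonds ab l b≢ s≢s′ as bs as′ bs′ t≢ p q p′ q′
          weak-b : W.gap xs b ≤ 4
          weak-b = ≮⇒≥ λ lt → let (l , t , t′ , t≢ , (p , q) , (p′ , q′)) = gap>4 lt in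
            two-diamonds (adj-sym ab) (adj-sym l) (λ e → b≢ (cong suc (sym e))) s≢s′ bs as bs′ as′ t≢ q p q′ p′

        double-linked : ∀ {a b s s′} → Rem a b → s ≢ s′ → Adj a s → Adj b s → Adj a s′ → Adj b s′ → ⊥
        double-linked {a} {b} r s≢s′ as bs as′ bs′ with <-cmp a b
        ... | tri< lt _ _ = double-linked< r lt s≢s′ as bs as′ bs′
        ... | tri≈ _ refl _ = adj-irr (proj₁ r)
        ... | tri> _ _ gt = double-linked< (Rem-sym r) gt s≢s′ bs as bs′ as′

        -- Refutes a triangle with exactly one link. The third edge at z lies in no triangle, so
        -- both gaps at z weigh at most 1, and so does a gap beyond one end of the link. The edge
        -- from z to that end weighs at least 4, more than three such gaps, so `no-weak-gap` with h
        -- = 1 applies.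
        module Triangle {i z} (l : Adj i (suc i)) (r : Rem z i) (r′ : Rem z (suc i)) where
          zi = proj₁ r
          zi′ = proj₁ r′

          only-suc : ∀ {t} → Adj z t → Adj i t → t ≡ suc i
          only-suc {t} zt it with t ≟ suc i
          ... | yes e = e
          ... | no ne = ⊥-elim (double-linked r ne zt it zi′ l)

          only-i : ∀ {t} → Adj z t → Adj (suc i) t → t ≡ i
          only-i {t} zt it with t ≟ i
          ... | yes e = e
          ... | no ne = ⊥-elim (double-linked r′ ne zt it zi (adj-sym l))

          lone : ∀ {t} → Adj z t → ∀ {c} → Adj z c → Adj t c → t ≢ i → t ≢ suc i → ⊥
          lone zt zc tc t≢i t≢si with third zi zi′ zt (Adj≢ l) (λ e → t≢i (sym e)) (λ e → t≢si (sym e)) zc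
          ... | inj₁ refl = t≢si (only-suc zt (adj-sym tc))
          ... | inj₂ (inj₁ refl) = t≢i (only-i zt (adj-sym tc))
          ... | inj₂ (inj₂ refl) = adj-irr tc

          weak-z⁺ : W.gap xs (suc z) ≤ 1
          weak-z⁺ = ≮⇒≥ λ lt → let (a , t , p , q) = gap>1 lt in
            lone a p q (λ e → proj₁ (proj₂ r) (sym e)) (λ e → proj₁ (proj₂ r′) (sym e))

          weak-z⁻ : ∀ z → Adj z i → Adj z (suc i) → (∀ {t} → Adj z t → ∀ {c} → Adj z c → Adj t c → t ≢ i → t ≢ suc i → ⊥) →
                    z ≢ suc i → z ≢ suc (suc i) → W.gap xs z ≤ 1
          weak-z⁻ zero _ _ _ _ _ = z≤n
          weak-z⁻ (suc z) _ _ lone z≢ z≢′ = ≮⇒≥ λ lt → let (a , t , p , q) = gap>1 lt in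
            lone (adj-sym a) q p (λ e → z≢ (cong suc e)) (λ e → z≢′ (cong suc e))

          back : ∀ i′ → suc i′ ≡ i → 1 < W.gap xs i → Adj i′ (suc i)
          back i′ refl lt with gap>1 lt
          ... | a , t , p , q with third l (adj-sym zi) (adj-sym a) (λ e → Adj≢ zi′ (sym e)) (λ ()) (λ e → proj₁ (proj₂ r) (cong suc (sym e))) q
          ...   | inj₁ refl = p
          ...   | inj₂ (inj₁ refl) = ⊥-elim (m≢1+m+n i′ {1} (trans (only-suc (adj-sym p) (adj-sym a)) (cong suc (+-comm 1 i′))))
          ...   | inj₂ (inj₂ refl) = ⊥-elim (adj-irr p)

          forth : 1 < W.gap xs (suc (suc i)) → Adj i (suc (suc i))
          forth lt with gap>1 lt
          ... | a , t , p , q with third (adj-sym l) (adj-sym zi′) a (λ e → Adj≢ zi (sym e)) (λ ()) (λ e → proj₂ (proj₂ r′) e) p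
          ...   | inj₁ refl = adj-sym q
          ...   | inj₂ (inj₁ refl) = ⊥-elim (m≢1+m+n i {1} (trans (sym (only-i (adj-sym q) a)) (cong suc (+-comm 1 i))))
          ...   | inj₂ (inj₂ refl) = ⊥-elim (adj-irr q)

          -- A heavy gap after the link forces an edge from i to i + 2; a heavy gap before it makes
          -- i - 1 adjacent to i. With i + 1 and z this would give i four neighbours.
          weak-end : W.gap xs i ≤ 1 ⊎ W.gap xs (suc (suc i)) ≤ 1
          weak-end with W.gap xs i ≤? 1 | W.gap xs (suc (suc i)) ≤? 1
          ... | yes p | _ = inj₁ p
          ... | no _ | yes p = inj₂ p
          ... | no p | no q = ⊥-elim (go i refl (≰⇒> p))
            where
            go : ∀ j → j ≡ i → 1 < W.gap xs i → ⊥
            go zero refl ()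
            go (suc i′) refl lt = adj-deg l (adj-sym zi) (adj-sym (proj₁ (gap>1 lt))) (forth (≰⇒> q))
              (λ e → Adj≢ zi′ (sym e)) (λ ()) (λ ()) (λ e → proj₁ (proj₂ r) (cong suc (sym e))) (λ e → proj₂ (proj₂ r′) e) (λ ())

          heavy-pair : ∀ {e s} → Rem z e → Adj z s → Adj e s → W.gap xs e ≤ 1 ⊎ W.gap xs (suc e) ≤ 1 → ⊥
          heavy-pair {e} (ze , e≢ , z≢) zs es we with <-cmp z e
          ... | tri< lt _ _ = <⇒≱ (strong-between 1 (≤∧≢⇒< lt (λ eq → e≢ (sym eq))) ze (triangle-heavy ze zs es) (inj₂ weak-z⁺) we (suc z) ≤-refl lt) weak-z⁺
          ... | tri≈ _ refl _ = adj-irr ze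
          ... | tri> _ _ gt = <⇒≱ (strong-between 1 (≤∧≢⇒< gt (λ eq → z≢ (sym eq))) (adj-sym ze) (triangle-heavy (adj-sym ze) es zs) we (inj₂ weak-z⁺) z gt ≤-refl)
                  (weak-z⁻ z zi zi′ lone (λ e → proj₂ (proj₂ r) e) (λ e → proj₂ (proj₂ r′) e))

          impossible : ⊥
          impossible with weak-end
          ... | inj₁ w = heavy-pair r zi′ l (inj₁ w)
          ... | inj₂ w = heavy-pair r′ zi (adj-sym l) (inj₂ w)

      layout : Layout (length xs) Adj
      layout = record
        { A? = adj?
        ; A-sym = adj-sym
        ; A-irr = adj-irr
        ; A-< = λ { (x , _ , p , _ , _) → at-< xs _ p }
        ; deg≤3 = adj-deg
        -- Threshold 0: every edge weighs more than 0, and a vertex that is not inner has a gap of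
        -- weight 0 beside it.
        ; ends-same-path = λ { {u} {v} (a , v≢ , u≢) u<v ou ov l u≤l l<v →
            gap>0 (strong-between 0 (≤∧≢⇒< u<v (λ e → v≢ (sym e))) a (edge-weight (proj₂ (proj₂ (proj₂ (proj₂ a))))) (loose u ou) (loose v ov) (suc l) (s≤s u≤l) l<v) }
        ; triangle-links = λ l r r′ → Triangle.impossible l r r′
        }
        where
        loose : ∀ u → ¬ Inner u → W.gap xs u ≤ 0 ⊎ W.gap xs (suc u) ≤ 0
        loose zero _ = inj₁ z≤n
        loose (suc u) ou with W.gap xs (suc u) ≤? 0 | W.gap xs (suc (suc u)) ≤? 0
        ... | yes p | _ = inj₁ p
        ... | no _ | yes q = inj₂ q
        ... | no p | no q = ⊥-elim (ou (gap>0 (≰⇒> p) , gap>0 (≰⇒> q)))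

-- Components of the remaining edges, their shapes and their slopes.

module Classes where
  open Arrange
  open import Data.Nat using (_≟_)
  open import Data.Nat.Properties
  open import Relation.Nullary.Decidable using (map′)
  open import Relation.Binary.PropositionalEquality using (_≡_; _≢_; refl; sym; trans; cong; subst)

  module ClassStructure {n : ℕ} {A : ℕ → ℕ → Set} (L : Layout n A) where
    open Links A public
    open Layout L public

    abstract
      Inner? : ∀ u → Dec (Inner u)
      Inner? zero = no λ ()
      Inner? (suc u) = A? u (suc u) ×-dec A? (suc u) (suc (suc u))

      R? : ∀ u v → Dec (R u v)
      R? u v = A? u v ×-dec (¬? (v ≟ suc u) ×-dec ¬? (u ≟ suc v))

    R-sym : ∀ {u v} → R u v → R v u
    R-sym (a , p , q) = A-sym a , q , p

    R-irr : ∀ {u v} → R u v → u ≢ v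
    R-irr (a , _) refl = A-irr a

    Linked : ℕ → Set
    Linked z = ∃ λ m → A z m × (m ≡ suc z ⊎ z ≡ suc m)

    linked-R : ∀ {z} (l : Linked z) {x} → R z x → proj₁ l ≢ x
    linked-R (m , _ , inj₁ refl) (_ , p , _) refl = p refl
    linked-R (m , _ , inj₂ refl) (_ , _ , q) refl = q refl

    linked-two : ∀ {z x y t} → Linked z → R z x → R z y → R z t → x ≢ y → x ≢ t → y ≢ t → ⊥
    linked-two l zx zy zt xy xt yt = deg≤3 (proj₁ (proj₂ l)) (proj₁ zx) (proj₁ zy) (proj₁ zt) (linked-R l zx) (linked-R l zy) (linked-R l zt) xy xt yt

    inner-unique : ∀ {u v v′} → Inner u → R u v → R u v′ → v ≡ v′
    inner-unique {suc u} {v} {v′} (l , l′) r r′ with v ≟ v′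
    ... | yes e = e
    ... | no ne = ⊥-elim (deg≤3 (A-sym l) l′ (proj₁ r) (proj₁ r′) (λ ()) (λ e → proj₂ (proj₂ r) (cong suc e)) (λ e → proj₂ (proj₂ r′) (cong suc e))
                    (λ e → proj₁ (proj₂ r) (sym e)) (λ e → proj₁ (proj₂ r′) (sym e)) ne)

    -- The first argument is the child and the second its parent. An inner vertex has at most one
    -- remaining edge, so a twin pair is a class of its own and leaves have no children; a close
    -- edge joins the two ends of a path and is oriented towards the earlier one.
    Leaf Twin Close : ℕ → ℕ → Set
    Leaf u w = R u w × Inner u × ¬ Inner w
    Twin u w = R u w × Inner u × Inner w × w < u
    Close c b = R c b × ¬ Inner c × ¬ Inner b × b < c

    data Par (u w : ℕ) : Set where
      leaf  : Leaf u w → Par u w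
      twin  : Twin u w → Par u w
      close : Close u w → Par u w

    Par-R : ∀ {u w} → Par u w → R u w
    Par-R (leaf (r , _)) = r
    Par-R (twin (r , _)) = r
    Par-R (close (r , _)) = r

    orient : ∀ {u v} → R u v → Par u v ⊎ Par v u
    orient {u} {v} r with Inner? u | Inner? v
    ... | yes i | no o = inj₁ (leaf (r , i , o))
    ... | no o | yes i = inj₂ (leaf (R-sym r , i , o))
    ... | yes i | yes j with <-cmp u v
    ...   | tri< lt _ _ = inj₂ (twin (R-sym r , j , i , lt))
    ...   | tri≈ _ e _ = ⊥-elim (R-irr r e)
    ...   | tri> _ _ gt = inj₁ (twin (r , i , j , gt))
    orient {u} {v} r | no i | no j with <-cmp u v
    ...   | tri< lt _ _ = inj₂ (close (R-sym r , j , i , lt))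
    ...   | tri≈ _ e _ = ⊥-elim (R-irr r e)
    ...   | tri> _ _ gt = inj₁ (close (r , i , j , gt))

    abstract
      Leaf? : ∀ u w → Dec (Leaf u w)
      Leaf? u w = R? u w ×-dec (Inner? u ×-dec ¬? (Inner? w))

      Close? : ∀ u w → Dec (Close u w)
      Close? u w = R? u w ×-dec (¬? (Inner? u) ×-dec (¬? (Inner? w) ×-dec (w <? u)))

      Par? : ∀ u w → Dec (Par u w)
      Par? u w with Leaf? u w | R? u w ×-dec (Inner? u ×-dec (Inner? w ×-dec (w <? u))) | Close? u w
      ... | yes p | _ | _ = yes (leaf p)
      ... | no _ | yes p | _ = yes (twin p)
      ... | no _ | no _ | yes p = yes (close p)
      ... | no a | no b | no c = no λ { (leaf p) → a p ; (twin p) → b p ; (close p) → c p }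

    close-links : ∀ {c b} → Close c b → ∀ l → b ≤ l → l < c → Lk l
    close-links (r , oc , ob , lt) = ends-same-path (R-sym r) lt ob oc

    private
      inner-between : ∀ {u v m} → (∀ l → u ≤ l → l < v → Lk l) → u < m → m < v → Inner m
      inner-between {m = suc m} links (s≤s u≤m) m<v = links m u≤m (<-trans (n<1+n m) m<v) , links (suc m) (m≤n⇒m≤1+n u≤m) m<v

    -- All positions from `b` to `c` are linked, so the larger of two such `b` would lie strictly
    -- inside the path of the smaller one and be inner.
    close-unique : ∀ {c b b′} → Close c b → Close c b′ → b ≡ b′
    close-unique {c} {b} {b′} k k′ with <-cmp b b′
    ... | tri≈ _ e _ = e
    ... | tri< lt _ _ = ⊥-elim (proj₁ (proj₂ (proj₂ k′)) (inner-between (close-links k) lt (proj₂ (proj₂ (proj₂ k′)))))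
    ... | tri> _ _ gt = ⊥-elim (proj₁ (proj₂ (proj₂ k)) (inner-between (close-links k′) gt (proj₂ (proj₂ (proj₂ k)))))

    close-injective : ∀ {c c′ b} → Close c b → Close c′ b → c ≡ c′
    close-injective {c} {c′} {b} k k′ with <-cmp c c′
    ... | tri≈ _ e _ = e
    ... | tri< lt _ _ = ⊥-elim (proj₁ (proj₂ k) (inner-between (close-links k′) (proj₂ (proj₂ (proj₂ k))) lt))
    ... | tri> _ _ gt = ⊥-elim (proj₁ (proj₂ k′) (inner-between (close-links k) (proj₂ (proj₂ (proj₂ k′))) gt))

    close-no-chain : ∀ {c b b′} → Close c b → Close b b′ → ⊥
    close-no-chain {c} {b} {b′} k k′ = proj₁ (proj₂ k′) (inner b refl)
      where
      inner : ∀ m → m ≡ b → Inner b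
      inner zero refl = ⊥-elim (n≮0 (proj₂ (proj₂ (proj₂ k′))))
      inner (suc m) refl = close-links k′ m (≤-pred (proj₂ (proj₂ (proj₂ k′)))) ≤-refl , close-links k (suc m) ≤-refl (proj₂ (proj₂ (proj₂ k)))

    close-first-link : ∀ {c b} → Close c b → Lk b
    close-first-link k = close-links k _ ≤-refl (proj₂ (proj₂ (proj₂ k)))

    close-last-link : ∀ {c b} → Close (suc c) b → Lk c
    close-last-link k = close-links k _ (≤-pred (proj₂ (proj₂ (proj₂ k)))) ≤-refl

    close-linked : ∀ {c b} → Close c b → Linked c × Linked b
    close-linked {zero} (_ , _ , _ , ())
    close-linked {suc c} {b} k = (c , A-sym (close-last-link k) , inj₂ refl) , (suc b , close-first-link k , inj₁ refl)

    close-break : ∀ {c b} → Close c b → ¬ Lk c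
    close-break {zero} (_ , _ , _ , ()) _
    close-break {suc c} k l = proj₁ (proj₂ k) (close-last-link k , l)

    close-break′ : ∀ {c b} → Close c (suc b) → ¬ Lk b
    close-break′ k l = proj₁ (proj₂ (proj₂ k)) (l , close-first-link k)

    par-unique : ∀ {u w w′} → Par u w → Par u w′ → w ≡ w′
    par-unique (close k) (close k′) = close-unique k k′
    par-unique (close (_ , o , _)) (leaf (_ , i , _)) = ⊥-elim (o i)
    par-unique (close (_ , o , _)) (twin (_ , i , _)) = ⊥-elim (o i)
    par-unique (leaf (r , i , _)) q = inner-unique i r (Par-R q)
    par-unique (twin (r , i , _)) q = inner-unique i r (Par-R q)

    Root : ℕ → Set
    Root u = ∀ w → ¬ Par u w

    abstract
      parent? : ∀ u → Dec (∃ λ w → Par u w)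
      parent? u = map′ (λ { (w , _ , q) → w , q }) (λ { (w , q) → w , A-< (proj₁ (R-sym (Par-R q))) , q }) (anyUpTo? (Par? u) n)

      p : ℕ → ℕ
      p u with parent? u
      ... | yes (w , _) = w
      ... | no _ = u

      p-par : ∀ {u w} → Par u w → p u ≡ w
      p-par {u} q with parent? u
      ... | yes (w , q′) = par-unique q′ q
      ... | no none = ⊥-elim (none (_ , q))

      p-root : ∀ {u} → Root u → p u ≡ u
      p-root {u} root with parent? u
      ... | yes (w , q) = ⊥-elim (root w q)
      ... | no none = refl

    -- Two steps always reach the root: the only chain of two edges is a leaf edge followed by a
    -- close edge.
    rep : ℕ → ℕ
    rep u = p (p u)

    abstract
      p-< : ∀ {u} → u < n → p u < n
      p-< {u} u<n with parent? u
      ... | yes (w , q) = A-< (proj₁ (R-sym (Par-R q)))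
      ... | no _ = u<n

    rep-< : ∀ {u} → u < n → rep u < n
    rep-< u<n = p-< (p-< u<n)

    twin-root : ∀ {u w} → Twin u w → Root w
    twin-root (r , i , j , lt) x (leaf (r′ , _ , o)) = o (subst Inner (inner-unique j (R-sym r) r′) i)
    twin-root (r , i , j , lt) x (twin (r′ , _ , _ , lt′)) = <-asym lt (subst (_< _) (sym (inner-unique j (R-sym r) r′)) lt′)
    twin-root (r , i , j , lt) x (close (_ , o , _)) = o j

    close-root : ∀ {c b} → Close c b → Root b
    close-root k x (leaf (_ , i , _)) = proj₁ (proj₂ (proj₂ k)) i
    close-root k x (twin (_ , i , _)) = proj₁ (proj₂ (proj₂ k)) i
    close-root k x (close k′) = close-no-chain k k′

    data View (u : ℕ) : Set where
      root   : Root u → View u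
      child  : ∀ {w} → Par u w → Root w → View u
      nephew : ∀ {c b} → Leaf u c → Close c b → View u

    view : ∀ u → View u
    view u with parent? u
    ... | no none = root (λ w q → none (w , q))
    ... | yes (w , twin t) = child (twin t) (twin-root t)
    ... | yes (w , close k) = child (close k) (close-root k)
    ... | yes (w , leaf l) with parent? w
    ...   | no none = child (leaf l) (λ v q → none (v , q))
    ...   | yes (b , close k) = nephew l k
    ...   | yes (b , leaf (_ , i , _)) = ⊥-elim (proj₂ (proj₂ l) i)
    ...   | yes (b , twin (_ , i , _)) = ⊥-elim (proj₂ (proj₂ l) i)

    rep-root : ∀ {u} → Root u → rep u ≡ u
    rep-root r = trans (cong p (p-root r)) (p-root r)

    rep-child : ∀ {u w} → Par u w → Root w → rep u ≡ w
    rep-child q r = trans (cong p (p-par q)) (p-root r)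

    rep-nephew : ∀ {u c b} → Leaf u c → Close c b → rep u ≡ b
    rep-nephew l k = trans (cong p (p-par (leaf l))) (p-par (close k))

    -- Both ends of a close edge have a link and the close edge itself, which leaves room for one
    -- further edge.
    closed-leaf : ∀ {c b u v} → Close c b → Leaf u c → Leaf v c → u ≡ v
    closed-leaf {u = u} {v} k l l′ with u ≟ v
    ... | yes e = e
    ... | no ne = ⊥-elim (linked-two (proj₁ (close-linked k)) (proj₁ k) (R-sym (proj₁ l)) (R-sym (proj₁ l′))
        (λ e → proj₁ (proj₂ (proj₂ k)) (subst Inner (sym e) (proj₁ (proj₂ l)))) (λ e → proj₁ (proj₂ (proj₂ k)) (subst Inner (sym e) (proj₁ (proj₂ l′)))) ne)

    closed-leaf′ : ∀ {c b u v} → Close c b → Leaf u b → Leaf v b → u ≡ v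
    closed-leaf′ {u = u} {v} k l l′ with u ≟ v
    ... | yes e = e
    ... | no ne = ⊥-elim (linked-two (proj₂ (close-linked k)) (R-sym (proj₁ k)) (R-sym (proj₁ l)) (R-sym (proj₁ l′))
        (λ e → proj₁ (proj₂ k) (subst Inner (sym e) (proj₁ (proj₂ l)))) (λ e → proj₁ (proj₂ k) (subst Inner (sym e) (proj₁ (proj₂ l′)))) ne)

    -- A class is a star or, around a close edge from `c` to `b`, a double star with at most one
    -- leaf at each centre. The constructors list the pairs of its vertices up to exchange; `kin`
    -- shows that the list is complete.
    data Kin (u v : ℕ) : Set where
      adjacent : R u v → Kin u v
      siblings : ∀ {z} → Leaf u z → Leaf v z → Root z → Kin u v
      uncle    : ∀ {b} → Leaf u b → Close v b → Kin u v
      grandson : ∀ {c} → Leaf v c → Close c u → Kin u v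
      cousins  : ∀ {c b} → Leaf u b → Leaf v c → Close c b → Kin u v

    kin : ∀ {u v} → u ≢ v → rep u ≡ rep v → Kin u v ⊎ Kin v u
    kin {u} {v} u≢v eq with view u | view v
    ... | root ru | root rv = ⊥-elim (u≢v (trans (sym (rep-root ru)) (trans eq (rep-root rv))))
    ... | root ru | child q rw with trans (sym (rep-root ru)) (trans eq (rep-child q rw))
    ...   | refl = inj₂ (adjacent (Par-R q))
    kin {u} {v} u≢v eq | root ru | nephew l k with trans (sym (rep-root ru)) (trans eq (rep-nephew l k))
    ...   | refl = inj₁ (grandson l k)
    kin {u} {v} u≢v eq | child q rw | root rv with trans (sym (rep-root rv)) (trans (sym eq) (rep-child q rw))
    ...   | refl = inj₁ (adjacent (Par-R q))
    kin {u} {v} u≢v eq | nephew l k | root rv with trans (sym (rep-root rv)) (trans (sym eq) (rep-nephew l k))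
    ...   | refl = inj₂ (grandson l k)
    kin {u} {v} u≢v eq | child q rw | child q′ rw′ with trans (sym (rep-child q rw)) (trans eq (rep-child q′ rw′)) | q | q′
    ...   | refl | leaf l | leaf l′ = inj₁ (siblings l l′ rw)
    ...   | refl | leaf l | twin t = ⊥-elim (proj₂ (proj₂ l) (proj₁ (proj₂ (proj₂ t))))
    ...   | refl | leaf l | close k = inj₁ (uncle l k)
    ...   | refl | twin t | leaf l = ⊥-elim (proj₂ (proj₂ l) (proj₁ (proj₂ (proj₂ t))))
    ...   | refl | twin t | twin t′ = ⊥-elim (u≢v (inner-unique (proj₁ (proj₂ (proj₂ t))) (R-sym (proj₁ t)) (R-sym (proj₁ t′))))
    ...   | refl | twin t | close k = ⊥-elim (proj₁ (proj₂ (proj₂ k)) (proj₁ (proj₂ (proj₂ t))))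
    ...   | refl | close k | leaf l = inj₂ (uncle l k)
    ...   | refl | close k | twin t = ⊥-elim (proj₁ (proj₂ (proj₂ k)) (proj₁ (proj₂ (proj₂ t))))
    ...   | refl | close k | close k′ = ⊥-elim (u≢v (close-injective k k′))
    kin {u} {v} u≢v eq | child q rw | nephew l k with trans (sym (rep-child q rw)) (trans eq (rep-nephew l k)) | q
    ...   | refl | leaf l′ = inj₁ (cousins l′ l k)
    ...   | refl | twin t = ⊥-elim (proj₁ (proj₂ (proj₂ k)) (proj₁ (proj₂ (proj₂ t))))
    ...   | refl | close k′ with close-injective k k′
    ...     | refl = inj₂ (adjacent (proj₁ l))
    kin {u} {v} u≢v eq | nephew l k | child q rw with trans (sym (rep-child q rw)) (trans (sym eq) (rep-nephew l k)) | q
    ...   | refl | leaf l′ = inj₂ (cousins l′ l k)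
    ...   | refl | twin t = ⊥-elim (proj₁ (proj₂ (proj₂ k)) (proj₁ (proj₂ (proj₂ t))))
    ...   | refl | close k′ with close-injective k k′
    ...     | refl = inj₁ (adjacent (proj₁ l))
    kin {u} {v} u≢v eq | nephew l k | nephew l′ k′ with trans (sym (rep-nephew l k)) (trans eq (rep-nephew l′ k′))
    ...   | refl with close-injective k k′
    ...     | refl = ⊥-elim (u≢v (closed-leaf k l l′))

    data InnerKind (u ρ : ℕ) : Set where
      self   : u ≡ ρ → InnerKind u ρ
      twinOf : Twin u ρ → InnerKind u ρ
      leafOf : Leaf u ρ → InnerKind u ρ
      deep   : ∀ {c} → Leaf u c → Close c ρ → InnerKind u ρ

    inner-kind : ∀ {u ρ} → Inner u → rep u ≡ ρ → InnerKind u ρ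
    inner-kind {u} i eq with view u
    ... | root r = self (trans (sym (rep-root r)) eq)
    ... | child (leaf l) r = leafOf (subst (Leaf u) (trans (sym (rep-child (leaf l) r)) eq) l)
    ... | child (twin t) r = twinOf (subst (Twin u) (trans (sym (rep-child (twin t) r)) eq) t)
    ... | child (close (_ , o , _)) r = ⊥-elim (o i)
    ... | nephew l k = deep l (subst (Close _) (trans (sym (rep-nephew l k)) eq) k)

    outer-kind : ∀ {u ρ} → ¬ Inner ρ → Inner u → rep u ≡ ρ → Leaf u ρ ⊎ (∃ λ c → Leaf u c × Close c ρ)
    outer-kind o i eq with inner-kind i eq
    ... | self refl = ⊥-elim (o i)
    ... | twinOf t = ⊥-elim (o (proj₁ (proj₂ (proj₂ t))))
    ... | leafOf l = inj₁ l
    ... | deep l k = inj₂ (_ , l , k)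

    inner-root-kind : ∀ {u ρ} → Inner ρ → Inner u → rep u ≡ ρ → u ≡ ρ ⊎ Twin u ρ
    inner-root-kind j i eq with inner-kind i eq
    ... | self e = inj₁ e
    ... | twinOf t = inj₂ t
    ... | leafOf l = ⊥-elim (proj₂ (proj₂ l) j)
    ... | deep l k = ⊥-elim (proj₁ (proj₂ (proj₂ k)) j)

    twin-unique : ∀ {u v ρ} → Twin u ρ → Twin v ρ → u ≡ v
    twin-unique t t′ = inner-unique (proj₁ (proj₂ (proj₂ t))) (R-sym (proj₁ t)) (R-sym (proj₁ t′))

    deep-unique : ∀ {u v ρ} → (∃ λ c → Leaf u c × Close c ρ) → (∃ λ c → Leaf v c × Close c ρ) → u ≡ v
    deep-unique (c , l , k) (c′ , l′ , k′) with close-injective k k′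
    ... | refl = closed-leaf k l l′

    closed-two : ∀ {c ρ u v w} → Close c ρ → Inner u → Inner v → Inner w → rep u ≡ ρ → rep v ≡ ρ → rep w ≡ ρ →
                 u ≢ v → u ≢ w → v ≢ w → ⊥
    closed-two k iu iv iw eu ev ew uv uw vw with outer-kind o iu eu | outer-kind o iv ev | outer-kind o iw ew
      where o = proj₁ (proj₂ (proj₂ k))
    ... | inj₁ a | inj₁ b | _ = uv (closed-leaf′ k a b)
    ... | inj₂ a | inj₂ b | _ = uv (deep-unique a b)
    ... | inj₁ a | inj₂ _ | inj₁ b = uw (closed-leaf′ k a b)
    ... | inj₂ a | inj₁ _ | inj₂ b = uw (deep-unique a b)
    ... | inj₁ _ | inj₂ a | inj₂ b = vw (deep-unique a b)
    ... | inj₂ _ | inj₁ a | inj₁ b = vw (closed-leaf′ k a b)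

    -- Twin pairs and double stars have at most two inner vertices. So three of them are leaves of a
    -- star, and they use up the degree of its centre.
    three-inner : ∀ {u v w ρ} → Inner u → Inner v → Inner w → rep u ≡ ρ → rep v ≡ ρ → rep w ≡ ρ →
                  u ≢ v → u ≢ w → v ≢ w → (Leaf u ρ × Leaf v ρ × Leaf w ρ) × (∀ c → ¬ Close c ρ) × ¬ Linked ρ
    three-inner {u} {v} {w} {ρ} iu iv iw eu ev ew uv uw vw with Inner? ρ
    ... | no o = leaves , open′ , λ l → linked-two l (R-sym (proj₁ (proj₁ leaves))) (R-sym (proj₁ (proj₁ (proj₂ leaves)))) (R-sym (proj₁ (proj₂ (proj₂ leaves)))) uv uw vw
      where
      open′ : ∀ c → ¬ Close c ρ
      open′ c k = closed-two k iu iv iw eu ev ew uv uw vw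
      is-leaf : ∀ {x} → Inner x → rep x ≡ ρ → Leaf x ρ
      is-leaf ix ex with outer-kind o ix ex
      ... | inj₁ l = l
      ... | inj₂ (c , _ , k) = ⊥-elim (open′ c k)
      leaves = is-leaf iu eu , is-leaf iv ev , is-leaf iw ew
    ... | yes j with inner-root-kind j iu eu | inner-root-kind j iv ev | inner-root-kind j iw ew
    ...   | inj₁ refl | inj₁ refl | _ = ⊥-elim (uv refl)
    ...   | inj₁ refl | inj₂ _ | inj₁ refl = ⊥-elim (uw refl)
    ...   | inj₂ _ | inj₁ refl | inj₁ refl = ⊥-elim (vw refl)
    ...   | inj₂ a | inj₂ b | _ = ⊥-elim (uv (twin-unique a b))
    ...   | inj₂ a | inj₁ _ | inj₂ b = ⊥-elim (uw (twin-unique a b))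
    ...   | inj₁ _ | inj₂ a | inj₂ b = ⊥-elim (vw (twin-unique a b))

    -- By `three-inner` the class is a star whose centre has no link and no room for a fourth leaf.
    -- The vertex `v` need only be linked, so that it may also be the end of a path.
    class-small : ∀ {v x y z} → Linked v → Inner x → Inner y → Inner z → rep x ≡ rep v → rep y ≡ rep v → rep z ≡ rep v →
                  x ≢ y → x ≢ z → y ≢ z → v ≢ x → v ≢ y → v ≢ z → ⊥
    class-small {v} l ix iy iz ex ey ez xy xz yz vx vy vz with three-inner ix iy iz ex ey ez xy xz yz
    ... | (lx , ly , lz) , open′ , unlinked with view v
    ...   | root r = unlinked (subst Linked (sym (rep-root r)) l)
    ...   | child (leaf lv) r with rep-child (leaf lv) r
    ...     | e rewrite e = deg≤3 (proj₁ (R-sym (proj₁ lv))) (proj₁ (R-sym (proj₁ lx))) (proj₁ (R-sym (proj₁ ly))) (proj₁ (R-sym (proj₁ lz))) vx vy vz xy xz yz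
    class-small {v} l ix iy iz ex ey ez xy xz yz vx vy vz | (lx , ly , lz) , open′ , unlinked | child (twin t) r =
      proj₂ (proj₂ lx) (subst Inner (sym (rep-child (twin t) r)) (proj₁ (proj₂ (proj₂ t))))
    class-small {v} l ix iy iz ex ey ez xy xz yz vx vy vz | (lx , ly , lz) , open′ , unlinked | child (close k) r =
      open′ v (subst (Close v) (sym (rep-child (close k) r)) k)
    class-small {v} l ix iy iz ex ey ez xy xz yz vx vy vz | (lx , ly , lz) , open′ , unlinked | nephew {c} lv k =
      open′ c (subst (Close c) (sym (rep-nephew lv k)) k)

    inner-linked : ∀ {u} → Inner u → Linked u
    inner-linked {suc u} (l , _) = u , A-sym l , inj₂ refl

    four-inner : ∀ {v x y z} → Inner v → Inner x → Inner y → Inner z → rep x ≡ rep v → rep y ≡ rep v → rep z ≡ rep v →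
                 x ≢ y → x ≢ z → y ≢ z → v ≢ x → v ≢ y → v ≢ z → ⊥
    four-inner iv = class-small (inner-linked iv)

    -- Two leaves of the two centres of one double star. A link between them shrinks to a point in
    -- the limit, as its ends have the same class.
    Collapsed : ℕ → ℕ → Set
    Collapsed u v = ∃₂ λ c b → Leaf u b × Leaf v c × Close c b

    private
      unkin : ∀ {i j} → Lk i → j ≡ suc i → Kin i j ⊎ Kin j i → Collapsed i j ⊎ Collapsed j i
      unkin l refl (inj₁ (adjacent (_ , q , _))) = ⊥-elim (q refl)
      unkin l refl (inj₁ (siblings a b _)) = ⊥-elim (triangle-links l (R-sym (proj₁ a)) (R-sym (proj₁ b)))
      unkin l refl (inj₁ (uncle a k)) = ⊥-elim (triangle-links l (R-sym (proj₁ a)) (R-sym (proj₁ k)))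
      unkin l refl (inj₁ (grandson a k)) = ⊥-elim (triangle-links l (proj₁ k) (R-sym (proj₁ a)))
      unkin l refl (inj₁ (cousins a d k)) = inj₁ (_ , _ , a , d , k)
      unkin l refl (inj₂ (adjacent (_ , _ , q))) = ⊥-elim (q refl)
      unkin l refl (inj₂ (siblings a b _)) = ⊥-elim (triangle-links l (R-sym (proj₁ b)) (R-sym (proj₁ a)))
      unkin l refl (inj₂ (uncle a k)) = ⊥-elim (triangle-links l (R-sym (proj₁ k)) (R-sym (proj₁ a)))
      unkin l refl (inj₂ (grandson a k)) = ⊥-elim (triangle-links l (R-sym (proj₁ a)) (proj₁ k))
      unkin l refl (inj₂ (cousins a d k)) = inj₂ (_ , _ , a , d , k)

    -- Any other kinship between the ends of a link would be a remaining edge at consecutive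
    -- positions, or give a common neighbour by two remaining edges and so a triangle with one link.
    collapsed : ∀ {i} → Lk i → rep i ≡ rep (suc i) → Collapsed i (suc i) ⊎ Collapsed (suc i) i
    collapsed l eq = unkin l refl (kin (λ ()) eq)

    collapsed-inner : ∀ {i} → Lk i → rep i ≡ rep (suc i) → Inner i × Inner (suc i)
    collapsed-inner l eq with collapsed l eq
    ... | inj₁ (_ , _ , a , d , _) = proj₁ (proj₂ a) , proj₁ (proj₂ d)
    ... | inj₂ (_ , _ , a , d , _) = proj₁ (proj₂ d) , proj₁ (proj₂ a)

    collapsed-closed : ∀ {i} → Lk i → rep i ≡ rep (suc i) → ∃ λ c → Close c (rep i)
    collapsed-closed {i} l eq with collapsed l eq
    ... | inj₁ (c , b , a , d , k) = c , subst (Close c) (sym (rep-child (leaf a) (close-root k))) k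
    ... | inj₂ (c , b , a , d , k) = c , subst (Close c) (sym (rep-nephew d k)) k

    -- Ends of collapsed links are inner, and their class has a close edge; with three inner
    -- vertices it has none.
    no-triple : ∀ {i} → Lk i → Lk (suc i) → rep i ≡ rep (suc i) → rep (suc i) ≡ rep (suc (suc i)) → ⊥
    no-triple {i} l l′ e e′ = proj₁ (proj₂ (three-inner (proj₁ (collapsed-inner l e)) (proj₂ (collapsed-inner l e)) (proj₂ (collapsed-inner l′ e′))
      refl (sym e) (sym (trans e e′)) (λ ()) (λ ()) (λ ()))) _ (proj₂ (collapsed-closed l e))

    outer-step : ∀ {z} → ¬ Inner z → Lk z → rep (suc z) ≢ rep z
    outer-step o l e = o (proj₁ (collapsed-inner l (sym e)))

    outer-step′ : ∀ {z} → ¬ Inner (suc z) → Lk z → rep z ≢ rep (suc z)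
    outer-step′ o l e = o (proj₂ (collapsed-inner l e))

    inner-step : ∀ {u v} → Inner u → R u v → Inner v → rep (suc u) ≢ rep u
    inner-step {u} i r j e with collapsed (Lk-inner i) (sym e)
      where
      Lk-inner : ∀ {u} → Inner u → Lk u
      Lk-inner {suc u} (_ , l) = l
    ... | inj₁ (_ , b , a , d , k) = proj₂ (proj₂ a) (subst Inner (inner-unique i r (proj₁ a)) j)
    ... | inj₂ (_ , b , a , d , k) = proj₂ (proj₂ d) (subst Inner (inner-unique i r (proj₁ d)) j)

    Fewer More : ℕ → ℕ → Set
    Fewer z u = ∃ λ v → v < u × Leaf v z
    More z u = ∃ λ v → u < v × Leaf v z

    abstract
      Fewer? : ∀ z u → Dec (Fewer z u)
      Fewer? z u = anyUpTo? (λ v → Leaf? v z) u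

      More? : ∀ z u → Dec (More z u)
      More? z u = map′ (λ { (v , _ , lt , l) → v , lt , l }) (λ { (v , lt , l) → v , A-< (proj₁ (proj₁ l)) , lt , l }) (anyUpTo? (λ v → (u <? v) ×-dec Leaf? v z) n)

      closes? : ∀ z → Dec (∃ λ b → Close z b)
      closes? z = map′ (λ { (b , _ , k) → b , k }) (λ { (b , k) → b , proj₂ (proj₂ (proj₂ k)) , k }) (anyUpTo? (Close? z) z)

    -- The first clause serves double stars: the leaf at the later centre gets 1, the close edge 2
    -- and the leaf at the earlier centre 0. In a star the first leaf gets 0, the last of several
    -- leaves 2, and one between them 1.
    leafColour : ℕ → ℕ → ℕ
    leafColour z u with closes? z | Fewer? z u | More? z u
    ... | yes _ | _ | _ = 1
    ... | no _ | no _ | _ = 0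
    ... | no _ | yes _ | yes _ = 1
    ... | no _ | yes _ | no _ = 2

    -- The slope of the edge from u to its parent is N / colour u. Two leaves of an end of a
    -- path get the extreme colours 0 and 2, so that any third slope lies between theirs.
    colour : ℕ → ℕ
    colour u with parent? u
    ... | no _ = 0
    ... | yes (w , leaf _) = leafColour w u
    ... | yes (w , twin _) = 0
    ... | yes (w , close _) = 2

    colour-leaf : ∀ {u z} → Leaf u z → colour u ≡ leafColour z u
    colour-leaf {u} l with parent? u
    ... | no none = ⊥-elim (none (_ , leaf l))
    ... | yes (w , leaf l′) = cong (λ w → leafColour w u) (par-unique (leaf l′) (leaf l))
    ... | yes (w , twin t) = ⊥-elim (proj₂ (proj₂ l) (subst Inner (par-unique (twin t) (leaf l)) (proj₁ (proj₂ (proj₂ t)))))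
    ... | yes (w , close (_ , o , _)) = ⊥-elim (o (proj₁ (proj₂ l)))

    colour-close : ∀ {c b} → Close c b → colour c ≡ 2
    colour-close {c} k with parent? c
    ... | no none = ⊥-elim (none (_ , close k))
    ... | yes (w , leaf (_ , i , _)) = ⊥-elim (proj₁ (proj₂ k) i)
    ... | yes (w , twin (_ , i , _)) = ⊥-elim (proj₁ (proj₂ k) i)
    ... | yes (w , close _) = refl

    leafColour≤2 : ∀ z u → leafColour z u ≤ 2
    leafColour≤2 z u with closes? z | Fewer? z u | More? z u
    ... | yes _ | _ | _ = s≤s z≤n
    ... | no _ | no _ | _ = z≤n
    ... | no _ | yes _ | yes _ = s≤s z≤n
    ... | no _ | yes _ | no _ = ≤-refl

    colour≤2 : ∀ u → colour u ≤ 2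
    colour≤2 u with parent? u
    ... | no _ = z≤n
    ... | yes (w , leaf _) = leafColour≤2 w u
    ... | yes (w , twin _) = z≤n
    ... | yes (w , close _) = ≤-refl

    colour-leaf-last : ∀ {u c b} → Leaf u c → Close c b → colour u ≡ 1
    colour-leaf-last {u} {c} l k rewrite colour-leaf l with closes? c | Fewer? c u | More? c u
    ... | yes _ | _ | _ = refl
    ... | no none | _ | _ = ⊥-elim (none (_ , k))

    colour-leaf-first : ∀ {u c b} → Leaf u b → Close c b → colour u ≡ 0
    colour-leaf-first {u} {c} {b} l k rewrite colour-leaf l with closes? b | Fewer? b u | More? b u
    ... | yes (_ , k′) | _ | _ = ⊥-elim (close-no-chain k k′)
    ... | no _ | no _ | _ = refl
    ... | no _ | yes (v , lt , l′) | _ = ⊥-elim (<⇒≢ lt (closed-leaf′ k l′ l))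

    private
      sibling-clash : ∀ {z t t′ s} → Leaf t z → Leaf t′ z → Linked z → Leaf s z → t ≢ t′ → t ≢ s → t′ ≢ s → ⊥
      sibling-clash l l′ ln ls = linked-two ln (R-sym (proj₁ l)) (R-sym (proj₁ l′)) (R-sym (proj₁ ls))

    -- A linked centre has at most two leaves and a third one lies between the extremes only at an
    -- unlinked centre. Distinct colours keep siblings off a common line through the centre.
    sibling-colours : ∀ {z t t′} → Root z → Leaf t z → Leaf t′ z → t < t′ → colour t ≢ colour t′ × (Linked z → colour t ≡ 0 × colour t′ ≡ 2)
    sibling-colours {z} {t} {t′} rz l l′ lt rewrite colour-leaf l | colour-leaf l′ with closes? z | Fewer? z t | More? z t | Fewer? z t′ | More? z t′
    ... | yes (b , k) | _ | _ | _ | _ = ⊥-elim (rz b (close k))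
    ... | no _ | _ | no none | _ | _ = ⊥-elim (none (t′ , lt , l′))
    ... | no _ | _ | yes _ | no none | _ = ⊥-elim (none (t , lt , l))
    ... | no _ | no _ | yes _ | yes _ | no _ = (λ ()) , λ _ → refl , refl
    ... | no _ | no _ | yes _ | yes _ | yes (s , t′<s , ls) = (λ ()) , λ ln → ⊥-elim (sibling-clash l l′ ln ls (<⇒≢ lt) (<⇒≢ (<-trans lt t′<s)) (<⇒≢ t′<s))
    ... | no _ | yes (s , s<t , ls) | yes _ | yes _ | no _ = (λ ()) , λ ln → ⊥-elim (sibling-clash ls l ln l′ (<⇒≢ s<t) (<⇒≢ (<-trans s<t lt)) (<⇒≢ lt))
    ... | no _ | yes (s , s<t , ls) | yes _ | yes _ | yes (s′ , t′<s′ , ls′) =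
        ⊥-elim (deg≤3 (proj₁ (R-sym (proj₁ ls))) (proj₁ (R-sym (proj₁ l))) (proj₁ (R-sym (proj₁ l′))) (proj₁ (R-sym (proj₁ ls′)))
          (<⇒≢ s<t) (<⇒≢ (<-trans s<t lt)) (<⇒≢ (<-trans s<t (<-trans lt t′<s′))) (<⇒≢ lt) (<⇒≢ (<-trans lt t′<s′)) (<⇒≢ t′<s′))

-- Arithmetic of the four steep slopes.

module Numbers where
  open LinAlg
  open import Data.Integer using (+_; -_; _+_; _*_; _-_)
  open import Data.Integer.Tactic.RingSolver using (solve-∀)
  open import Data.Fin using (_≟_)
  open import Data.Fin.Properties using (all?; any?)
  open import Relation.Nullary using (_⊎-dec_)
  open import Relation.Nullary.Decidable using (from-yes)
  open import Relation.Binary.PropositionalEquality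

  pattern 0F = zero
  pattern 1F = suc zero
  pattern 2F = suc (suc zero)
  pattern 3F = suc (suc (suc zero))

  next : Fin 4 → Fin 4
  next 0F = 1F
  next 1F = 2F
  next 2F = 3F
  next 3F = 0F

  next≢ : ∀ r → next r ≢ r
  next≢ 0F ()
  next≢ 1F ()
  next≢ 2F ()
  next≢ 3F ()

  residue : ℕ → Fin 4
  residue zero = 0F
  residue (suc l) = next (residue l)

  -- The summand 10 leaves room for the digits up to 9 of the finite checks, and 4 n for loads of at
  -- most 4 for each of `n` vertices.
  module Slopes (n base : ℕ) (large : 10 ℕ.+ 4 ℕ.* n ℕ.≤ base) where

    B : ℤ
    B = + base

    base-expansion : ∀ x y z → ∣ x ∣ ℕ.< base → ∣ y ∣ ℕ.< base → ∣ z ∣ ℕ.< base →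
                     x + y * B + z * (B * B) ≡ 0ℤ → x ≡ 0ℤ × y ≡ 0ℤ × z ≡ 0ℤ
    base-expansion x y z x< y< z< eq = x≡0 , y≡0 , z≡0
      where
      ring₁ : ∀ x y z B → B * (y + z * B) + x ≡ x + y * B + z * (B * B)
      ring₁ = solve-∀
      ring₂ : ∀ y z B → B * z + y ≡ y + z * B
      ring₂ = solve-∀
      high : y + z * B ≡ 0ℤ
      high with (y + z * B) ℤₚ.≟ 0ℤ
      ... | yes e = e
      ... | no ne = ⊥-elim (dominant B (y + z * B) x ne x< (trans (ring₁ x y z B) eq))
      x≡0 : x ≡ 0ℤ
      x≡0 = trans (sym (trans (cong (λ h → B * h + x) high) (trans (cong (_+ x) (ℤₚ.*-zeroʳ B)) (ℤₚ.+-identityˡ x)))) (trans (ring₁ x y z B) eq)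
      z≡0 : z ≡ 0ℤ
      z≡0 with z ℤₚ.≟ 0ℤ
      ... | yes e = e
      ... | no ne = ⊥-elim (dominant B z y ne y< (trans (ring₂ y z B) high))
      y≡0 : y ≡ 0ℤ
      y≡0 = trans (sym (trans (cong (λ h → y + h * B) z≡0) (trans (cong (_+_ y) (ℤₚ.*-zeroˡ B)) (ℤₚ.+-identityʳ y)))) high

    -- Integer relations with small coefficients between these slopes are decided digit by digit.
    steep : Fin 4 → ℕ
    steep 0F = 1
    steep 1F = 2
    steep 2F = 2 ℕ.+ base
    steep 3F = 2 ℕ.+ (base ℕ.+ base ℕ.* base)

    σ : Fin 4 → ℤ
    σ r = + steep r

    σ₃ : σ 3F ≡ + 2 + (B + B * B)
    σ₃ = cong (λ z → + 2 + (B + z)) (ℤₚ.pos-* base base)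

    private
      d₀ d₁ d₂ : Fin 4 → ℤ
      d₀ 0F = 1ℤ
      d₀ _ = + 2
      d₁ 0F = 0ℤ
      d₁ 1F = 0ℤ
      d₁ _ = 1ℤ
      d₂ 3F = 1ℤ
      d₂ _ = 0ℤ

      digits : ∀ r → σ r ≡ d₀ r + d₁ r * B + d₂ r * (B * B)
      digits 0F = r B
        where
        r : ∀ B → 1ℤ ≡ 1ℤ + 0ℤ * B + 0ℤ * (B * B)
        r = solve-∀
      digits 1F = r B
        where
        r : ∀ B → + 2 ≡ + 2 + 0ℤ * B + 0ℤ * (B * B)
        r = solve-∀
      digits 2F = r B
        where
        r : ∀ B → + 2 + B ≡ + 2 + 1ℤ * B + 0ℤ * (B * B)
        r = solve-∀
      digits 3F = trans σ₃ (r B)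
        where
        r : ∀ B → + 2 + (B + B * B) ≡ + 2 + 1ℤ * B + 1ℤ * (B * B)
        r = solve-∀

    Form : Set
    Form = List (ℤ × Fin 4)

    weigh : (Fin 4 → ℤ) → Form → ℤ
    weigh f [] = 0ℤ
    weigh f ((c , r) ∷ e) = c * f r + weigh f e

    private
      weigh-digits : ∀ e → weigh σ e ≡ weigh d₀ e + weigh d₁ e * B + weigh d₂ e * (B * B)
      weigh-digits [] = ring B
        where
        ring : ∀ B → 0ℤ ≡ 0ℤ + 0ℤ * B + 0ℤ * (B * B)
        ring = solve-∀
      weigh-digits ((c , r) ∷ e) = trans (cong₂ (λ s t → c * s + t) (digits r) (weigh-digits e)) (ring c (d₀ r) (d₁ r) (d₂ r) (weigh d₀ e) (weigh d₁ e) (weigh d₂ e) B)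
        where
        ring : ∀ c x y z u v w B → c * (x + y * B + z * (B * B)) + (u + v * B + w * (B * B)) ≡ (c * x + u) + (c * y + v) * B + (c * z + w) * (B * B)
        ring = solve-∀

    Small : ℤ → Set
    Small x = ∣ x ∣ ℕ.≤ 9

    -- Small digits, not all zero. The digits do not involve the base, so this can be decided by
    -- evaluation although `base` is a variable.
    Independent : Form → Set
    Independent e = (Small (weigh d₀ e) × Small (weigh d₁ e) × Small (weigh d₂ e)) × ¬ (weigh d₀ e ≡ 0ℤ × weigh d₁ e ≡ 0ℤ × weigh d₂ e ≡ 0ℤ)

    independent? : ∀ e → Dec (Independent e)
    independent? e = ((_ ℕ.≤? _) ×-dec ((_ ℕ.≤? _) ×-dec (_ ℕ.≤? _))) ×-dec ¬? ((_ ℤₚ.≟ _) ×-dec ((_ ℤₚ.≟ _) ×-dec (_ ℤₚ.≟ _)))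

    independent-nonzero : ∀ e → Independent e → weigh σ e ≢ 0ℤ
    independent-nonzero e ((a , b , c) , ne) eq = ne (base-expansion _ _ _ (big a) (big b) (big c) (trans (sym (weigh-digits e)) eq))
      where
      big : ∀ {x} → x ℕ.≤ 9 → x ℕ.< base
      big le = ℕₚ.<-≤-trans (s≤s (ℕₚ.≤-trans le (ℕₚ.m≤m+n 9 _))) large

    bit : Fin 2 → ℤ
    bit b = + toℕ b

    -- The rise along consecutive links with slope indices f 0, f 1, … when the abscissae are the bits
    -- of x, which tell in which of two classes a vertex lies.
    turns : (ℕ → Fin 4) → (ℕ → Fin 2) → ℕ → Form
    turns f x zero = []
    turns f x (suc j) = (bit (x (suc j)) - bit (x j) , f j) ∷ turns f x j

    cycle : Fin 4 → ℕ → Fin 4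
    cycle r zero = r
    cycle r (suc k) = next (cycle r k)

    -- The default letter 0 is the class of the last vertex of a segment, which the words leave out.
    spell : List (Fin 2) → ℕ → Fin 2
    spell [] _ = 0F
    spell (b ∷ w) zero = b
    spell (b ∷ w) (suc i) = spell w i

    -- The first vertex has abscissa 1 and the last has 0, so a chord of slope σ r rises by - σ r;
    -- the form is the difference between the rise along the links and that of the chord.
    wordForm : Fin 4 → Fin 4 → ℕ → List (Fin 2) → Form
    wordForm i r j w = (1ℤ , r) ∷ turns (cycle i) (spell (1F ∷ w)) j

    Stutter : (ℕ → Fin 2) → ℕ → Set
    Stutter x j = ∃ λ i → i ℕ.< j × 2 ℕ.+ i ℕ.≤ j × x i ≡ x (suc i) × x (suc i) ≡ x (2 ℕ.+ i)

    Recurrent : (ℕ → Fin 2) → Set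
    Recurrent x = ∃ λ (i : Fin 6) → ∃ λ (k : Fin 6) → ∃ λ (l : Fin 6) →
      0 ℕ.< toℕ i × toℕ i ℕ.< toℕ k × toℕ k ℕ.< toℕ l × x (toℕ i) ≡ x (toℕ k) × x (toℕ k) ≡ x (toℕ l)

    private
      stutter? : ∀ x j → Dec (Stutter x j)
      stutter? x j = ℕₚ.anyUpTo? (λ i → (2 ℕ.+ i ℕ.≤? j) ×-dec ((x i ≟ x (suc i)) ×-dec (x (suc i) ≟ x (2 ℕ.+ i)))) j

      recurrent? : ∀ x → Dec (Recurrent x)
      recurrent? x = any? λ i → any? λ k → any? λ l →
        (0 ℕ.<? toℕ i) ×-dec ((toℕ i ℕ.<? toℕ k) ×-dec ((toℕ k ℕ.<? toℕ l) ×-dec ((x (toℕ i) ≟ x (toℕ k)) ×-dec (x (toℕ k) ≟ x (toℕ l)))))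

    abstract
      -- Exhaustive evaluation. The exceptions here and in `word₃` are the segments in which all
      -- links but one collapse: in the limit, the chord then has the slope of that one link.
      word₂ : ∀ i r a → r ≡ cycle i (toℕ a) ⊎ Independent (wordForm i r 2 (a ∷ []))
      word₂ = from-yes (all? λ i → all? λ r → all? λ a → (r ≟ cycle i (toℕ a)) ⊎-dec independent? (wordForm i r 2 (a ∷ [])))

      word₃ : ∀ i r a b → Stutter (spell (1F ∷ a ∷ b ∷ [])) 3 ⊎ (a ≡ 1F × b ≡ 0F × r ≡ next i) ⊎ Independent (wordForm i r 3 (a ∷ b ∷ []))
      word₃ = from-yes (all? λ i → all? λ r → all? λ a → all? λ b →
        stutter? (spell (1F ∷ a ∷ b ∷ [])) 3 ⊎-dec (((a ≟ 1F) ×-dec ((b ≟ 0F) ×-dec (r ≟ next i))) ⊎-dec independent? (wordForm i r 3 (a ∷ b ∷ []))))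

      word₄ : ∀ i r a b c → Stutter (spell (1F ∷ a ∷ b ∷ c ∷ [])) 4 ⊎ Independent (wordForm i r 4 (a ∷ b ∷ c ∷ []))
      word₄ = from-yes (all? λ i → all? λ r → all? λ a → all? λ b → all? λ c →
        stutter? (spell (1F ∷ a ∷ b ∷ c ∷ [])) 4 ⊎-dec independent? (wordForm i r 4 (a ∷ b ∷ c ∷ [])))

      word₅ : ∀ i r a b c d → Stutter (spell (1F ∷ a ∷ b ∷ c ∷ d ∷ [])) 5 ⊎ Independent (wordForm i r 5 (a ∷ b ∷ c ∷ d ∷ []))
      word₅ = from-yes (all? λ i → all? λ r → all? λ a → all? λ b → all? λ c → all? λ d →
        stutter? (spell (1F ∷ a ∷ b ∷ c ∷ d ∷ [])) 5 ⊎-dec independent? (wordForm i r 5 (a ∷ b ∷ c ∷ d ∷ [])))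

      -- Pigeonhole: among five interior letters from an alphabet of two, three agree.
      word₆ : ∀ a b c d e → Recurrent (spell (1F ∷ a ∷ b ∷ c ∷ d ∷ e ∷ []))
      word₆ = from-yes (all? λ a → all? λ b → all? λ c → all? λ d → all? λ e → recurrent? (spell (1F ∷ a ∷ b ∷ c ∷ d ∷ e ∷ [])))

    private
      pair : Fin 4 → Fin 4 → Form
      pair r s = (1ℤ , r) ∷ (-1ℤ , s) ∷ []

    σ-injective : ∀ r s → r ≢ s → σ r - σ s ≢ 0ℤ
    σ-injective r s r≢s eq with from-yes (all? λ r → all? λ s → (r ≟ s) ⊎-dec independent? (pair r s)) r s
    ... | inj₁ r≡s = r≢s r≡s
    ... | inj₂ ind = independent-nonzero (pair r s) ind (trans (ring (σ r) (σ s)) eq)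
      where
      ring : ∀ x y → 1ℤ * x + (-1ℤ * y + 0ℤ) ≡ x - y
      ring = solve-∀

    sum : ℕ → (ℕ → ℤ) → ℤ
    sum zero f = 0ℤ
    sum (suc k) f = sum k f + f k

    sum-cong : ∀ k {f g} → (∀ v → v ℕ.< k → f v ≡ g v) → sum k f ≡ sum k g
    sum-cong zero eq = refl
    sum-cong (suc k) eq = cong₂ _+_ (sum-cong k λ v lt → eq v (ℕₚ.<-trans lt (ℕₚ.n<1+n k))) (eq k (ℕₚ.n<1+n k))

    -- The indices 1, 2, 3 give 1, B and B², for which the slopes were chosen; index 0 gives minus
    -- their sum.
    turn : Fin 4 → ℤ
    turn 0F = σ 0F - σ 3F
    turn 1F = σ 1F - σ 0F
    turn 2F = σ 2F - σ 1F
    turn 3F = σ 3F - σ 2F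

    turn-next : ∀ r → σ (next r) - σ r ≡ turn (next r)
    turn-next 0F = refl
    turn-next 1F = refl
    turn-next 2F = refl
    turn-next 3F = refl

    share : Fin 4 → Fin 4 → ℕ → ℕ
    share s r t = if does (s ≟ r) then t else 0

    load : (ℕ → ℕ) → Fin 4 → ℕ → ℕ
    load f r zero = 0
    load f r (suc k) = load f r k ℕ.+ share (residue k) r (f k)

    private
      share≤ : ∀ s r t → share s r t ℕ.≤ t
      share≤ s r t with s ≟ r
      ... | yes _ = ℕₚ.≤-refl
      ... | no _ = z≤n

      share-self : ∀ s t → share s s t ≡ t
      share-self s t with s ≟ s
      ... | yes _ = refl
      ... | no ne = ⊥-elim (ne refl)

      load≤ : ∀ f r k → (∀ v → f v ℕ.≤ 4) → load f r k ℕ.≤ 4 ℕ.* k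
      load≤ f r zero f≤ = z≤n
      load≤ f r (suc k) f≤ = ℕₚ.≤-trans (ℕₚ.+-mono-≤ (load≤ f r k f≤) (ℕₚ.≤-trans (share≤ (residue k) r (f k)) (f≤ k)))
        (ℕₚ.≤-reflexive (trans (ℕₚ.+-comm (4 ℕ.* k) 4) (sym (ℕₚ.*-suc 4 k))))

      load≡0 : ∀ f r k → (∀ v → v ℕ.< k → f v ≢ 0 → residue v ≢ r) → load f r k ≡ 0
      load≡0 f r zero _ = refl
      load≡0 f r (suc k) none = cong₂ ℕ._+_ (load≡0 f r k (λ v lt → none v (ℕₚ.<-trans lt (ℕₚ.n<1+n k)))) skipped
        where
        skipped : share (residue k) r (f k) ≡ 0
        skipped with residue k ≟ r
        ... | no _ = refl
        ... | yes e with f k ℕ.≟ 0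
        ...   | yes z = z
        ...   | no nz = ⊥-elim (none k (ℕₚ.n<1+n k) nz e)

      load≥ : ∀ f v k → v ℕ.< k → f v ℕ.≤ load f (residue v) k
      load≥ f v (suc k) v<k with v ℕ.≟ k
      ... | no ne = ℕₚ.≤-trans (load≥ f v k (ℕₚ.≤∧≢⇒< (ℕₚ.≤-pred v<k) ne)) (ℕₚ.m≤m+n _ _)
      ... | yes refl = ℕₚ.≤-trans (ℕₚ.≤-reflexive (sym (share-self (residue v) (f v)))) (ℕₚ.m≤n+m _ _)

      -- The weighted sum of the turns after `turn 0F` has been eliminated by the zero sum. The
      -- coefficients left are differences of loads, which are the base-B digits.
      combine : (w x y z : ℤ) → ℤ
      combine w x y z = (x - w) * turn 1F + (y - w) * turn 2F + (z - w) * turn 3F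

      total : (ℕ → ℕ) → ℕ → ℤ
      total f k = combine (+ load f 0F k) (+ load f 1F k) (+ load f 2F k) (+ load f 3F k)

      combine-step : ∀ s w x y z t → combine (+ w) (+ x) (+ y) (+ z) + + t * turn s ≡
                     combine (+ (w ℕ.+ share s 0F t)) (+ (x ℕ.+ share s 1F t)) (+ (y ℕ.+ share s 2F t)) (+ (z ℕ.+ share s 3F t))
      combine-step 0F w x y z t = ring (+ w) (+ x) (+ y) (+ z) (+ t) (σ 0F) (σ 1F) (σ 2F) (σ 3F)
        where
        ring : ∀ w x y z t a b c d → (x - w) * (b - a) + (y - w) * (c - b) + (z - w) * (d - c) + t * (a - d) ≡
                                (x + 0ℤ - (w + t)) * (b - a) + (y + 0ℤ - (w + t)) * (c - b) + (z + 0ℤ - (w + t)) * (d - c)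
        ring = solve-∀
      combine-step 1F w x y z t = ring (+ w) (+ x) (+ y) (+ z) (+ t) (turn 1F) (turn 2F) (turn 3F)
        where
        ring : ∀ w x y z t a b c → (x - w) * a + (y - w) * b + (z - w) * c + t * a ≡ (x + t - (w + 0ℤ)) * a + (y + 0ℤ - (w + 0ℤ)) * b + (z + 0ℤ - (w + 0ℤ)) * c
        ring = solve-∀
      combine-step 2F w x y z t = ring (+ w) (+ x) (+ y) (+ z) (+ t) (turn 1F) (turn 2F) (turn 3F)
        where
        ring : ∀ w x y z t a b c → (x - w) * a + (y - w) * b + (z - w) * c + t * b ≡ (x + 0ℤ - (w + 0ℤ)) * a + (y + t - (w + 0ℤ)) * b + (z + 0ℤ - (w + 0ℤ)) * c
        ring = solve-∀
      combine-step 3F w x y z t = ring (+ w) (+ x) (+ y) (+ z) (+ t) (turn 1F) (turn 2F) (turn 3F)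
        where
        ring : ∀ w x y z t a b c → (x - w) * a + (y - w) * b + (z - w) * c + t * c ≡ (x + 0ℤ - (w + 0ℤ)) * a + (y + 0ℤ - (w + 0ℤ)) * b + (z + t - (w + 0ℤ)) * c
        ring = solve-∀

      sum-loads : ∀ f k → sum k (λ v → + f v * turn (residue v)) ≡ total f k
      sum-loads f zero = ring (turn 1F) (turn 2F) (turn 3F)
        where
        ring : ∀ a b c → 0ℤ ≡ (0ℤ - 0ℤ) * a + (0ℤ - 0ℤ) * b + (0ℤ - 0ℤ) * c
        ring = solve-∀
      sum-loads f (suc k) = trans (cong (_+ + f k * turn (residue k)) (sum-loads f k))
        (combine-step (residue k) (load f 0F k) (load f 1F k) (load f 2F k) (load f 3F k) (f k))

      total-expansion : ∀ f k → total f k ≡ (+ load f 1F k - + load f 0F k) + (+ load f 2F k - + load f 0F k) * B + (+ load f 3F k - + load f 0F k) * (B * B)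
      total-expansion f k = trans (cong (λ s → x * turn 1F + y * turn 2F + z * (s - σ 2F)) σ₃) (r x y z B)
        where
        x = + load f 1F k - + load f 0F k
        y = + load f 2F k - + load f 0F k
        z = + load f 3F k - + load f 0F k
        r : ∀ x y z B → x * (+ 2 - 1ℤ) + y * ((+ 2 + B) - + 2) + z * ((+ 2 + (B + B * B)) - (+ 2 + B)) ≡ x + y * B + z * (B * B)
        r = solve-∀

      difference-small : ∀ a b → a ℕ.≤ 4 ℕ.* n → b ℕ.≤ 4 ℕ.* n → ∣ + a - + b ∣ ℕ.< base
      difference-small a b a≤ b≤ = ℕₚ.<-≤-trans (s≤s (ℕₚ.≤-trans (subst (λ z → ∣ z ∣ ℕ.≤ 4 ℕ.* n) (sym (ℤₚ.m-n≡m⊖n a b)) (ℕₚ.≤-trans (ℤₚ.∣m⊝n∣≤m⊔n a b) (ℕₚ.⊔-lub a≤ b≤))) (ℕₚ.m≤n+m _ 9))) large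

    -- The four turns sum to zero and satisfy no other small relation, so a weighted sum
    -- of turns that misses one residue cannot vanish.
    turns-independent : ∀ f r → (∀ v → f v ℕ.≤ 4) → (∀ v → v ℕ.< n → f v ≢ 0 → residue v ≢ r) →
                        ∀ v → v ℕ.< n → f v ≢ 0 → sum n (λ v → + f v * turn (residue v)) ≢ 0ℤ
    turns-independent f r f≤ missing v v<n fv≢0 eq = fv≢0 (ℕₚ.n≤0⇒n≡0 (ℕₚ.≤-trans (load≥ f v n v<n) (ℕₚ.≤-reflexive (trans (all-equal (residue v)) (trans (sym (all-equal r)) (load≡0 f r n missing))))))
      where
      ℓ : Fin 4 → ℕ
      ℓ s = load f s n
      small : ∀ s → ∣ + ℓ s - + ℓ 0F ∣ ℕ.< base
      small s = difference-small (ℓ s) (ℓ 0F) (load≤ f s n f≤) (load≤ f 0F n f≤)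
      zeros = base-expansion _ _ _ (small 1F) (small 2F) (small 3F) (trans (sym (total-expansion f n)) (trans (sym (sum-loads f n)) eq))
      equal : ∀ {a b} → + a - + b ≡ 0ℤ → a ≡ b
      equal {a} {b} e = ℤₚ.+-injective (ℤₚ.i-j≡0⇒i≡j (+ a) (+ b) e)
      all-equal : ∀ s → ℓ s ≡ ℓ 0F
      all-equal 0F = refl
      all-equal 1F = equal (proj₁ zeros)
      all-equal 2F = equal (proj₁ (proj₂ zeros))
      all-equal 3F = equal (proj₂ (proj₂ zeros))

-- The limit drawing as a linear function of its data.

module Limit where
  open LinAlg
  open Arrange
  open Classes
  open Numbers
  open import Data.Integer using (+_; -_; _+_; _*_; _-_)
  open import Data.Integer.Tactic.RingSolver using (solve-∀)
  open import Relation.Binary.PropositionalEquality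

  choose : ∀ {P : Set} {B : Set} → Dec P → B → B → B
  choose (yes _) x y = x
  choose (no _) x y = y

  choose-yes : ∀ {P B : Set} (d : Dec P) {x y : B} → P → choose d x y ≡ x
  choose-yes (yes _) _ = refl
  choose-yes (no ¬p) p = ⊥-elim (¬p p)

  choose-no : ∀ {P B : Set} (d : Dec P) {x y : B} → ¬ P → choose d x y ≡ y
  choose-no (yes p) ¬p = ⊥-elim (¬p p)
  choose-no (no _) _ = refl

  -- The response of the ordinates to a unit shift at a break l: exactly the positions after l move.
  θ : ℕ → ℕ → ℤ
  θ l v = choose (l <? v) 1ℤ 0ℤ

  θ-< : ∀ {l v} → l ℕ.< v → θ l v ≡ 1ℤ
  θ-< {l} {v} = choose-yes (l <? v)

  θ-≥ : ∀ {l v} → v ℕ.≤ l → θ l v ≡ 0ℤ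
  θ-≥ {l} {v} le = choose-no (l <? v) (ℕₚ.≤⇒≯ le)

  θ-suc : ∀ l v → l ≢ v → θ l (suc v) ≡ θ l v
  θ-suc l v l≢v with l <? v
  ... | yes lt = θ-< (ℕₚ.m≤n⇒m≤1+n lt)
  ... | no ¬lt = θ-≥ (ℕₚ.≤∧≢⇒< (ℕₚ.≮⇒≥ ¬lt) (λ e → l≢v (sym e)))

  θ-pred : ∀ l v → suc l ≢ v → θ l v ≡ θ (suc l) v
  θ-pred l v l≢v with suc l <? v
  ... | yes lt = θ-< (ℕₚ.<-trans (ℕₚ.n<1+n l) lt)
  ... | no ¬lt = θ-≥ (ℕₚ.≤-pred (ℕₚ.≤∧≢⇒< (ℕₚ.≮⇒≥ ¬lt) (λ e → l≢v (sym e))))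

  module LimitModel {n : ℕ} {A : ℕ → ℕ → Set} (L : Layout n A) (base : ℕ) (large : 10 ℕ.+ 4 ℕ.* n ℕ.≤ base) where
    open ClassStructure L public
    open Slopes n base large public

    slope : ℕ → ℤ
    slope l = σ (residue l)

    jump : ℕ → ℤ → ℤ
    jump l s = choose (A? l (suc l)) 0ℤ s

    jump-0 : ∀ l → jump l 0ℤ ≡ 0ℤ
    jump-0 l with A? l (suc l)
    ... | yes _ = refl
    ... | no _ = refl

    jump-link : ∀ {l} s → Lk l → jump l s ≡ 0ℤ
    jump-link {l} s k = choose-yes (A? l (suc l)) k

    jump-break : ∀ {l} s → ¬ Lk l → jump l s ≡ s
    jump-break {l} s ¬k = choose-no (A? l (suc l)) ¬k

    jump-linear : ∀ l t s s′ → jump l (t * s + s′) ≡ t * jump l s + jump l s′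
    jump-linear l t s s′ with A? l (suc l)
    ... | yes _ = sym (trans (ℤₚ.+-identityʳ _) (ℤₚ.*-zeroʳ t))
    ... | no _ = refl

    -- The ordinates forced by abscissae x along the steep paths; s moves the paths freely.
    path : (ℕ → ℤ) → (ℕ → ℤ) → ℕ → ℤ
    path x s zero = 0ℤ
    path x s (suc l) = path x s l + (slope l * (x (suc l) - x l) + jump l (s l))

    abstract
      path-linear : ∀ t x s x′ s′ l → path (λ i → t * x i + x′ i) (λ i → t * s i + s′ i) l ≡ t * path x s l + path x′ s′ l
      path-linear t x s x′ s′ zero = sym (trans (ℤₚ.+-identityʳ _) (ℤₚ.*-zeroʳ t))
      path-linear t x s x′ s′ (suc l) = trans (cong₂ (λ a b → a + (slope l * ((t * x (suc l) + x′ (suc l)) - (t * x l + x′ l)) + b)) (path-linear t x s x′ s′ l) (jump-linear l t (s l) (s′ l)))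
        (ring t (path x s l) (path x′ s′ l) (slope l) (x (suc l)) (x l) (x′ (suc l)) (x′ l) (jump l (s l)) (jump l (s′ l)))
        where
        ring : ∀ t y y′ m a b a′ b′ j j′ → (t * y + y′) + (m * ((t * a + a′) - (t * b + b′)) + (t * j + j′)) ≡ t * (y + (m * (a - b) + j)) + (y′ + (m * (a′ - b′) + j′))
        ring = solve-∀

    path-cong : ∀ {x x′ s s′} → (∀ i → x i ≡ x′ i) → (∀ i → s i ≡ s′ i) → ∀ l → path x s l ≡ path x′ s′ l
    path-cong ex es zero = refl
    path-cong ex es (suc l) = cong₂ _+_ (path-cong ex es l) (cong₂ _+_ (cong₂ (λ a b → slope l * (a - b)) (ex (suc l)) (ex l)) (cong (jump l) (es l)))

    -- Abscissae of the classes, and shifts at the breaks.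
    Datum : Set
    Datum = (ℕ → ℤ) × (ℕ → ℤ)

    comb : ℤ → Datum → Datum → Datum
    comb t (c , s) (c′ , s′) = (λ i → t * c i + c′ i) , (λ i → t * s i + s′ i)

    X Y κ Ξ H : Datum → ℕ → ℤ
    X w l = proj₁ w (rep l)
    Y w = path (X w) (proj₂ w)
    -- To first order, N times the difference of the abscissae along the edge to the parent, whose
    -- slope is N / colour u. It vanishes at a root, where p u = u.
    κ w u = + colour u * (Y w u - Y w (p u))
    -- In the limit N → ∞ the abscissae are X + Ξ / N to first order, and the ordinates Y + H / N.
    Ξ w u = κ w u + κ w (p u)
    H w = path (Ξ w) (λ _ → 0ℤ)

    δ : ℕ → ℕ → ℤ
    δ l i = choose (i ℕ.≟ l) 1ℤ 0ℤ

    δ-self : ∀ l → δ l l ≡ 1ℤ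
    δ-self l = choose-yes (l ℕ.≟ l) refl

    δ-other : ∀ {l i} → i ≢ l → δ l i ≡ 0ℤ
    δ-other {l} {i} = choose-no (i ℕ.≟ l)

    stepDatum classDatum : ℕ → Datum
    stepDatum l = (λ _ → 0ℤ) , δ l
    classDatum k = δ k , λ _ → 0ℤ

    data Basic : Datum → Set where
      step : ∀ {l} → l ℕ.< n → Basic (stepDatum l)
      class : ∀ {k} → k ℕ.< n → Basic (classDatum k)

    basis : List Datum
    basis = map stepDatum (upTo n) ++ map classDatum (upTo n)

    basic-∈ : ∀ {b} → Basic b → b ∈ basis
    basic-∈ (step lt) = ∈-++⁺ˡ (∈-map⁺ stepDatum (∈-upTo⁺ lt))
    basic-∈ (class lt) = ∈-++⁺ʳ (map stepDatum (upTo n)) (∈-map⁺ classDatum (∈-upTo⁺ lt))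

    Y-step : ∀ {l} → ¬ Lk l → ∀ u → Y (stepDatum l) u ≡ θ l u
    Y-step {l} br zero = refl
    Y-step {l} br (suc v) with v ℕ.≟ l
    ... | yes refl = trans (cong₂ (λ a b → a + (slope v * 0ℤ + b)) (trans (Y-step br v) (θ-≥ {v} ℕₚ.≤-refl)) (jump-break 1ℤ br))
        (trans (trans (ℤₚ.+-identityˡ _) (cong (_+ 1ℤ) (ℤₚ.*-zeroʳ (slope v)))) (sym (θ-< (ℕₚ.n<1+n v))))
    ... | no ne = trans (cong₂ (λ a b → a + (slope v * 0ℤ + b)) (Y-step br v) (jump-0 v))
        (trans (cong (_+_ (θ l v)) (trans (ℤₚ.+-identityʳ _) (ℤₚ.*-zeroʳ (slope v)))) (trans (ℤₚ.+-identityʳ _) (sym (θ-suc l v (λ e → ne (sym e))))))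

    private
      incoming : ℕ → ℤ
      incoming zero = 0ℤ
      incoming (suc l) = slope l

      bend : ℕ → ℤ
      bend v = slope v - incoming v

      bend-suc : ∀ v → bend (suc v) ≡ turn (residue (suc v))
      bend-suc v = turn-next (residue v)

      bends : (ℕ → ℤ) → ℕ → ℤ
      bends x u = sum u (λ v → bend v * x v)

      -- Summation by parts: apart from a boundary term, the ordinate depends on an abscissa only
      -- through the change of slope at its vertex. Setting `incoming` to 0 at position 0 lets the
      -- start of the sum follow the same rule.
      Y-bends : ∀ k u → Y (classDatum k) u + bends (X (classDatum k)) u ≡ incoming u * X (classDatum k) u
      Y-bends k zero = sym (ℤₚ.*-zeroˡ (X (classDatum k) 0))
      Y-bends k (suc l) = trans (cong (λ j → Y w l + (slope l * (X w (suc l) - X w l) + j) + (bends (X w) l + bend l * X w l)) (jump-0 l))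
        (trans (ring₁ (Y w l) (bends (X w) l) (slope l) (incoming l) (X w (suc l)) (X w l)) (trans (cong (λ e → e + (slope l * (X w (suc l) - X w l) + (slope l - incoming l) * X w l)) (Y-bends k l)) (ring₂ (slope l) (incoming l) (X w (suc l)) (X w l))))
        where
        w = classDatum k
        ring₁ : ∀ y z m i a b → y + (m * (a - b) + 0ℤ) + (z + (m - i) * b) ≡ (y + z) + (m * (a - b) + (m - i) * b)
        ring₁ = solve-∀
        ring₂ : ∀ m i a b → i * b + (m * (a - b) + (m - i) * b) ≡ m * a
        ring₂ = solve-∀

      sum-below : ∀ k u (h : ℕ → ℤ) → k ℕ.≤ u → sum k (λ v → θ v u * h v) ≡ sum k h
      sum-below zero u h _ = refl
      sum-below (suc k) u h lt = cong₂ _+_ (sum-below k u h (ℕₚ.<⇒≤ lt)) (trans (cong (_* h k) (θ-< lt)) (ℤₚ.*-identityˡ (h k)))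

      sum-upto : ∀ k u (h : ℕ → ℤ) → u ℕ.≤ k → sum k (λ v → θ v u * h v) ≡ sum u h
      sum-upto zero zero h _ = refl
      sum-upto (suc k) u h u≤ with u ℕ.≤? k
      ... | yes u≤k = trans (cong₂ _+_ (sum-upto k u h u≤k) (trans (cong (_* h k) (θ-≥ u≤k)) (ℤₚ.*-zeroˡ (h k)))) (ℤₚ.+-identityʳ _)
      ... | no u≰k with ℕₚ.≤-antisym u≤ (ℕₚ.≰⇒> u≰k)
      ...   | refl = sum-below (suc k) u h ℕₚ.≤-refl

      sum-scale : ∀ k s (h : ℕ → ℤ) → sum k (λ v → s * h v) ≡ s * sum k h
      sum-scale zero s h = sym (ℤₚ.*-zeroʳ s)
      sum-scale (suc k) s h = trans (cong (_+ s * h k) (sum-scale k s h)) (sym (ℤₚ.*-distribˡ-+ s (sum k h) (h k)))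

      sum-+ : ∀ k (f h : ℕ → ℤ) → sum k (λ v → f v + h v) ≡ sum k f + sum k h
      sum-+ zero f h = refl
      sum-+ (suc k) f h = trans (cong (_+ (f k + h k)) (sum-+ k f h)) (ring (sum k f) (sum k h) (f k) (h k))
        where
        ring : ∀ a b c d → (a + b) + (c + d) ≡ (a + c) + (b + d)
        ring = solve-∀

      sum-zero : ∀ k → sum k (λ _ → 0ℤ) ≡ 0ℤ
      sum-zero zero = refl
      sum-zero (suc k) = trans (ℤₚ.+-identityʳ _) (sum-zero k)

    Points : Set
    Points = List (ℤ × ℕ)

    -- The linear form Σ c y(v); on the indicators θ l its value is the total coefficient beyond l.
    Λ : Points → (ℕ → ℤ) → ℤ
    Λ [] y = 0ℤ
    Λ ((c , v) ∷ g) y = c * y v + Λ g y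

    Λ-cong : ∀ {y y′} g → All (λ e → y (proj₂ e) ≡ y′ (proj₂ e)) g → Λ g y ≡ Λ g y′
    Λ-cong [] [] = refl
    Λ-cong ((c , v) ∷ g) (e ∷ es) = cong₂ (λ a b → c * a + b) e (Λ-cong g es)

    Λ-neg : ∀ g y → Λ g (λ v → - y v) ≡ - Λ g y
    Λ-neg [] y = refl
    Λ-neg ((c , v) ∷ g) y = trans (cong (_+_ (c * - y v)) (Λ-neg g y)) (ring c (y v) (Λ g y))
      where
      ring : ∀ c a b → c * - a + - b ≡ - (c * a + b)
      ring = solve-∀

    private
      Λ-sum : ∀ k g (h : ℕ → ℤ) → Λ g (λ u → sum k (λ v → θ v u * h v)) ≡ sum k (λ v → Λ g (θ v) * h v)
      Λ-sum k [] h = sym (trans (sum-cong k (λ v _ → ℤₚ.*-zeroˡ (h v))) (sum-zero k))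
      Λ-sum k ((c , u) ∷ g) h = trans (cong₂ _+_ (sym (sum-scale k c (λ v → θ v u * h v))) (Λ-sum k g h)) (trans (sym (sum-+ k (λ v → c * (θ v u * h v)) (λ v → Λ g (θ v) * h v))) (sum-cong k λ v _ → ring c (θ v u) (h v) (Λ g (θ v))))
        where
        ring : ∀ c t h r → c * (t * h) + r * h ≡ (c * t + r) * h
        ring = solve-∀

    -- The hypothesis under which the generic datum gives a form a nonzero value.
    Visible : (Datum → ℤ) → Set
    Visible f = ∃ λ b → Basic b × f b ≢ 0ℤ

    visible-cong : ∀ {f g} → (∀ b → f b ≡ g b) → Visible f → Visible g
    visible-cong eq (b , basic , ne) = b , basic , λ e → ne (trans (eq b) e)

    visible-neg : ∀ {f} → Visible f → Visible (λ b → - f b)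
    visible-neg {f} (b , basic , ne) = b , basic , λ e → ne (trans (sym (ℤₚ.neg-involutive (f b))) (cong -_ e))

    visible-scale : ∀ {f} c → c ≢ 0ℤ → Visible f → Visible (λ b → c * f b)
    visible-scale c c≢0 (b , basic , ne) = b , basic , *≢0 c≢0 ne

    visible-step : ∀ {l} g → l ℕ.< n → ¬ Lk l → Λ g (θ l) ≢ 0ℤ → Visible (λ b → Λ g (Y b))
    visible-step {l} g l<n br ne = stepDatum l , step l<n , λ e → ne (trans (sym (Λ-cong g (All.universal (λ e → Y-step br (proj₂ e)) g))) e)

    -- Either some break sees the form, or the class of l₀ does: only its (at most three) inner
    -- members count, and their turns are independent.
    one-sided : ∀ g s (weight : ℕ → ℕ) {l₀} → s ≢ 0ℤ → (∀ l → weight l ℕ.≤ 4) → (∀ l → Λ g (θ l) ≡ s * + weight l) →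
                Λ g (λ _ → 1ℤ) ≡ 0ℤ → All (λ e → proj₂ e ℕ.< n) g → l₀ ℕ.< n → weight l₀ ≢ 0 → All (λ e → rep (proj₂ e) ≢ rep l₀) g →
                ∃ λ b → Basic b × Λ g (Y b) ≢ 0ℤ × All (λ e → X b (proj₂ e) ≡ 0ℤ) g
    one-sided g s weight {l₀} s≢0 w≤4 form balanced g<n l₀<n w₀≢0 apart
      with ℕₚ.anyUpTo? (λ l → ¬? (A? l (suc l)) ×-dec ¬? (weight l ℕ.≟ 0)) n
    ... | yes (l , l<n , br , wl≢0) = stepDatum l , step l<n , (proj₂ (proj₂ (visible-step g l<n br nonzero))) , All.universal (λ _ → refl) g
      where
      nonzero : Λ g (θ l) ≢ 0ℤ
      nonzero e = *≢0 s≢0 (λ e′ → wl≢0 (ℤₚ.+-injective e′)) (trans (sym (form l)) e)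
    ... | no unbroken = classDatum k , class (rep-< l₀<n) , nonzero , X≡0
      where
      k = rep l₀
      w = classDatum k
      h : ℕ → ℤ
      h v = bend v * X w v
      f : ℕ → ℕ
      f v = choose (rep v ℕ.≟ k) (weight v) 0
      f-in : ∀ {v} → rep v ≡ k → f v ≡ weight v
      f-in {v} e with rep v ℕ.≟ k
      ... | yes _ = refl
      ... | no ne = ⊥-elim (ne e)
      f≢0 : ∀ {v} → f v ≢ 0 → rep v ≡ k × weight v ≢ 0
      f≢0 {v} ne with rep v ℕ.≟ k
      ... | yes e = e , ne
      ... | no _ = ⊥-elim (ne refl)
      X≡0 : All (λ e → X w (proj₂ e) ≡ 0ℤ) g
      X≡0 = All.map (λ ne → δ-other ne) apart
      off-support : ∀ {v} → rep v ≡ k → All (λ e → v ≢ proj₂ e) g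
      off-support rv = All.map (λ ne e → ne (trans (cong rep (sym e)) rv)) apart
      links : ∀ {v} → v ℕ.< n → weight v ≢ 0 → Lk v
      links {v} v<n ne with A? v (suc v)
      ... | yes l = l
      ... | no br = ⊥-elim (unbroken (v , v<n , br , ne))
      inner : ∀ v → v ℕ.< n → rep v ≡ k → weight v ≢ 0 → Inner v
      -- Position 0 is not a point of `g`, so all points lie beyond it and the value of the form on
      -- `θ 0` is the total coefficient, which is 0.
      inner zero _ rv ne = ⊥-elim (*≢0 s≢0 (λ e → ne (ℤₚ.+-injective e)) (trans (sym (form 0))
        (trans (Λ-cong g (All.map (λ {e} v≢ → θ-< (ℕₚ.n≢0⇒n>0 (λ e → v≢ (sym e)))) (off-support rv))) balanced)))
      inner (suc v) v<n rv ne = links (ℕₚ.<-trans (ℕₚ.n<1+n v) v<n) ne′ , links v<n ne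
        where
        -- From v to v + 1 the coefficient beyond changes only by that of a point of `g` at v + 1,
        -- and no point of `g` lies in this class.
        ne′ : weight v ≢ 0
        ne′ e = *≢0 s≢0 (λ e′ → ne (ℤₚ.+-injective e′)) (trans (sym (form (suc v)))
          (trans (Λ-cong g (All.map (λ {e} v≢ → sym (θ-pred v (proj₂ e) v≢)) (off-support rv))) (trans (form v) (trans (cong (λ z → s * + z) e) (ℤₚ.*-zeroʳ s)))))
      member : Fin 4 → ℕ → Set
      member r v = v ℕ.< n × f v ≢ 0 × residue v ≡ r
      find : ∀ r → (∃ (member r)) ⊎ (∀ v → v ℕ.< n → f v ≢ 0 → residue v ≢ r)
      find r with ℕₚ.anyUpTo? (λ v → ¬? (f v ℕ.≟ 0) ×-dec (residue v Fin.≟ r)) n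
      ... | yes (v , lt , ne , e) = inj₁ (v , lt , ne , e)
      ... | no none = inj₂ λ v lt ne e → none (v , lt , ne , e)
      member-inner : ∀ {r v} → member r v → Inner v × rep v ≡ k
      member-inner {r} {v} (lt , ne , _) = inner v lt (proj₁ (f≢0 ne)) (proj₂ (f≢0 ne)) , proj₁ (f≢0 ne)
      -- Members with all four residues would be four distinct inner vertices of one class.
      missing : ∃ λ r → ∀ v → v ℕ.< n → f v ≢ 0 → residue v ≢ r
      missing with find 0F | find 1F | find 2F | find 3F
      ... | inj₂ m | _ | _ | _ = 0F , m
      ... | inj₁ _ | inj₂ m | _ | _ = 1F , m
      ... | inj₁ _ | inj₁ _ | inj₂ m | _ = 2F , m
      ... | inj₁ _ | inj₁ _ | inj₁ _ | inj₂ m = 3F , m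
      ... | inj₁ (a , ma) | inj₁ (b , mb) | inj₁ (c , mc) | inj₁ (d , md) =
        ⊥-elim (four-inner (proj₁ ia) (proj₁ ib) (proj₁ ic) (proj₁ id′)
          (trans (proj₂ ib) (sym (proj₂ ia))) (trans (proj₂ ic) (sym (proj₂ ia))) (trans (proj₂ id′) (sym (proj₂ ia)))
          (apart′ mb mc λ ()) (apart′ mb md λ ()) (apart′ mc md λ ()) (apart′ ma mb λ ()) (apart′ ma mc λ ()) (apart′ ma md λ ()))
        where
        ia = member-inner ma
        ib = member-inner mb
        ic = member-inner mc
        id′ = member-inner md
        apart′ : ∀ {r r′ v v′} → member r v → member r′ v′ → r ≢ r′ → v ≢ v′
        apart′ (_ , _ , e) (_ , _ , e′) ne refl = ne (trans (sym e) e′)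
      f≤4 : ∀ v → f v ℕ.≤ 4
      f≤4 v with rep v ℕ.≟ k
      ... | yes _ = w≤4 v
      ... | no _ = z≤n
      f₀ : f l₀ ≢ 0
      f₀ e = w₀≢0 (trans (sym (f-in refl)) e)
      f0≡0 : 0 ℕ.< n → f 0 ≡ 0
      f0≡0 0<n with f 0 ℕ.≟ 0
      ... | yes e = e
      ... | no ne = ⊥-elim (inner 0 0<n (proj₁ (f≢0 ne)) (proj₂ (f≢0 ne)))
      term : ∀ v → v ℕ.< n → Λ g (θ v) * (bend v * X w v) ≡ s * (+ f v * turn (residue v))
      term zero 0<n = trans (cong (_* (bend 0 * X w 0)) (form 0)) (trans zero-term (sym (trans (cong (λ z → s * (+ z * turn 0F)) (f0≡0 0<n)) (trans (cong (s *_) (ℤₚ.*-zeroˡ (turn 0F))) (ℤₚ.*-zeroʳ s)))))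
        where
        zero-term : s * + weight 0 * (bend 0 * X w 0) ≡ 0ℤ
        zero-term with rep 0 ℕ.≟ k
        ... | no _ = trans (cong (s * + weight 0 *_) (ℤₚ.*-zeroʳ (bend 0))) (ℤₚ.*-zeroʳ (s * + weight 0))
        ... | yes e = trans (cong (λ z → s * + z * (bend 0 * 1ℤ)) (trans (sym (f-in e)) (f0≡0 0<n))) (trans (cong (_* (bend 0 * 1ℤ)) (ℤₚ.*-zeroʳ s)) (ℤₚ.*-zeroˡ (bend 0 * 1ℤ)))
      term (suc v) v<n = trans (cong₂ (λ a b → a * (b * X w (suc v))) (form (suc v)) (bend-suc v)) masked
        where
        masked : s * + weight (suc v) * (turn (residue (suc v)) * X w (suc v)) ≡ s * (+ f (suc v) * turn (residue (suc v)))
        masked with rep (suc v) ℕ.≟ k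
        ... | yes _ = ring s (+ weight (suc v)) (turn (residue (suc v)))
          where
          ring : ∀ s a t → s * a * (t * 1ℤ) ≡ s * (a * t)
          ring = solve-∀
        ... | no _ = ring s (+ weight (suc v)) (turn (residue (suc v)))
          where
          ring : ∀ s a t → s * a * (t * 0ℤ) ≡ s * (0ℤ * t)
          ring = solve-∀
      -- At the points of `g` the abscissa is 0, so the boundary term of the summation by parts
      -- drops out.
      Y≡ : All (λ e → Y w (proj₂ e) ≡ - sum n (λ v → θ v (proj₂ e) * (bend v * X w v))) g
      Y≡ = All.zipWith (λ { {_ , u} (x≡0 , u<n) → trans (solved (Y w u) (bends (X w) u) (trans (Y-bends k u) (trans (cong (incoming u *_) x≡0) (ℤₚ.*-zeroʳ (incoming u)))))
          (cong -_ (sym (sum-upto n u h (ℕₚ.<⇒≤ u<n)))) }) (X≡0 , g<n)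
        where
        solved : ∀ y z → y + z ≡ 0ℤ → y ≡ - z
        solved y z e = trans (ring y z) (trans (cong (_- z) e) (ℤₚ.+-identityˡ (- z)))
          where
          ring : ∀ y z → y ≡ (y + z) - z
          ring = solve-∀
      value : Λ g (Y w) ≡ - (s * sum n (λ v → + f v * turn (residue v)))
      value = trans (Λ-cong g Y≡) (trans (Λ-neg g (λ u → sum n (λ v → θ v u * h v))) (cong -_ (trans (Λ-sum n g h) (trans (sum-cong n term) (sum-scale n s (λ v → + f v * turn (residue v)))))))
      nonzero : Λ g (Y w) ≢ 0ℤ
      nonzero e = *≢0 s≢0 (turns-independent f (proj₁ missing) f≤4 (proj₂ missing) l₀ l₀<n f₀)
        (trans (sym (ℤₚ.neg-involutive _)) (cong -_ (trans (sym value) e)))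

-- Forms at an outer vertex and forms across a third class.

module Visible where
  open LinAlg
  open Arrange
  open Classes
  open Numbers
  open Limit
  open import Data.Integer using (+_; -_; _+_; _*_; _-_)
  open import Data.Integer.Tactic.RingSolver using (solve-∀)
  open import Relation.Binary.PropositionalEquality

  within : ℕ → ℕ → ℕ → ℕ
  within a b l = choose (l <? b) (choose (l <? a) 0 1) 0

  within-θ : ∀ {a b} l → a ℕ.≤ b → θ l b - θ l a ≡ + within a b l
  within-θ {a} {b} l a≤b with l <? b | l <? a
  ... | yes _ | yes _ = refl
  ... | yes _ | no _ = refl
  ... | no ¬b | yes la = ⊥-elim (¬b (ℕₚ.<-≤-trans la a≤b))
  ... | no _ | no _ = refl

  within≤1 : ∀ a b l → within a b l ℕ.≤ 1
  within≤1 a b l with l <? b | l <? a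
  ... | yes _ | yes _ = z≤n
  ... | yes _ | no _ = ℕₚ.≤-refl
  ... | no _ | _ = z≤n

  within-inside : ∀ {a b l} → a ℕ.≤ l → l ℕ.< b → within a b l ≡ 1
  within-inside {a} {b} {l} a≤l l<b with l <? b | l <? a
  ... | yes _ | yes l<a = ⊥-elim (ℕₚ.<⇒≱ l<a a≤l)
  ... | yes _ | no _ = refl
  ... | no ¬b | _ = ⊥-elim (¬b l<b)

  ≢0-+ : ∀ {a b} → a ≢ 0 ⊎ b ≢ 0 → a ℕ.+ b ≢ 0
  ≢0-+ (inj₁ a) e = a (ℕₚ.m+n≡0⇒m≡0 _ e)
  ≢0-+ {a} (inj₂ b) e = b (ℕₚ.m+n≡0⇒n≡0 a e)

  +≢0 : ∀ {m} → m ≢ 0 → + m ≢ 0ℤ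
  +≢0 ne e = ne (ℤₚ.+-injective e)

  -≢0 : ∀ {i} → i ≢ 0ℤ → - i ≢ 0ℤ
  -≢0 {i} ne e = ne (trans (sym (ℤₚ.neg-involutive i)) (cong -_ e))

  module VisibleForms {n : ℕ} {A : ℕ → ℕ → Set} (L : Layout n A) (base : ℕ) (large : 10 ℕ.+ 4 ℕ.* n ℕ.≤ base) where
    open LimitModel L base large public

    private
      -- A target t of a fan at z with coefficient c, known not to lie on one side of z.
      Beyond Before : ℕ → ℕ → ℕ → Set
      Beyond z c t = c ≡ 0 ⊎ z ℕ.< t
      Before z c t = c ≡ 0 ⊎ t ℕ.< z

      beyond? : ∀ z c t → t ≢ z → Beyond z c t ⊎ (c ≢ 0 × t ℕ.< z)
      beyond? z c t ne with c ℕ.≟ 0 | ℕₚ.<-cmp t z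
      ... | yes e | _ = inj₁ (inj₁ e)
      ... | no _ | tri> _ _ gt = inj₁ (inj₂ gt)
      ... | no c≢0 | tri< lt _ _ = inj₂ (c≢0 , lt)
      ... | no _ | tri≈ _ e _ = ⊥-elim (ne e)

      before? : ∀ z c t → t ≢ z → Before z c t ⊎ (c ≢ 0 × z ℕ.< t)
      before? z c t ne with c ℕ.≟ 0 | ℕₚ.<-cmp t z
      ... | yes e | _ = inj₁ (inj₁ e)
      ... | no _ | tri< lt _ _ = inj₁ (inj₂ lt)
      ... | no c≢0 | tri> _ _ gt = inj₂ (c≢0 , gt)
      ... | no _ | tri≈ _ e _ = ⊥-elim (ne e)

      beyond-term : ∀ {z c t} l → Beyond z c t → + c * (θ l z - θ l t) ≡ - (+ (c ℕ.* within z t l))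
      beyond-term {z} {t = t} l (inj₁ refl) = ℤₚ.*-zeroˡ (θ l z - θ l t)
      beyond-term {z} {c} {t} l (inj₂ z<t) = trans (ring (+ c) (θ l z) (θ l t)) (cong -_ (trans (cong (+ c *_) (within-θ l (ℕₚ.<⇒≤ z<t))) (sym (ℤₚ.pos-* c _))))
        where
        ring : ∀ c a b → c * (a - b) ≡ - (c * (b - a))
        ring = solve-∀

      before-term : ∀ {z c t} l → Before z c t → + c * (θ l z - θ l t) ≡ + (c ℕ.* within t z l)
      before-term {z} {t = t} l (inj₁ refl) = ℤₚ.*-zeroˡ (θ l z - θ l t)
      before-term {z} {c} {t} l (inj₂ t<z) = trans (cong (+ c *_) (within-θ l (ℕₚ.<⇒≤ t<z))) (sym (ℤₚ.pos-* c _))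

      left-value : ∀ {z} c t → ∃ λ m → + c * (θ z (suc z) - θ z t) ≡ + m × (c ≢ 0 × t ℕ.< suc z → m ≢ 0)
      left-value {z} c t with t ℕ.≤? z
      ... | yes t≤z = c , trans (cong₂ (λ e f → + c * (e - f)) (θ-< (ℕₚ.n<1+n z)) (θ-≥ t≤z)) (ℤₚ.*-identityʳ (+ c)) , proj₁
      ... | no t≰z = 0 , trans (cong₂ (λ e f → + c * (e - f)) (θ-< (ℕₚ.n<1+n z)) (θ-< (ℕₚ.≰⇒> t≰z))) (ℤₚ.*-zeroʳ (+ c)) , λ (_ , lt) _ → t≰z (ℕₚ.≤-pred lt)

      right-value : ∀ z c t → ∃ λ m → + c * (θ z z - θ z t) ≡ - (+ m) × (c ≢ 0 × z ℕ.< t → m ≢ 0)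
      right-value z c t = go (z <? t)
        where
        ring : ∀ c → c * (0ℤ - 1ℤ) ≡ - c
        ring = solve-∀
        go : Dec (z ℕ.< t) → ∃ λ m → + c * (θ z z - θ z t) ≡ - (+ m) × (c ≢ 0 × z ℕ.< t → m ≢ 0)
        go (yes z<t) = c , trans (cong₂ (λ e f → + c * (e - f)) (θ-≥ {z} ℕₚ.≤-refl) (θ-< z<t)) (ring (+ c)) , proj₁
        go (no z≮t) = 0 , trans (cong₂ (λ e f → + c * (e - f)) (θ-≥ {z} ℕₚ.≤-refl) (θ-≥ (ℕₚ.≮⇒≥ z≮t))) (ℤₚ.*-zeroʳ (+ c)) , λ (_ , lt) _ → z≮t lt

    -- As z is not inner, one of the two gaps at z is a break. If a target with nonzero coefficient
    -- lies behind it, the break sees the form, because all contributions there have one sign.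
    -- Otherwise all such targets lie on the other side. If there is a break on that side too, it
    -- sees the form; if there is a link, the linked neighbour of z lies in another class and starts
    -- `one-sided`.
    module Fan {z c₁ t₁ c₂ t₂ : ℕ} (outer : ¬ Inner z) (z<n : z ℕ.< n) (t₁<n : t₁ ℕ.< n) (t₂<n : t₂ ℕ.< n)
               (t₁≢z : t₁ ≢ z) (t₂≢z : t₂ ≢ z) (rep₁ : rep t₁ ≡ rep z) (rep₂ : rep t₂ ≡ rep z)
               (c₁≤2 : c₁ ℕ.≤ 2) (c₂≤2 : c₂ ℕ.≤ 2) (some : c₁ ≢ 0 ⊎ c₂ ≢ 0) where

      private
        g : Points
        g = (+ c₁ + + c₂ , z) ∷ (- (+ c₁) , t₁) ∷ (- (+ c₂) , t₂) ∷ []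

        form : (ℕ → ℤ) → ℤ
        form y = + c₁ * (y z - y t₁) + + c₂ * (y z - y t₂)

        Λ-form : ∀ y → Λ g y ≡ form y
        Λ-form y = ring (+ c₁) (+ c₂) (y z) (y t₁) (y t₂)
          where
          ring : ∀ a b x y z → (a + b) * x + (- a * y + (- b * z + 0ℤ)) ≡ a * (x - y) + b * (x - z)
          ring = solve-∀

        balanced : Λ g (λ _ → 1ℤ) ≡ 0ℤ
        balanced = trans (Λ-form (λ _ → 1ℤ)) (ring (+ c₁) (+ c₂))
          where
          ring : ∀ a b → a * (1ℤ - 1ℤ) + b * (1ℤ - 1ℤ) ≡ 0ℤ
          ring = solve-∀

        finish : Visible (λ b → Λ g (Y b)) → Visible (λ b → form (Y b))
        finish = visible-cong (λ b → Λ-form (Y b))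

        g<n : All (λ e → proj₂ e ℕ.< n) g
        g<n = z<n ∷ t₁<n ∷ t₂<n ∷ []

        apart : ∀ {l} → rep l ≢ rep z → All (λ e → rep (proj₂ e) ≢ rep l) g
        apart ne = (λ e → ne (sym e)) ∷ (λ e → ne (trans (sym e) rep₁)) ∷ (λ e → ne (trans (sym e) rep₂)) ∷ []

        weight≤4 : ∀ {a b c d a′ b′ c′ d′} → a ℕ.≤ 2 → a′ ℕ.≤ 2 → a ℕ.* within b c d ℕ.+ a′ ℕ.* within b′ c′ d′ ℕ.≤ 4
        weight≤4 {a} {b} {c} {d} {a′} {b′} {c′} {d′} p q = ℕₚ.+-mono-≤ (ℕₚ.*-mono-≤ p (within≤1 b c d)) (ℕₚ.*-mono-≤ q (within≤1 b′ c′ d′))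

        left-break : ∀ {z′} → z ≡ suc z′ → ¬ Lk z′ → (c₁ ≢ 0 × t₁ ℕ.< z) ⊎ (c₂ ≢ 0 × t₂ ℕ.< z) → Visible (λ b → form (Y b))
        left-break {z′} refl br active with left-value {z′} c₁ t₁ | left-value {z′} c₂ t₂
        ... | m₁ , e₁ , p₁ | m₂ , e₂ , p₂ = finish (visible-step g (ℕₚ.<-trans (ℕₚ.n<1+n z′) z<n) br
            λ e → +≢0 (≢0-+ (pick active)) (trans (sym (trans (Λ-form (θ z′)) (cong₂ _+_ e₁ e₂))) e))
          where
          pick : (c₁ ≢ 0 × t₁ ℕ.< z) ⊎ (c₂ ≢ 0 × t₂ ℕ.< z) → m₁ ≢ 0 ⊎ m₂ ≢ 0
          pick (inj₁ a) = inj₁ (p₁ a)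
          pick (inj₂ a) = inj₂ (p₂ a)

        right-break : ¬ Lk z → (c₁ ≢ 0 × z ℕ.< t₁) ⊎ (c₂ ≢ 0 × z ℕ.< t₂) → Visible (λ b → form (Y b))
        right-break br active with right-value z c₁ t₁ | right-value z c₂ t₂
        ... | m₁ , e₁ , p₁ | m₂ , e₂ , p₂ = finish (visible-step g z<n br
            λ e → -≢0 (+≢0 (≢0-+ (pick active))) (trans (sym (trans (Λ-form (θ z)) (trans (cong₂ _+_ e₁ e₂) (sym (ℤₚ.neg-distrib-+ (+ m₁) (+ m₂)))))) e))
          where
          pick : (c₁ ≢ 0 × z ℕ.< t₁) ⊎ (c₂ ≢ 0 × z ℕ.< t₂) → m₁ ≢ 0 ⊎ m₂ ≢ 0
          pick (inj₁ a) = inj₁ (p₁ a)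
          pick (inj₂ a) = inj₂ (p₂ a)

        active-beyond : ∀ {c t} → c ≢ 0 → Beyond z c t → z ℕ.< t
        active-beyond ne (inj₁ e) = ⊥-elim (ne e)
        active-beyond ne (inj₂ lt) = lt

        active-before : ∀ {c t} → c ≢ 0 → Before z c t → t ℕ.< z
        active-before ne (inj₁ e) = ⊥-elim (ne e)
        active-before ne (inj₂ lt) = lt

        *1≢0 : ∀ {c w} → c ≢ 0 → w ≡ 1 → c ℕ.* w ≢ 0
        *1≢0 {c} ne refl e = ne (trans (sym (ℕₚ.*-identityʳ c)) e)

        right-fan : Lk z → Beyond z c₁ t₁ → Beyond z c₂ t₂ → Visible (λ b → form (Y b))
        right-fan lk b₁ b₂ = finish (proj₁ seen , proj₁ (proj₂ seen) , proj₁ (proj₂ (proj₂ seen)))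
          where
          mass : ℕ → ℕ
          mass l = c₁ ℕ.* within z t₁ l ℕ.+ c₂ ℕ.* within z t₂ l
          far : rep (suc z) ≢ rep z
          far = outer-step outer lk
          reach : ∀ {c t} → rep t ≡ rep z → c ≢ 0 → Beyond z c t → c ℕ.* within z t (suc z) ≢ 0
          reach {c} {t} rt ne b = *1≢0 ne (within-inside (ℕₚ.n≤1+n z) (ℕₚ.≤∧≢⇒< (active-beyond ne b) λ { refl → far rt }))
          heavy : mass (suc z) ≢ 0
          heavy = [ (λ ne → ≢0-+ (inj₁ (reach rep₁ ne b₁))) , (λ ne → ≢0-+ {c₁ ℕ.* within z t₁ (suc z)} (inj₂ (reach rep₂ ne b₂))) ]′ some
          ring : ∀ a b → - a + - b ≡ -1ℤ * (a + b)
          ring = solve-∀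
          seen = one-sided g -1ℤ mass (λ ()) (λ l → weight≤4 {b = z} {t₁} {l} {b′ = z} {t₂} {l} c₁≤2 c₂≤2)
            (λ l → trans (Λ-form (θ l)) (trans (cong₂ _+_ (beyond-term l b₁) (beyond-term l b₂)) (ring (+ (c₁ ℕ.* within z t₁ l)) (+ (c₂ ℕ.* within z t₂ l)))))
            balanced g<n (A-< (A-sym lk)) heavy (apart far)

        left-fan : ∀ {z′} → z ≡ suc z′ → Lk z′ → Before z c₁ t₁ → Before z c₂ t₂ → Visible (λ b → form (Y b))
        left-fan {z′} refl lk b₁ b₂ = finish (proj₁ seen , proj₁ (proj₂ seen) , proj₁ (proj₂ (proj₂ seen)))
          where
          mass : ℕ → ℕ
          mass l = c₁ ℕ.* within t₁ z l ℕ.+ c₂ ℕ.* within t₂ z l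
          far : rep z′ ≢ rep z
          far = outer-step′ outer lk
          reach : ∀ {c t} → c ≢ 0 → Before z c t → c ℕ.* within t z z′ ≢ 0
          reach ne b = *1≢0 ne (within-inside (ℕₚ.≤-pred (active-before ne b)) ℕₚ.≤-refl)
          heavy : mass z′ ≢ 0
          heavy = [ (λ ne → ≢0-+ (inj₁ (reach ne b₁))) , (λ ne → ≢0-+ {c₁ ℕ.* within t₁ z z′} (inj₂ (reach ne b₂))) ]′ some
          seen = one-sided g 1ℤ mass (λ ()) (λ l → weight≤4 {b = t₁} {z} {l} {b′ = t₂} {z} {l} c₁≤2 c₂≤2)
            (λ l → trans (Λ-form (θ l)) (trans (cong₂ _+_ (before-term l b₁) (before-term l b₂)) (sym (ℤₚ.*-identityˡ (+ mass l)))))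
            balanced g<n (A-< lk) heavy (apart far)

        right-side : (∀ {z′} → z ≡ suc z′ → ¬ Lk z′) → Visible (λ b → form (Y b))
        right-side br with beyond? z c₁ t₁ t₁≢z | beyond? z c₂ t₂ t₂≢z
        ... | inj₂ a | _ = left z refl
          where
          left : ∀ y → z ≡ y → Visible (λ b → form (Y b))
          left zero e = ⊥-elim (ℕₚ.n≮0 (subst (t₁ ℕ.<_) e (proj₂ a)))
          left (suc z′) e = left-break e (br e) (inj₁ a)
        ... | inj₁ _ | inj₂ a = left z refl
          where
          left : ∀ y → z ≡ y → Visible (λ b → form (Y b))
          left zero e = ⊥-elim (ℕₚ.n≮0 (subst (t₂ ℕ.<_) e (proj₂ a)))
          left (suc z′) e = left-break e (br e) (inj₂ a)
        ... | inj₁ b₁ | inj₁ b₂ with A? z (suc z)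
        ...   | yes lk = right-fan lk b₁ b₂
        ...   | no br′ = [ (λ ne → right-break br′ (inj₁ (ne , active-beyond ne b₁))) , (λ ne → right-break br′ (inj₂ (ne , active-beyond ne b₂))) ]′ some

        left-side : ∀ {z′} → z ≡ suc z′ → Lk z′ → ¬ Lk z → Visible (λ b → form (Y b))
        left-side e lk br with before? z c₁ t₁ t₁≢z | before? z c₂ t₂ t₂≢z
        ... | inj₂ a | _ = right-break br (inj₁ a)
        ... | inj₁ _ | inj₂ a = right-break br (inj₂ a)
        ... | inj₁ b₁ | inj₁ b₂ = left-fan e lk b₁ b₂

      fan : Visible (λ b → + c₁ * (Y b z - Y b t₁) + + c₂ * (Y b z - Y b t₂))
      fan = go z refl
        where
        go : ∀ y → z ≡ y → Visible (λ b → form (Y b))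
        go zero e = right-side (λ e′ → ⊥-elim (ℕₚ.0≢1+n (trans (sym e) e′)))
        go (suc z′) e with A? z′ (suc z′)
        ... | no br = right-side (λ e′ → subst (λ y → ¬ Lk y) (ℕₚ.suc-injective (trans (sym e) e′)) br)
        ... | yes lk = left-side e lk (λ lk′ → outer (subst Inner (sym e) (lk , subst Lk e lk′)))

    fan₁ : ∀ {z t} → ¬ Inner z → z ℕ.< n → t ℕ.< n → t ≢ z → rep t ≡ rep z → Visible (λ b → Y b z - Y b t)
    fan₁ {z} {t} o z< t< ne e = visible-cong (λ b → ring (Y b z) (Y b t)) (Fan.fan {c₁ = 1} {c₂ = 0} o z< t< t< ne ne e e (s≤s z≤n) z≤n (inj₁ λ ()))
      where
      ring : ∀ a b → 1ℤ * (a - b) + 0ℤ * (a - b) ≡ a - b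
      ring = solve-∀

    R-< : ∀ {u v} → R u v → u ℕ.< n
    R-< (a , _) = A-< a

    R-<′ : ∀ {u v} → R u v → v ℕ.< n
    R-<′ r = R-< (R-sym r)

    rep-par : ∀ {u w} → Par u w → rep u ≡ rep w
    rep-par {u} {w} q with view u
    ... | root r = ⊥-elim (r w q)
    ... | child q′ r with par-unique q q′
    ...   | refl = trans (rep-child q′ r) (sym (rep-root r))
    rep-par {u} {w} q | nephew l k with par-unique q (leaf l)
    ... | refl = trans (rep-nephew l k) (sym (rep-child (close k) (close-root k)))

    -- The abscissae of `p` and `q` are kept at 0 in the conclusion, so that one datum refutes lines
    -- of every slope m through both points.
    pair-apart : ∀ {p q l₀} → p ℕ.< l₀ → l₀ ℕ.< q → q ℕ.< n → rep l₀ ≢ rep p → rep l₀ ≢ rep q →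
                 ∃ λ b → Basic b × Y b q - Y b p ≢ 0ℤ × X b p ≡ 0ℤ × X b q ≡ 0ℤ
    pair-apart {p} {q} {l₀} p< <q q<n np nq = finish (one-sided g 1ℤ (within p q) {l₀} (λ ()) (λ l → ℕₚ.≤-trans (within≤1 p q l) (s≤s z≤n))
        (λ l → trans (Λ-form (θ l)) (trans (within-θ l (ℕₚ.<⇒≤ p<q)) (sym (ℤₚ.*-identityˡ (+ within p q l))))) refl (q<n ∷ ℕₚ.<-trans p<q q<n ∷ [])
        (ℕₚ.<-trans <q q<n) (λ e → ℕₚ.0≢1+n (trans (sym e) (within-inside (ℕₚ.<⇒≤ p<) <q))) ((λ e → nq (sym e)) ∷ (λ e → np (sym e)) ∷ []))
      where
      p<q = ℕₚ.<-trans p< <q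
      g : Points
      g = (1ℤ , q) ∷ (-1ℤ , p) ∷ []
      Λ-form : ∀ y → Λ g y ≡ y q - y p
      Λ-form y = ring (y q) (y p)
        where
        ring : ∀ a b → 1ℤ * a + (-1ℤ * b + 0ℤ) ≡ a - b
        ring = solve-∀
      finish : (∃ λ b → Basic b × Λ g (Y b) ≢ 0ℤ × All (λ e → X b (proj₂ e) ≡ 0ℤ) g) → ∃ λ b → Basic b × Y b q - Y b p ≢ 0ℤ × X b p ≡ 0ℤ × X b q ≡ 0ℤ
      finish (b , basic , ne , (xq ∷ xp ∷ [])) = b , basic , (λ e → ne (trans (Λ-form (Y b)) e)) , xp , xq

    -- Separates the ends of a remaining edge, which may be vertical and thus have equal abscissae.
    -- In a twin pair neither end is outer and no fan is available; instead the successor of the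
    -- earlier twin lies between the two in another class.
    parent-visible : ∀ {u w} → Par u w → Visible (λ b → Y b u - Y b w)
    parent-visible {u} {w} q@(leaf (r , _ , o)) = visible-cong (λ b → ring (Y b w) (Y b u)) (visible-neg (fan₁ o (R-<′ r) (R-< r) (R-irr r) (rep-par q)))
      where
      ring : ∀ a b → - (a - b) ≡ b - a
      ring = solve-∀
    parent-visible {u} {w} q@(close (r , _ , o , _)) = visible-cong (λ b → ring (Y b w) (Y b u)) (visible-neg (fan₁ o (R-<′ r) (R-< r) (R-irr r) (rep-par q)))
      where
      ring : ∀ a b → - (a - b) ≡ b - a
      ring = solve-∀
    parent-visible {u} {w} q@(twin (r , i , j , w<u)) =
      proj₁ seen , proj₁ (proj₂ seen) , proj₁ (proj₂ (proj₂ seen))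
      where
      far : rep (suc w) ≢ rep w
      far = inner-step j (R-sym r) i
      seen = pair-apart {l₀ = suc w} (ℕₚ.n<1+n w) (ℕₚ.≤∧≢⇒< w<u (λ e → proj₂ (proj₂ r) (sym e))) (R-< r) far (λ e → far (trans e (rep-par q)))

-- Pairs within one class against the slopes ∞, N and N / 2.

module ClassForms where
  open LinAlg
  open Arrange using (Layout)
  open Classes
  open Numbers
  open Limit
  open Visible
  open import Data.Integer using (+_; -_; _+_; _*_; _-_)
  open import Data.Integer.Tactic.RingSolver using (solve-∀)
  open import Relation.Binary.PropositionalEquality

  module SameClassForms {n : ℕ} {A : ℕ → ℕ → Set} (L : Layout n A) (base : ℕ) (large : 10 ℕ.+ 4 ℕ.* n ℕ.≤ base) where
    open VisibleForms L base large public

    κ-par : ∀ {u w} b → Par u w → κ b u ≡ + colour u * (Y b u - Y b w)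
    κ-par {u} b q = cong (λ w → + colour u * (Y b u - Y b w)) (p-par q)

    κ-root : ∀ {u} b → Root u → κ b u ≡ 0ℤ
    κ-root {u} b r = trans (cong (λ w → + colour u * (Y b u - Y b w)) (p-root r)) (trans (cong (+ colour u *_) (ℤₚ.+-inverseʳ (Y b u))) (ℤₚ.*-zeroʳ (+ colour u)))

    Ξ-root : ∀ {u} b → Root u → Ξ b u ≡ 0ℤ
    Ξ-root {u} b r = cong₂ _+_ (κ-root b r) (trans (cong (κ b) (p-root r)) (κ-root b r))

    Ξ-child : ∀ {u w} b → Par u w → Root w → Ξ b u ≡ + colour u * (Y b u - Y b w)
    Ξ-child b q r = trans (cong₂ _+_ (κ-par b q) (trans (cong (κ b) (p-par q)) (κ-root b r))) (ℤₚ.+-identityʳ _)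

    Ξ-nephew : ∀ {u c e} b → Leaf u c → Close c e → Ξ b u ≡ + colour u * (Y b u - Y b c) + + colour c * (Y b c - Y b e)
    Ξ-nephew b l k = cong₂ _+_ (κ-par b (leaf l)) (trans (cong (κ b) (p-par (leaf l))) (κ-par b (close k)))

    -- For u and v in one class, the leading part of N (x_u - x_v) - k (y_u - y_v), which vanishes
    -- on lines of slope N / k, vertical for k = 0.
    ψ : ℕ → ℕ → ℕ → Datum → ℤ
    ψ k u v b = (Ξ b u - Ξ b v) - + k * (Y b u - Y b v)

    private
      data Upto2 : ℕ → Set where
        is0 : Upto2 0
        is1 : Upto2 1
        is2 : Upto2 2

      upto2 : ∀ {k} → k ℕ.≤ 2 → Upto2 k
      upto2 {0} _ = is0
      upto2 {1} _ = is1
      upto2 {2} _ = is2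
      upto2 {suc (suc (suc k))} (s≤s (s≤s ()))

      split-< : ∀ l v → l ℕ.< v ⊎ v ℕ.≤ l
      split-< l v with v ℕ.≤? l
      ... | yes p = inj₂ p
      ... | no p = inj₁ (ℕₚ.≰⇒> p)

    -- Not a fan, as both centres occur with leaves of their own. The path from `b` to `c` has a
    -- break before `b` or starts the order, and has a break after `c`. These breaks see the form
    -- unless `a` lies after `b` and `d` strictly between `b` and `c`; then all coefficients beyond
    -- a position have one sign.
    kite : ∀ {a b c d} → Leaf a b → Leaf d c → Close c b → Visible (λ w → + 2 * (Y w b - Y w a) - (Y w c - Y w d))
    kite {a} {b} {c} {d} la ld k = visible-cong (λ w → Λ-form (Y w)) go
      where
      g : Points
      g = (+ 2 , b) ∷ (- (+ 2) , a) ∷ (-1ℤ , c) ∷ (1ℤ , d) ∷ []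
      Λ-form : ∀ y → Λ g y ≡ + 2 * (y b - y a) - (y c - y d)
      Λ-form y = ring (y b) (y a) (y c) (y d)
        where
        ring : ∀ b a c d → + 2 * b + (- (+ 2) * a + (-1ℤ * c + (1ℤ * d + 0ℤ))) ≡ + 2 * (b - a) - (c - d)
        ring = solve-∀
      b<c = proj₂ (proj₂ (proj₂ k))
      a<n = R-< (proj₁ la)
      d<n = R-< (proj₁ ld)
      c<n = R-< (proj₁ k)
      ob = proj₁ (proj₂ (proj₂ k))
      oc = proj₁ (proj₂ k)
      ra : rep a ≡ rep b
      ra = rep-par (leaf la)
      rc : rep c ≡ rep b
      rc = rep-par (close k)
      rd : rep d ≡ rep b
      rd = trans (rep-par (leaf ld)) rc
      differ : ∀ {x y} → Inner x → ¬ Inner y → x ≢ y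
      differ i o refl = o i
      ia = proj₁ (proj₂ la)
      id′ = proj₁ (proj₂ ld)
      eval : ∀ l {tb ta tc td} → θ l b ≡ tb → θ l a ≡ ta → θ l c ≡ tc → θ l d ≡ td → + 2 * (tb - ta) - (tc - td) ≢ 0ℤ → Λ g (θ l) ≢ 0ℤ
      eval l refl refl refl refl ne e = ne (trans (sym (Λ-form (θ l))) e)
      at-first : (a ℕ.< b ⊎ d ℕ.< b) → Visible (λ w → Λ g (Y w))
      at-first = first b refl
        where
        first : ∀ y → y ≡ b → (a ℕ.< b ⊎ d ℕ.< b) → Visible (λ w → Λ g (Y w))
        first zero refl (inj₁ ())
        first zero refl (inj₂ ())
        first (suc b′) refl left = visible-step g (ℕₚ.<-trans (ℕₚ.n<1+n b′) (ℕₚ.<-trans b<c c<n)) (close-break′ k) (value left (split-< b′ a) (split-< b′ d))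
          where
          tb = θ-< (ℕₚ.n<1+n b′)
          tc = θ-< (ℕₚ.<-trans (ℕₚ.n<1+n b′) b<c)
          value : (a ℕ.< b ⊎ d ℕ.< b) → b′ ℕ.< a ⊎ a ℕ.≤ b′ → b′ ℕ.< d ⊎ d ℕ.≤ b′ → Λ g (θ b′) ≢ 0ℤ
          value _ (inj₂ p) (inj₂ q) = eval b′ tb (θ-≥ p) tc (θ-≥ q) λ ()
          value _ (inj₂ p) (inj₁ q) = eval b′ tb (θ-≥ p) tc (θ-< q) λ ()
          value _ (inj₁ p) (inj₂ q) = eval b′ tb (θ-< p) tc (θ-≥ q) λ ()
          value (inj₁ lt) (inj₁ p) (inj₁ q) = ⊥-elim (ℕₚ.<⇒≱ lt p)
          value (inj₂ lt) (inj₁ p) (inj₁ q) = ⊥-elim (ℕₚ.<⇒≱ lt q)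
      at-last : (c ℕ.< a ⊎ c ℕ.< d) → Visible (λ w → Λ g (Y w))
      at-last right = visible-step g c<n (close-break k) (value right (split-< c a) (split-< c d))
        where
        tb = θ-≥ (ℕₚ.<⇒≤ b<c)
        tc = θ-≥ {c} ℕₚ.≤-refl
        value : (c ℕ.< a ⊎ c ℕ.< d) → c ℕ.< a ⊎ a ℕ.≤ c → c ℕ.< d ⊎ d ℕ.≤ c → Λ g (θ c) ≢ 0ℤ
        value _ (inj₁ p) (inj₁ q) = eval c tb (θ-< p) tc (θ-< q) λ ()
        value _ (inj₁ p) (inj₂ q) = eval c tb (θ-< p) tc (θ-≥ q) λ ()
        value _ (inj₂ p) (inj₁ q) = eval c tb (θ-≥ p) tc (θ-< q) λ ()
        value (inj₁ lt) (inj₂ p) (inj₂ q) = ⊥-elim (ℕₚ.<⇒≱ lt p)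
        value (inj₂ lt) (inj₂ p) (inj₂ q) = ⊥-elim (ℕₚ.<⇒≱ lt q)
      inside : b ℕ.< a → d ℕ.< c → Visible (λ w → Λ g (Y w))
      inside b<a d<c = proj₁ seen , proj₁ (proj₂ seen) , proj₁ (proj₂ (proj₂ seen))
        where
        mass : ℕ → ℕ
        mass l = 2 ℕ.* within b a l ℕ.+ within d c l
        lk = close-first-link k
        far : rep (suc b) ≢ rep b
        far = outer-step ob lk
        form : ∀ l → Λ g (θ l) ≡ -1ℤ * + mass l
        form l = trans (Λ-form (θ l)) (trans (ring₁ (θ l b) (θ l a) (θ l c) (θ l d)) (trans (cong₂ (λ x y → -1ℤ * (+ 2 * x + y)) (within-θ l (ℕₚ.<⇒≤ b<a)) (within-θ l (ℕₚ.<⇒≤ d<c)))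
          (cong (λ z → -1ℤ * (z + + within d c l)) (sym (ℤₚ.pos-* 2 (within b a l))))))
          where
          ring₁ : ∀ b a c d → + 2 * (b - a) - (c - d) ≡ -1ℤ * (+ 2 * (a - b) + (c - d))
          ring₁ = solve-∀
        twice : ∀ {w} → w ≡ 1 → 2 ℕ.* w ≢ 0
        twice refl ()
        seen = one-sided g -1ℤ mass {suc b} (λ ()) (λ l → ℕₚ.≤-trans (ℕₚ.+-mono-≤ (ℕₚ.*-monoʳ-≤ 2 (within≤1 b a l)) (within≤1 d c l)) (s≤s (s≤s (s≤s z≤n))))
          form refl (ℕₚ.<-trans b<c c<n ∷ a<n ∷ c<n ∷ d<n ∷ []) (A-< (A-sym lk))
          (≢0-+ (inj₁ (twice (within-inside (ℕₚ.n≤1+n b) (ℕₚ.≤∧≢⇒< b<a λ { refl → far ra })))))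
          ((λ e → far (sym e)) ∷ (λ e → far (trans (sym e) ra)) ∷ (λ e → far (trans (sym e) rc)) ∷ (λ e → far (trans (sym e) rd)) ∷ [])
      go : Visible (λ w → Λ g (Y w))
      go with ℕₚ.<-cmp a b | ℕₚ.<-cmp d b | ℕₚ.<-cmp d c
      ... | tri< lt _ _ | _ | _ = at-first (inj₁ lt)
      ... | tri≈ _ e _ | _ | _ = ⊥-elim (differ ia ob e)
      ... | tri> _ _ _ | tri< lt _ _ | _ = at-first (inj₂ lt)
      ... | tri> _ _ _ | tri≈ _ e _ | _ = ⊥-elim (differ id′ ob e)
      ... | tri> _ _ _ | tri> _ _ _ | tri> _ _ gt = at-last (inj₂ gt)
      ... | tri> _ _ _ | tri> _ _ _ | tri≈ _ e _ = ⊥-elim (differ id′ oc e)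
      ... | tri> _ _ b<a | tri> _ _ _ | tri< d<c _ _ = inside b<a d<c

    -- If the centre is linked, the colours are 0 and 2, both coefficients k and 2 - k are
    -- nonnegative, and the form is a fan. If not, any neighbouring gaps of z are breaks: with both
    -- leaves on one side a break sees the sum of the coefficients, a difference of distinct
    -- colours; with leaves on both sides the two breaks see one coefficient each.
    module Siblings {t t′ z} (l : Leaf t z) (l′ : Leaf t′ z) (rz : Root z) (t<t′ : t ℕ.< t′) {k} (k≤2 : k ℕ.≤ 2) where
      private
        α β : ℤ
        α = + k - + colour t
        β = + colour t′ - + k

        form : (ℕ → ℤ) → ℤ
        form y = α * (y z - y t) + β * (y z - y t′)

        o = proj₂ (proj₂ l)
        z<n = R-<′ (proj₁ l)

        t≢z : t ≢ z
        t≢z = R-irr (proj₁ l)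

        t′≢z : t′ ≢ z
        t′≢z = R-irr (proj₁ l′)

        colours = sibling-colours rz l l′ t<t′

        expand : ∀ b → form (Y b) ≡ ψ k t t′ b
        expand b = trans (ring (+ k) (+ colour t) (+ colour t′) (Y b z) (Y b t) (Y b t′))
          (cong₂ (λ x y → (x - y) - + k * (Y b t - Y b t′)) (sym (Ξ-child b (leaf l) rz)) (sym (Ξ-child b (leaf l′) rz)))
          where
          ring : ∀ k c c′ z t t′ → (k - c) * (z - t) + (c′ - k) * (z - t′) ≡ (c * (t - z) - c′ * (t′ - z)) - k * (t - t′)
          ring = solve-∀

        fan′ : ∀ {k₁ k₂} → k₁ ℕ.≤ 2 → k₂ ℕ.≤ 2 → k₁ ≢ 0 ⊎ k₂ ≢ 0 → Visible (λ b → + k₁ * (Y b z - Y b t) + + k₂ * (Y b z - Y b t′))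
        fan′ = Fan.fan o z<n (R-< (proj₁ l)) (R-< (proj₁ l′)) t≢z t′≢z (rep-par (leaf l)) (rep-par (leaf l′))

        linked-case : Linked z → Visible (λ b → form (Y b))
        linked-case ln = subst₂ (λ c c′ → Visible (λ b → (+ k - + c) * (Y b z - Y b t) + (+ c′ - + k) * (Y b z - Y b t′)))
            (sym (proj₁ (proj₂ colours ln))) (sym (proj₂ (proj₂ colours ln))) (go (upto2 k≤2))
          where
          go : ∀ {k} → Upto2 k → Visible (λ b → (+ k - 0ℤ) * (Y b z - Y b t) + (+ 2 - + k) * (Y b z - Y b t′))
          go is0 = fan′ {0} {2} z≤n ℕₚ.≤-refl (inj₂ λ ())
          go is1 = fan′ {1} {1} (s≤s z≤n) (s≤s z≤n) (inj₁ λ ())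
          go is2 = fan′ {2} {0} ℕₚ.≤-refl z≤n (inj₁ λ ())

        g : Points
        g = (α + β , z) ∷ (- α , t) ∷ (- β , t′) ∷ []

        Λ-form : ∀ y → Λ g y ≡ form y
        Λ-form y = ring α β (y z) (y t) (y t′)
          where
          ring : ∀ a b x y z → (a + b) * x + (- a * y + (- b * z + 0ℤ)) ≡ a * (x - y) + b * (x - z)
          ring = solve-∀

        spread : α + β ≢ 0ℤ
        spread e = proj₁ colours (sym (ℤₚ.+-injective (ℤₚ.i-j≡0⇒i≡j (+ colour t′) (+ colour t) (trans (ring (+ k) (+ colour t) (+ colour t′)) e))))
          where
          ring : ∀ k c c′ → c′ - c ≡ (k - c) + (c′ - k)
          ring = solve-∀

        some-nonzero : ∀ {x y} → x + y ≢ 0ℤ → x ≢ 0ℤ ⊎ y ≢ 0ℤ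
        some-nonzero {x} {y} ne with x ℤₚ.≟ 0ℤ
        ... | no x≢0 = inj₁ x≢0
        ... | yes refl = inj₂ λ { refl → ne refl }

        seen : ∀ {l} → l ℕ.< n → ¬ Lk l → ∀ {a b c r} → θ l z ≡ a → θ l t ≡ b → θ l t′ ≡ c → α * (a - b) + β * (a - c) ≡ r → r ≢ 0ℤ →
               Visible (λ b → form (Y b))
        seen {l} l<n br refl refl refl r ne = visible-cong (λ b → Λ-form (Y b)) (visible-step g l<n br λ e → ne (trans (sym r) (trans (sym (Λ-form (θ l))) e)))

        both-right : ∀ a b → a * (0ℤ - 1ℤ) + b * (0ℤ - 1ℤ) ≡ - (a + b)
        both-right = solve-∀
        both-left : ∀ a b → a * (1ℤ - 0ℤ) + b * (1ℤ - 0ℤ) ≡ a + b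
        both-left = solve-∀
        first-left : ∀ a b → a * (1ℤ - 0ℤ) + b * (1ℤ - 1ℤ) ≡ a
        first-left = solve-∀
        second-right : ∀ a b → a * (0ℤ - 0ℤ) + b * (0ℤ - 1ℤ) ≡ - b
        second-right = solve-∀

        isolated : ¬ Lk z → ∀ y → y ≡ z → (∀ {z′} → y ≡ suc z′ → ¬ Lk z′) → Visible (λ b → form (Y b))
        isolated br y refl br′ with ℕₚ.<-cmp t z | ℕₚ.<-cmp t′ z
        ... | tri≈ _ e _ | _ = ⊥-elim (t≢z e)
        ... | tri> _ _ _ | tri≈ _ e _ = ⊥-elim (t′≢z e)
        ... | tri< _ _ _ | tri≈ _ e _ = ⊥-elim (t′≢z e)
        ... | tri> _ _ gt | tri> _ _ gt′ = seen z<n br (θ-≥ {z} ℕₚ.≤-refl) (θ-< gt) (θ-< gt′) (both-right α β) (-≢0 spread)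
        ... | tri> _ _ gt | tri< lt _ _ = ⊥-elim (ℕₚ.<-asym t<t′ (ℕₚ.<-trans lt gt))
        isolated br zero refl br′ | tri< () _ _ | _
        isolated br (suc z′) refl br′ | tri< lt _ _ | tri< lt′ _ _ =
          seen (ℕₚ.<-trans (ℕₚ.n<1+n z′) z<n) (br′ refl) (θ-< (ℕₚ.n<1+n z′)) (θ-≥ (ℕₚ.≤-pred lt)) (θ-≥ (ℕₚ.≤-pred lt′)) (both-left α β) spread
        isolated br (suc z′) refl br′ | tri< lt _ _ | tri> _ _ gt′ with some-nonzero {α} {β} spread
        ... | inj₁ α≢0 = seen (ℕₚ.<-trans (ℕₚ.n<1+n z′) z<n) (br′ refl) (θ-< (ℕₚ.n<1+n z′)) (θ-≥ (ℕₚ.≤-pred lt)) (θ-< (ℕₚ.<-trans (ℕₚ.n<1+n z′) gt′)) (first-left α β) α≢0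
        ... | inj₂ β≢0 = seen z<n br (θ-≥ {z} ℕₚ.≤-refl) (θ-≥ (ℕₚ.<⇒≤ lt)) (θ-< gt′) (second-right α β) (-≢0 β≢0)

        go : Dec (Lk z) → Visible (λ b → form (Y b))
        go (yes lk) = linked-case (suc z , lk , inj₁ refl)
        go (no br) = go′ z refl
          where
          go′ : ∀ y → y ≡ z → Visible (λ b → form (Y b))
          go′ zero e = isolated br zero e (λ ())
          go′ (suc z′) e with A? z′ (suc z′)
          ... | yes lk = linked-case (z′ , subst (λ y → A y z′) e (A-sym lk) , inj₂ (sym e))
          ... | no br′ = isolated br (suc z′) e (λ e′ → subst (λ y → ¬ Lk y) (ℕₚ.suc-injective e′) br′)

      visible : Visible (ψ k t t′)
      visible = visible-cong expand (go (A? z (suc z)))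

    ψ-swap : ∀ k u v b → - ψ k u v b ≡ ψ k v u b
    ψ-swap k u v b = ring (Ξ b u) (Ξ b v) (Y b u) (Y b v) (+ k)
      where
      ring : ∀ a b c d k → - ((a - b) - k * (c - d)) ≡ (b - a) - k * (d - c)
      ring = solve-∀

    cousins-expand : ∀ {a b c d} → Leaf a b → Leaf d c → Close c b → ∀ k w → + 2 * Y w b - Y w c - + k * Y w a + (+ k - 1ℤ) * Y w d ≡ ψ k a d w
    cousins-expand {a} {b} {c} {d} la ld cl k w = trans (ring (Y w a) (Y w b) (Y w c) (Y w d) (+ k))
      (sym (cong₂ (λ x y → (x - y) - + k * (Y w a - Y w d))
        (trans (Ξ-child w (leaf la) (close-root cl)) (cong (λ e → + e * (Y w a - Y w b)) (colour-leaf-first la cl)))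
        (trans (Ξ-nephew w ld cl) (cong₂ (λ e f → + e * (Y w d - Y w c) + + f * (Y w c - Y w b)) (colour-leaf-last ld cl) (colour-close cl)))))
      where
      ring : ∀ a b c d k → + 2 * b - c - k * a + (k - 1ℤ) * d ≡ (0ℤ * (a - b) - (1ℤ * (d - c) + + 2 * (c - b))) - k * (a - d)
      ring = solve-∀

    -- For k = 0 the coefficient of `a` vanishes and for k = 1 that of `d`, leaving fans at `b`; for
    -- k = 2 all four vertices remain, in the form of `kite`.
    cousins-visible : ∀ {a b c d} → Leaf a b → Leaf d c → Close c b → ∀ {k} → k ℕ.≤ 2 → Visible (ψ k a d)
    cousins-visible {a} {b} {c} {d} la ld cl {k} k≤2 = visible-cong (cousins-expand la ld cl k) (go (upto2 k≤2))
      where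
      ob = proj₁ (proj₂ (proj₂ cl))
      b<n = R-<′ (proj₁ cl)
      c<n = R-< (proj₁ cl)
      a<n = R-< (proj₁ la)
      d<n = R-< (proj₁ ld)
      c≢b = R-irr (proj₁ cl)
      a≢b = R-irr (proj₁ la)
      d≢b : d ≢ b
      d≢b refl = ob (proj₁ (proj₂ ld))
      rc = rep-par (close cl)
      rd = trans (rep-par (leaf ld)) rc
      go : ∀ {k} → Upto2 k → Visible (λ w → + 2 * Y w b - Y w c - + k * Y w a + (+ k - 1ℤ) * Y w d)
      go is0 = visible-cong (λ w → ring (Y w a) (Y w b) (Y w c) (Y w d)) (Fan.fan {c₁ = 1} {c₂ = 1} ob b<n c<n d<n c≢b d≢b rc rd (s≤s z≤n) (s≤s z≤n) (inj₁ λ ()))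
        where
        ring : ∀ a b c d → 1ℤ * (b - c) + 1ℤ * (b - d) ≡ + 2 * b - c - 0ℤ * a + (0ℤ - 1ℤ) * d
        ring = solve-∀
      go is1 = visible-cong (λ w → ring (Y w a) (Y w b) (Y w c) (Y w d)) (Fan.fan {c₁ = 1} {c₂ = 1} ob b<n c<n a<n c≢b a≢b rc (rep-par (leaf la)) (s≤s z≤n) (s≤s z≤n) (inj₁ λ ()))
        where
        ring : ∀ a b c d → 1ℤ * (b - c) + 1ℤ * (b - a) ≡ + 2 * b - c - 1ℤ * a + (1ℤ - 1ℤ) * d
        ring = solve-∀
      go is2 = visible-cong (λ w → ring (Y w a) (Y w b) (Y w c) (Y w d)) (kite la ld cl)
        where
        ring : ∀ a b c d → + 2 * (b - a) - (c - d) ≡ + 2 * b - c - + 2 * a + (+ 2 - 1ℤ) * d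
        ring = solve-∀

    private
      uncle-visible : ∀ {a b c} → Leaf a b → Close c b → ∀ {k} → k ℕ.≤ 2 → Visible (ψ k a c)
      uncle-visible {a} {b} {c} la cl {k} k≤2 = visible-cong expand (go (upto2 k≤2))
        where
        expand : ∀ w → + k * (Y w b - Y w a) + (+ 2 - + k) * (Y w b - Y w c) ≡ ψ k a c w
        expand w = trans (ring (Y w a) (Y w b) (Y w c) (+ k)) (sym (cong₂ (λ x y → (x - y) - + k * (Y w a - Y w c))
          (trans (Ξ-child w (leaf la) (close-root cl)) (cong (λ e → + e * (Y w a - Y w b)) (colour-leaf-first la cl)))
          (trans (Ξ-child w (close cl) (close-root cl)) (cong (λ e → + e * (Y w c - Y w b)) (colour-close cl)))))
          where
          ring : ∀ a b c k → k * (b - a) + (+ 2 - k) * (b - c) ≡ (0ℤ * (a - b) - + 2 * (c - b)) - k * (a - c)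
          ring = solve-∀
        fan′ : ∀ {k₁ k₂} → k₁ ℕ.≤ 2 → k₂ ℕ.≤ 2 → k₁ ≢ 0 ⊎ k₂ ≢ 0 → Visible (λ w → + k₁ * (Y w b - Y w a) + + k₂ * (Y w b - Y w c))
        fan′ = Fan.fan (proj₁ (proj₂ (proj₂ cl))) (R-<′ (proj₁ cl)) (R-< (proj₁ la)) (R-< (proj₁ cl)) (R-irr (proj₁ la)) (R-irr (proj₁ cl)) (rep-par (leaf la)) (rep-par (close cl))
        go : ∀ {k} → Upto2 k → Visible (λ w → + k * (Y w b - Y w a) + (+ 2 - + k) * (Y w b - Y w c))
        go is0 = fan′ {0} {2} z≤n ℕₚ.≤-refl (inj₂ λ ())
        go is1 = fan′ {1} {1} (s≤s z≤n) (s≤s z≤n) (inj₁ λ ())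
        go is2 = fan′ {2} {0} ℕₚ.≤-refl z≤n (inj₁ λ ())

      grandson-visible : ∀ {b c d} → Leaf d c → Close c b → ∀ {k} → k ℕ.≤ 2 → Visible (ψ k b d)
      grandson-visible {b} {c} {d} ld cl {k} k≤2 = visible-cong expand (go (upto2 k≤2))
        where
        ob = proj₁ (proj₂ (proj₂ cl))
        oc = proj₁ (proj₂ cl)
        d≢b : d ≢ b
        d≢b refl = ob (proj₁ (proj₂ ld))
        expand : ∀ w → (+ 2 - + k) * Y w b - Y w c + (+ k - 1ℤ) * Y w d ≡ ψ k b d w
        expand w = trans (ring (Y w b) (Y w c) (Y w d) (+ k)) (sym (cong₂ (λ x y → (x - y) - + k * (Y w b - Y w d)) (Ξ-root w (close-root cl))
          (trans (Ξ-nephew w ld cl) (cong₂ (λ e f → + e * (Y w d - Y w c) + + f * (Y w c - Y w b)) (colour-leaf-last ld cl) (colour-close cl)))))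
          where
          ring : ∀ b c d k → (+ 2 - k) * b - c + (k - 1ℤ) * d ≡ (0ℤ - (1ℤ * (d - c) + + 2 * (c - b))) - k * (b - d)
          ring = solve-∀
        fan′ : ∀ {k₁ k₂} → k₁ ℕ.≤ 2 → k₂ ℕ.≤ 2 → k₁ ≢ 0 ⊎ k₂ ≢ 0 → Visible (λ w → + k₁ * (Y w b - Y w c) + + k₂ * (Y w b - Y w d))
        fan′ = Fan.fan ob (R-<′ (proj₁ cl)) (R-< (proj₁ cl)) (R-< (proj₁ ld)) (R-irr (proj₁ cl)) d≢b (rep-par (close cl)) (trans (rep-par (leaf ld)) (rep-par (close cl)))
        go : ∀ {k} → Upto2 k → Visible (λ w → (+ 2 - + k) * Y w b - Y w c + (+ k - 1ℤ) * Y w d)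
        go is0 = visible-cong (λ w → ring (Y w b) (Y w c) (Y w d)) (fan′ {1} {1} (s≤s z≤n) (s≤s z≤n) (inj₁ λ ()))
          where
          ring : ∀ b c d → 1ℤ * (b - c) + 1ℤ * (b - d) ≡ (+ 2 - 0ℤ) * b - c + (0ℤ - 1ℤ) * d
          ring = solve-∀
        go is1 = visible-cong (λ w → ring (Y w b) (Y w c) (Y w d)) (fan′ {1} {0} (s≤s z≤n) z≤n (inj₁ λ ()))
          where
          ring : ∀ b c d → 1ℤ * (b - c) + 0ℤ * (b - d) ≡ (+ 2 - 1ℤ) * b - c + (1ℤ - 1ℤ) * d
          ring = solve-∀
        go is2 = visible-cong (λ w → ring (Y w b) (Y w c) (Y w d)) (visible-neg (fan₁ oc (R-< (proj₁ cl)) (R-< (proj₁ ld)) (R-irr (proj₁ ld)) (rep-par (leaf ld))))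
          where
          ring : ∀ b c d → - (c - d) ≡ (+ 2 - + 2) * b - c + (+ 2 - 1ℤ) * d
          ring = solve-∀

      kin-visible : ∀ {u v} → u ≢ v → ¬ R u v → Kin u v → ∀ {k} → k ℕ.≤ 2 → Visible (ψ k u v)
      kin-visible u≢v ¬r (adjacent r) = ⊥-elim (¬r r)
      kin-visible {u} {v} u≢v ¬r (siblings l l′ rz) {k} k≤2 with ℕₚ.<-cmp u v
      ... | tri< lt _ _ = Siblings.visible l l′ rz lt k≤2
      ... | tri≈ _ e _ = ⊥-elim (u≢v e)
      ... | tri> _ _ gt = visible-cong (ψ-swap k v u) (visible-neg (Siblings.visible l′ l rz gt k≤2))
      kin-visible u≢v ¬r (uncle l k) = uncle-visible l k
      kin-visible u≢v ¬r (grandson l k) = grandson-visible l k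
      kin-visible u≢v ¬r (cousins l l′ k) = cousins-visible l l′ k

    same-class-visible : ∀ {u v} → u ≢ v → ¬ R u v → rep u ≡ rep v → ∀ {k} → k ℕ.≤ 2 → Visible (ψ k u v)
    same-class-visible {u} {v} u≢v ¬r e {k} k≤2 with kin u≢v e
    ... | inj₁ q = kin-visible u≢v ¬r q k≤2
    ... | inj₂ q = visible-cong (ψ-swap k v u) (visible-neg (kin-visible (λ e′ → u≢v (sym e′)) (λ r → ¬r (R-sym r)) q k≤2))

    class-visible : ∀ {u v} → u ℕ.< n → rep u ≢ rep v → Visible (λ b → X b u - X b v)
    class-visible {u} {v} u<n ne = classDatum (rep u) , class (rep-< u<n) , λ e → 1≢0 (trans (sym (cong₂ _-_ (δ-self (rep u)) (δ-other (λ e′ → ne (sym e′))))) e)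
      where
      1≢0 : 1ℤ - 0ℤ ≢ 0ℤ
      1≢0 ()

-- Pairs of vertices against the four steep slopes.

module SteepForms where
  open LinAlg
  open Arrange using (Layout)
  open Classes
  open Numbers
  open Limit
  open Visible
  open ClassForms
  open import Data.Integer using (+_; -_; _+_; _*_; _-_)
  open import Data.Integer.Tactic.RingSolver using (solve-∀)
  open import Relation.Binary.PropositionalEquality

  module SteepLineForms {n : ℕ} {A : ℕ → ℕ → Set} (L : Layout n A) (base : ℕ) (large : 10 ℕ.+ 4 ℕ.* n ℕ.≤ base) where
    open SameClassForms L base large public

    deviation : ℤ → ℕ → ℕ → (ℕ → ℤ) → (ℕ → ℤ) → ℤ
    deviation m p q x y = (y q - y p) - m * (x q - x p)

    -- The deviation of q from the line of slope m through p, at order 0 and at order 1 / N.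
    φ₀ φ₁ : ℤ → ℕ → ℕ → Datum → ℤ
    φ₀ m p q w = deviation m p q (X w) (Y w)
    φ₁ m p q w = deviation m p q (Ξ w) (H w)

    private
      rise : (ℕ → ℤ) → ℕ → ℕ → ℤ
      rise x p zero = 0ℤ
      rise x p (suc j) = rise x p j + slope (j ℕ.+ p) * (x (suc j ℕ.+ p) - x (j ℕ.+ p))

      path-rise : ∀ x s p j → (∀ l → jump l (s l) ≡ 0ℤ) → path x s (j ℕ.+ p) - path x s p ≡ rise x p j
      path-rise x s p zero flat = ℤₚ.+-inverseʳ (path x s p)
      path-rise x s p (suc j) flat = trans (cong (λ i → path x s (j ℕ.+ p) + (slope (j ℕ.+ p) * (x (suc j ℕ.+ p) - x (j ℕ.+ p)) + i) - path x s p) (flat (j ℕ.+ p)))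
        (trans (ring (path x s (j ℕ.+ p)) (slope (j ℕ.+ p) * (x (suc j ℕ.+ p) - x (j ℕ.+ p))) (path x s p)) (cong (_+ slope (j ℕ.+ p) * (x (suc j ℕ.+ p) - x (j ℕ.+ p))) (path-rise x s p j flat)))
        where
        ring : ∀ a b c → a + (b + 0ℤ) - c ≡ (a - c) + b
        ring = solve-∀

      φ₀-rise : ∀ m p j k → φ₀ m p (j ℕ.+ p) (classDatum k) ≡ rise (X (classDatum k)) p j - m * (X (classDatum k) (j ℕ.+ p) - X (classDatum k) p)
      φ₀-rise m p j k = cong (_- m * (X (classDatum k) (j ℕ.+ p) - X (classDatum k) p)) (path-rise (X (classDatum k)) (λ _ → 0ℤ) p j jump-0)

      φ₁-rise : ∀ m p j w → φ₁ m p (j ℕ.+ p) w ≡ rise (Ξ w) p j - m * (Ξ w (j ℕ.+ p) - Ξ w p)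
      φ₁-rise m p j w = cong (_- m * (Ξ w (j ℕ.+ p) - Ξ w p)) (path-rise (Ξ w) (λ _ → 0ℤ) p j jump-0)

    -- The case k = 0 of the form of the cousins at its ends: a collapsed link still has nonzero
    -- width at order 1 / N.
    collapsed-visible : ∀ {i} → Lk i → rep i ≡ rep (suc i) → Visible (λ w → Ξ w (suc i) - Ξ w i)
    collapsed-visible {i} lk e with collapsed lk e
    ... | inj₁ (_ , _ , a , d , k) = visible-cong (λ w → ring (Ξ w i) (Ξ w (suc i)) (Y w i - Y w (suc i))) (visible-neg (cousins-visible a d k z≤n))
      where
      ring : ∀ x y z → - ((x - y) - 0ℤ * z) ≡ y - x
      ring = solve-∀
    ... | inj₂ (_ , _ , a , d , k) = visible-cong (λ w → ring (Ξ w i) (Ξ w (suc i)) (Y w (suc i) - Y w i)) (cousins-visible a d k z≤n)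
      where
      ring : ∀ x y z → (y - x) - 0ℤ * z ≡ y - x
      ring = solve-∀

    private
      Out : ℕ → ℕ → ℕ → Set
      Out b c d = d ℕ.< b ⊎ c ℕ.< d

      out? : ∀ b c d → Out b c d ⊎ (b ℕ.≤ d × d ℕ.≤ c)
      out? b c d with d <? b | c <? d
      ... | yes p | _ = inj₁ (inj₁ p)
      ... | no _ | yes p = inj₁ (inj₂ p)
      ... | no p | no q = inj₂ (ℕₚ.≮⇒≥ p , ℕₚ.≮⇒≥ q)

      within-block : ∀ {c b b′ c′} → Close c b → Close c′ b′ → b ℕ.< b′ → b′ ℕ.≤ c → ⊥
      within-block {b′ = zero} k k′ ()
      within-block {b′ = suc y} k k′ b<b′ b′≤c = close-break′ k′ (close-links k y (ℕₚ.≤-pred b<b′) b′≤c)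

      Together : ℕ → ℕ → Set
      Together d d′ = ∀ {l} → ¬ Lk l → (l ℕ.< d → l ℕ.< d′) × (l ℕ.< d′ → l ℕ.< d)

      -- A break next to the path from b to c, which does not contain d, separates the two kites.
      separate : ∀ α β {b c d b′ c′ d′} → α ≢ 0ℤ → β ≢ 0ℤ → Close c b → Close c′ b′ → b ≢ b′ → Together d d′ → Out b c d →
                 Visible (λ w → α * (+ 2 * Y w b - Y w c - Y w d) + β * (+ 2 * Y w b′ - Y w c′ - Y w d′))
      separate α β {b} {c} {d} {b′} {c′} {d′} α≢0 β≢0 k k′ b≢b′ near out = visible-cong (λ w → Λ-form (Y w)) (go out (c <? b′))
        where
        form : (ℕ → ℤ) → ℤ
        form y = α * (+ 2 * y b - y c - y d) + β * (+ 2 * y b′ - y c′ - y d′)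
        g : Points
        g = (α * + 2 , b) ∷ (- α , c) ∷ (- α , d) ∷ (β * + 2 , b′) ∷ (- β , c′) ∷ (- β , d′) ∷ []
        Λ-form : ∀ y → Λ g y ≡ form y
        Λ-form y = ring α β (y b) (y c) (y d) (y b′) (y c′) (y d′)
          where
          ring : ∀ α β b c d b′ c′ d′ → α * + 2 * b + (- α * c + (- α * d + (β * + 2 * b′ + (- β * c′ + (- β * d′ + 0ℤ))))) ≡ α * (+ 2 * b - c - d) + β * (+ 2 * b′ - c′ - d′)
          ring = solve-∀
        b<c = proj₂ (proj₂ (proj₂ k))
        b′<c′ = proj₂ (proj₂ (proj₂ k′))
        c<n = R-< (proj₁ k)
        seen : ∀ {l} → l ℕ.< n → ¬ Lk l → ∀ {tb tc td ub uc ud r} → θ l b ≡ tb → θ l c ≡ tc → θ l d ≡ td → θ l b′ ≡ ub → θ l c′ ≡ uc → θ l d′ ≡ ud →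
               α * (+ 2 * tb - tc - td) + β * (+ 2 * ub - uc - ud) ≡ r → r ≢ 0ℤ → Visible (λ w → Λ g (Y w))
        seen {l} l<n br refl refl refl refl refl refl r ne = visible-step g l<n br (λ e → ne (trans (sym r) (trans (sym (Λ-form (θ l))) e)))
        left-of : b′ ℕ.≤ c → b′ ℕ.< b
        left-of b′≤c with ℕₚ.<-cmp b′ b
        ... | tri< lt _ _ = lt
        ... | tri≈ _ e _ = ⊥-elim (b≢b′ (sym e))
        ... | tri> _ _ gt = ⊥-elim (within-block k k′ gt b′≤c)
        not-across : ∀ {l} → ¬ Lk l → b′ ℕ.≤ l → c′ ℕ.≤ l
        not-across {l} br b′≤l with c′ ℕ.≤? l
        ... | yes p = p
        ... | no p = ⊥-elim (br (close-links k′ l b′≤l (ℕₚ.≰⇒> p)))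
        far-d′ : ∀ {l} → ¬ Lk l → d ℕ.≤ l → d′ ℕ.≤ l
        far-d′ br d≤l = ℕₚ.≮⇒≥ λ lt → ℕₚ.<⇒≱ (proj₂ (near br) lt) d≤l
        before : ∀ y → y ≡ b → b′ ℕ.≤ c → d ℕ.< b ⊎ c ℕ.< d → Visible (λ w → Λ g (Y w))
        before zero refl b′≤c _ = ⊥-elim (ℕₚ.n≮0 (left-of b′≤c))
        before (suc y) refl b′≤c side = at side
          where
          br = close-break′ k
          y<n = ℕₚ.<-trans (ℕₚ.n<1+n y) (ℕₚ.<-trans b<c c<n)
          b′≤y = ℕₚ.≤-pred (left-of b′≤c)
          at : d ℕ.< suc y ⊎ c ℕ.< d → Visible (λ w → Λ g (Y w))
          at (inj₁ d<b) = seen y<n br (θ-< (ℕₚ.n<1+n y)) (θ-< (ℕₚ.<-trans (ℕₚ.n<1+n y) b<c)) (θ-≥ (ℕₚ.≤-pred d<b)) (θ-≥ b′≤y) (θ-≥ (not-across br b′≤y)) (θ-≥ (far-d′ br (ℕₚ.≤-pred d<b)))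
              (ring α β) α≢0
            where
            ring : ∀ α β → α * (+ 2 * 1ℤ - 1ℤ - 0ℤ) + β * (+ 2 * 0ℤ - 0ℤ - 0ℤ) ≡ α
            ring = solve-∀
          at (inj₂ c<d) = seen y<n br (θ-< (ℕₚ.n<1+n y)) (θ-< (ℕₚ.<-trans (ℕₚ.n<1+n y) b<c)) (θ-< y<d) (θ-≥ b′≤y) (θ-≥ (not-across br b′≤y)) (θ-< (proj₁ (near br) y<d))
              (ring α β) (-≢0 β≢0)
            where
            y<d = ℕₚ.<-trans (ℕₚ.n<1+n y) (ℕₚ.<-trans b<c c<d)
            ring : ∀ α β → α * (+ 2 * 1ℤ - 1ℤ - 1ℤ) + β * (+ 2 * 0ℤ - 0ℤ - 1ℤ) ≡ - β
            ring = solve-∀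
        go : Out b c d → Dec (c ℕ.< b′) → Visible (λ w → Λ g (Y w))
        go side (no ¬c<b′) = before b refl (ℕₚ.≮⇒≥ ¬c<b′) side
        go (inj₂ c<d) (yes c<b′) = seen c<n (close-break k) (θ-≥ (ℕₚ.<⇒≤ b<c)) (θ-≥ {c} ℕₚ.≤-refl) (θ-< c<d) (θ-< c<b′) (θ-< (ℕₚ.<-trans c<b′ b′<c′)) (θ-< (proj₁ (near (close-break k)) c<d))
            (ring α β) (-≢0 α≢0)
          where
          ring : ∀ α β → α * (+ 2 * 0ℤ - 0ℤ - 1ℤ) + β * (+ 2 * 1ℤ - 1ℤ - 1ℤ) ≡ - α
          ring = solve-∀
        go (inj₁ d<b) (yes c<b′) = seen c<n (close-break k) (θ-≥ (ℕₚ.<⇒≤ b<c)) (θ-≥ {c} ℕₚ.≤-refl) (θ-≥ d≤c) (θ-< c<b′) (θ-< (ℕₚ.<-trans c<b′ b′<c′)) (θ-≥ (far-d′ (close-break k) d≤c))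
            (ring α β) β≢0
          where
          d≤c = ℕₚ.<⇒≤ (ℕₚ.<-trans d<b b<c)
          ring : ∀ α β → α * (+ 2 * 0ℤ - 0ℤ - 0ℤ) + β * (+ 2 * 1ℤ - 1ℤ - 0ℤ) ≡ β
          ring = solve-∀

      -- If each of d, d′ lay on the path spanned by its own close edge, then, no break separating d
      -- from d′, the two paths would be one and b = b′. So one of them lies outside, and `separate`
      -- applies.
      two-kites : ∀ α β {b c d b′ c′ d′} → α ≢ 0ℤ → β ≢ 0ℤ → Close c b → Close c′ b′ → b ≢ b′ → Inner d → Inner d′ → Together d d′ →
                  Visible (λ w → α * (+ 2 * Y w b - Y w c - Y w d) + β * (+ 2 * Y w b′ - Y w c′ - Y w d′))
      two-kites α β {b} {c} {d} {b′} {c′} {d′} α≢0 β≢0 k k′ b≢b′ i i′ near with out? b c d | out? b′ c′ d′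
      ... | inj₁ o | _ = separate α β α≢0 β≢0 k k′ b≢b′ near o
      ... | inj₂ _ | inj₁ o = visible-cong (λ w → ℤₚ.+-comm (β * _) (α * _)) (separate β α β≢0 α≢0 k′ k (λ e → b≢b′ (sym e)) (λ br → proj₂ (near br) , proj₁ (near br)) o)
      ... | inj₂ (b≤d , d≤c) | inj₂ (b′≤d′ , d′≤c′) with ℕₚ.<-cmp b b′
      ...   | tri≈ _ e _ = ⊥-elim (b≢b′ e)
      ...   | tri< lt _ _ = ⊥-elim (within-block k k′ lt (reach (ℕₚ.≤∧≢⇒< b′≤d′ λ { refl → proj₁ (proj₂ (proj₂ k′)) i′ })))
        where
        reach : b′ ℕ.< d′ → b′ ℕ.≤ c
        reach _ = ℕₚ.≮⇒≥ λ c<b′ → ℕₚ.<⇒≱ (proj₂ (near (close-break k)) (ℕₚ.<-≤-trans c<b′ b′≤d′)) d≤c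
      ...   | tri> _ _ gt = ⊥-elim (within-block k′ k gt (ℕₚ.≮⇒≥ λ c′<b → ℕₚ.<⇒≱ (proj₁ (near (close-break k′)) (ℕₚ.<-≤-trans c′<b b≤d)) d′≤c′))

      -- The first-order width of a collapsed link in explicit form. The end `d` of the link is the
      -- one attached to the later centre `c`; `ε` is a sign telling which end that is.
      kite-of : ∀ {i} → Lk i → rep i ≡ rep (suc i) →
                ∃₂ λ ε d → ∃₂ λ b c → ε ≢ 0ℤ × Close c b × Inner d × (d ≡ i ⊎ d ≡ suc i) × rep i ≡ b ×
                  (∀ w → Ξ w (suc i) - Ξ w i ≡ ε * (+ 2 * Y w b - Y w c - Y w d))
      kite-of {i} lk e with collapsed lk e
      ... | inj₁ (c , b , a , d , k) = -1ℤ , suc i , b , c , (λ ()) , k , proj₁ (proj₂ d) , inj₂ refl , rep-child (leaf a) (close-root k) ,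
          λ w → trans (ring₁ (Ξ w i) (Ξ w (suc i)) (Y w i - Y w (suc i))) (trans (cong -_ (sym (cousins-expand a d k 0 w))) (ring₂ (Y w i) (Y w b) (Y w c) (Y w (suc i))))
        where
        ring₁ : ∀ x y z → y - x ≡ - ((x - y) - 0ℤ * z)
        ring₁ = solve-∀
        ring₂ : ∀ a b c d → - (+ 2 * b - c - 0ℤ * a + (0ℤ - 1ℤ) * d) ≡ -1ℤ * (+ 2 * b - c - d)
        ring₂ = solve-∀
      ... | inj₂ (c , b , a , d , k) = 1ℤ , i , b , c , (λ ()) , k , proj₁ (proj₂ d) , inj₁ refl , trans e (rep-child (leaf a) (close-root k)) ,
          λ w → trans (ring₁ (Ξ w i) (Ξ w (suc i)) (Y w (suc i) - Y w i)) (trans (sym (cousins-expand a d k 0 w)) (ring₂ (Y w (suc i)) (Y w b) (Y w c) (Y w i)))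
        where
        ring₁ : ∀ x y z → y - x ≡ (y - x) - 0ℤ * z
        ring₁ = solve-∀
        ring₂ : ∀ a b c d → + 2 * b - c - 0ℤ * a + (0ℤ - 1ℤ) * d ≡ 1ℤ * (+ 2 * b - c - d)
        ring₂ = solve-∀

    private
      -- A segment of links all of whose vertices lie in the classes of its ends. It is encoded as a
      -- binary word, with 1 for the class of the first vertex, and tested on the datum that gives
      -- abscissa 1 to that class.
      module Chain (p j : ℕ) (q<n : j ℕ.+ p ℕ.< n) (links : ∀ i → i ℕ.< j → Lk (i ℕ.+ p)) (2≤j : 2 ℕ.≤ j)
                   (tag : ∀ i → 0 ℕ.< i → i ℕ.< j → rep (i ℕ.+ p) ≡ rep p ⊎ rep (i ℕ.+ p) ≡ rep (j ℕ.+ p)) where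

        p<n : p ℕ.< n
        p<n = ℕₚ.≤-<-trans (ℕₚ.m≤n+m p j) q<n

        triple : ∀ i → suc (suc i) ℕ.≤ j → ∀ {κ} → rep (i ℕ.+ p) ≡ κ → rep (suc i ℕ.+ p) ≡ κ → rep (suc (suc i) ℕ.+ p) ≡ κ → ⊥
        triple i le e e′ e″ = no-triple (links i (ℕₚ.<-trans (ℕₚ.n<1+n i) le)) (links (suc i) le) (trans e (sym e′)) (trans e′ (sym e″))

        apart : rep p ≢ rep (j ℕ.+ p)
        apart e = triple 0 2≤j refl (same 1 (s≤s z≤n) 2≤j) (last (ℕₚ.m≤n⇒m<n∨m≡n 2≤j))
          where
          same : ∀ i → 0 ℕ.< i → i ℕ.< j → rep (i ℕ.+ p) ≡ rep p
          same i 0<i i<j = [ (λ z → z) , (λ z → trans z (sym e)) ]′ (tag i 0<i i<j)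
          last : 2 ℕ.< j ⊎ 2 ≡ j → rep (2 ℕ.+ p) ≡ rep p
          last (inj₁ lt) = same 2 (s≤s z≤n) lt
          last (inj₂ refl) = sym e

        w : Datum
        w = classDatum (rep p)

        inner-at : ∀ i → 0 ℕ.< i → i ℕ.< j → Inner (i ℕ.+ p)
        inner-at (suc i) _ lt = links i (ℕₚ.<-trans (ℕₚ.n<1+n i) lt) , links (suc i) lt

        linked-first : Linked p
        linked-first = suc p , links 0 (ℕₚ.<-trans (s≤s z≤n) 2≤j) , inj₁ refl

        linked-last : Linked (j ℕ.+ p)
        linked-last = go j refl
          where
          go : ∀ y → y ≡ j → Linked (j ℕ.+ p)
          go zero refl = ⊥-elim (ℕₚ.n≮0 2≤j)
          go (suc y) refl = y ℕ.+ p , A-sym (links y (ℕₚ.n<1+n y)) , inj₂ refl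

        offset : ∀ {i i′} → i ≢ i′ → i ℕ.+ p ≢ i′ ℕ.+ p
        offset ne e = ne (ℕₚ.+-cancelʳ-≡ p _ _ e)

        letter : Fin 2 → ℕ
        letter 0F = rep (j ℕ.+ p)
        letter 1F = rep p

        Spells : (ℕ → Fin 2) → Set
        Spells x = ∀ i → i ℕ.≤ j → rep (i ℕ.+ p) ≡ letter (x i)

        Letter : ℕ → Set
        Letter i = ∃ λ b → rep (i ℕ.+ p) ≡ letter b

        letter-at : ∀ i → 0 ℕ.< i → i ℕ.< j → Letter i
        letter-at i 0<i i<j = [ (1F ,_) , (0F ,_) ]′ (tag i 0<i i<j)

        no-stutter : ∀ {x} → Spells x → ¬ Stutter x j
        no-stutter sp (i , i<j , le , e , e′) =
          triple i le (sp i (ℕₚ.<⇒≤ i<j)) (trans (sp (suc i) i<j) (cong letter (sym e))) (trans (sp (2 ℕ.+ i) le) (cong letter (sym (trans e e′))))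

        few : ∀ b {i k l} → 0 ℕ.< i → i ℕ.< k → k ℕ.< l → l ℕ.< j →
              rep (i ℕ.+ p) ≡ letter b → rep (k ℕ.+ p) ≡ letter b → rep (l ℕ.+ p) ≡ letter b → ⊥
        few b {i} {k} {l} 0<i i<k k<l l<j = go b
          where
          k<j = ℕₚ.<-trans k<l l<j
          i<j = ℕₚ.<-trans i<k k<j
          0<k = ℕₚ.<-trans 0<i i<k
          0<l = ℕₚ.<-trans 0<k k<l
          at : ∀ {o} → Linked (o ℕ.+ p) → o ≢ i → o ≢ k → o ≢ l → rep (i ℕ.+ p) ≡ rep (o ℕ.+ p) → rep (k ℕ.+ p) ≡ rep (o ℕ.+ p) → rep (l ℕ.+ p) ≡ rep (o ℕ.+ p) → ⊥
          at ln oi ok ol ei ek el = class-small ln (inner-at i 0<i i<j) (inner-at k 0<k k<j) (inner-at l 0<l l<j) ei ek el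
            (offset (ℕₚ.<⇒≢ i<k)) (offset (ℕₚ.<⇒≢ (ℕₚ.<-trans i<k k<l))) (offset (ℕₚ.<⇒≢ k<l)) (offset oi) (offset ok) (offset ol)
          go : ∀ b → rep (i ℕ.+ p) ≡ letter b → rep (k ℕ.+ p) ≡ letter b → rep (l ℕ.+ p) ≡ letter b → ⊥
          go 0F = at linked-last (ℕₚ.>⇒≢ i<j) (ℕₚ.>⇒≢ k<j) (ℕₚ.>⇒≢ l<j)
          go 1F = at linked-first (ℕₚ.<⇒≢ 0<i) (ℕₚ.<⇒≢ 0<k) (ℕₚ.<⇒≢ 0<l)

        X-letter : ∀ i b → rep i ≡ letter b → X w i ≡ bit b
        X-letter i 0F e = δ-other (λ e′ → apart (trans (sym e′) e))
        X-letter i 1F e = trans (cong (δ (rep p)) e) (δ-self (rep p))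

        rise-turns : ∀ {x} k → (∀ i → i ℕ.≤ k → X w (i ℕ.+ p) ≡ bit (x i)) → rise (X w) p k ≡ weigh σ (turns (λ i → residue (i ℕ.+ p)) x k)
        rise-turns zero _ = refl
        rise-turns {x} (suc k) X≡ = trans (cong₂ (λ u v → rise (X w) p k + slope (k ℕ.+ p) * (u - v)) (X≡ (suc k) ℕₚ.≤-refl) (X≡ k (ℕₚ.n≤1+n k)))
          (trans (ring (rise (X w) p k) (slope (k ℕ.+ p)) (bit (x (suc k)) - bit (x k)))
            (cong (_+_ ((bit (x (suc k)) - bit (x k)) * slope (k ℕ.+ p))) (rise-turns k (λ i le → X≡ i (ℕₚ.≤-trans le (ℕₚ.n≤1+n k))))))
          where
          ring : ∀ a b c → a + b * c ≡ c * b + a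
          ring = solve-∀

        word-visible : ∀ x r → Spells x → Independent ((1ℤ , r) ∷ turns (λ i → residue (i ℕ.+ p)) x j) → Visible (φ₀ (σ r) p (j ℕ.+ p))
        word-visible x r sp ind = w , class (rep-< p<n) , λ z → independent-nonzero ((1ℤ , r) ∷ T) ind (trans (trans (ring (σ r) (weigh σ T))
            (trans (cong₂ (λ a b → weigh σ T - σ r * (a - b)) (sym (X-letter (j ℕ.+ p) 0F refl)) (sym (X-letter p 1F refl)))
              (cong (_- σ r * (X w (j ℕ.+ p) - X w p)) (sym (rise-turns j λ i le → X-letter (i ℕ.+ p) (x i) (sp i le)))))) (trans (sym (φ₀-rise (σ r) p j (rep p))) z))
          where
          T = turns (λ i → residue (i ℕ.+ p)) x j
          ring : ∀ m a → 1ℤ * m + a ≡ a - m * (0ℤ - 1ℤ)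
          ring = solve-∀

      module Words2 (p : ℕ) (q<n : 2 ℕ.+ p ℕ.< n) (links : ∀ i → i ℕ.< 2 → Lk (i ℕ.+ p)) (tag : ∀ i → 0 ℕ.< i → i ℕ.< 2 → rep (i ℕ.+ p) ≡ rep p ⊎ rep (i ℕ.+ p) ≡ rep (2 ℕ.+ p)) where
        open Chain p 2 q<n links (s≤s (s≤s z≤n)) tag

        -- One of the two links collapses and the chord has the slope of the other one, so at order
        -- 1 / N only the width of the collapsed link remains, times a difference of two slopes.
        collapsed-end : ∀ r b → rep (1 ℕ.+ p) ≡ letter b → r ≡ cycle (residue p) (toℕ b) → Visible (φ₁ (σ r) p (2 ℕ.+ p))
        collapsed-end _ 1F e refl = visible-cong (λ w → trans (ring (slope p) (slope (suc p)) (Ξ w p) (Ξ w (1 ℕ.+ p)) (Ξ w (2 ℕ.+ p))) (sym (φ₁-rise (slope (suc p)) p 2 w)))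
            (visible-scale (slope p - slope (suc p)) (σ-injective (residue p) (next (residue p)) (λ z → next≢ (residue p) (sym z))) (collapsed-visible (links 0 (s≤s z≤n)) (sym e)))
          where
          ring : ∀ s0 s1 x0 x1 x2 → (s0 - s1) * (x1 - x0) ≡ ((0ℤ + s0 * (x1 - x0)) + s1 * (x2 - x1)) - s1 * (x2 - x0)
          ring = solve-∀
        collapsed-end _ 0F e refl = visible-cong (λ w → trans (ring (slope p) (slope (suc p)) (Ξ w p) (Ξ w (1 ℕ.+ p)) (Ξ w (2 ℕ.+ p))) (sym (φ₁-rise (slope p) p 2 w)))
            (visible-scale (slope (suc p) - slope p) (σ-injective (next (residue p)) (residue p) (next≢ (residue p))) (collapsed-visible (links 1 (s≤s (s≤s z≤n))) e))
          where
          ring : ∀ s0 s1 x0 x1 x2 → (s1 - s0) * (x2 - x1) ≡ ((0ℤ + s0 * (x1 - x0)) + s1 * (x2 - x1)) - s0 * (x2 - x0)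
          ring = solve-∀

        visible : ∀ r → Visible (φ₀ (σ r) p (2 ℕ.+ p)) ⊎ Visible (φ₁ (σ r) p (2 ℕ.+ p))
        visible r = go (letter-at 1 (s≤s z≤n) (s≤s (s≤s z≤n)))
          where
          go : Letter 1 → Visible (φ₀ (σ r) p (2 ℕ.+ p)) ⊎ Visible (φ₁ (σ r) p (2 ℕ.+ p))
          go (b , e) = [ (λ z → inj₂ (collapsed-end r b e z)) , (λ ind → inj₁ (word-visible (spell (1F ∷ b ∷ [])) r spelt ind)) ]′ (word₂ (residue p) r b)
            where
            spelt : Spells (spell (1F ∷ b ∷ []))
            spelt 0 _ = refl
            spelt 1 _ = e
            spelt 2 _ = refl
            spelt (suc (suc (suc _))) (s≤s (s≤s ()))

      module Words3 (p : ℕ) (q<n : 3 ℕ.+ p ℕ.< n) (links : ∀ i → i ℕ.< 3 → Lk (i ℕ.+ p)) (tag : ∀ i → 0 ℕ.< i → i ℕ.< 3 → rep (i ℕ.+ p) ≡ rep p ⊎ rep (i ℕ.+ p) ≡ rep (3 ℕ.+ p)) where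
        open Chain p 3 q<n links (s≤s (s≤s z≤n)) tag

        -- Both end links collapse and the chord has the slope of the middle one. The first-order
        -- form combines the widths of the two collapsed links; they belong to different double
        -- stars but lie on one path, so `two-kites` applies.
        collapsed-ends : rep (1 ℕ.+ p) ≡ rep p → rep (2 ℕ.+ p) ≡ rep (3 ℕ.+ p) → Visible (φ₁ (slope (suc p)) p (3 ℕ.+ p))
        collapsed-ends e1 e2 with kite-of (links 0 (s≤s z≤n)) (sym e1) | kite-of (links 2 (s≤s (s≤s (s≤s z≤n)))) e2
        ... | ε , d , b , c , ε≢0 , k , i , place , rb , Ξ≡ | ε′ , d′ , b′ , c′ , ε′≢0 , k′ , i′ , place′ , rb′ , Ξ′≡ =
            visible-cong (λ w → trans (cong₂ _+_ (ℤₚ.*-assoc (s0 - s1) ε _) (ℤₚ.*-assoc (s2 - s1) ε′ _)) (trans (cong₂ (λ x y → (s0 - s1) * x + (s2 - s1) * y) (sym (Ξ≡ w)) (sym (Ξ′≡ w)))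
                (trans (ring s0 s1 s2 (Ξ w p) (Ξ w (1 ℕ.+ p)) (Ξ w (2 ℕ.+ p)) (Ξ w (3 ℕ.+ p))) (sym (φ₁-rise s1 p 3 w)))))
              (two-kites ((s0 - s1) * ε) ((s2 - s1) * ε′) (*≢0 (σ-injective (residue p) (next (residue p)) (λ z → next≢ (residue p) (sym z))) ε≢0)
                (*≢0 (σ-injective (next (next (residue p))) (next (residue p)) (next≢ (next (residue p)))) ε′≢0) k k′
                (λ b≡b′ → apart (trans rb (trans b≡b′ (trans (sym rb′) e2)))) i i′ together)
          where
          s0 = slope p
          s1 = slope (suc p)
          s2 = slope (2 ℕ.+ p)
          ring : ∀ s0 s1 s2 x0 x1 x2 x3 → (s0 - s1) * (x1 - x0) + (s2 - s1) * (x3 - x2) ≡ (((0ℤ + s0 * (x1 - x0)) + s1 * (x2 - x1)) + s2 * (x3 - x2)) - s1 * (x3 - x0)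
          ring = solve-∀
          bounds : ∀ {i x} → i ℕ.≤ 2 → x ≡ i ℕ.+ p ⊎ x ≡ suc i ℕ.+ p → p ℕ.≤ x × x ℕ.≤ 3 ℕ.+ p
          bounds {i} le (inj₁ refl) = ℕₚ.m≤n+m p i , ℕₚ.+-monoˡ-≤ p (ℕₚ.m≤n⇒m≤1+n le)
          bounds {i} le (inj₂ refl) = ℕₚ.m≤n+m p (suc i) , ℕₚ.+-monoˡ-≤ p (s≤s le)
          chain : ∀ {l x y} → ¬ Lk l → p ℕ.≤ y → x ℕ.≤ 3 ℕ.+ p → l ℕ.< x → l ℕ.< y
          chain {l} {x} {y} br p≤y x≤ l<x = ℕₚ.≰⇒> λ y≤l → br (subst Lk (ℕₚ.m∸n+n≡m (ℕₚ.≤-trans p≤y y≤l))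
            (links (l ℕ.∸ p) (ℕₚ.+-cancelʳ-< p (l ℕ.∸ p) 3 (subst (ℕ._< 3 ℕ.+ p) (sym (ℕₚ.m∸n+n≡m (ℕₚ.≤-trans p≤y y≤l))) (ℕₚ.<-≤-trans l<x x≤)))))
          dp = bounds {0} z≤n place
          dp′ = bounds {2} ℕₚ.≤-refl place′
          together : Together d d′
          together br = chain br (proj₁ dp′) (proj₂ dp) , chain br (proj₁ dp) (proj₂ dp′)

        visible : ∀ r → Visible (φ₀ (σ r) p (3 ℕ.+ p)) ⊎ Visible (φ₁ (σ r) p (3 ℕ.+ p))
        visible r = go (letter-at 1 (s≤s z≤n) (s≤s (s≤s z≤n))) (letter-at 2 (s≤s z≤n) ℕₚ.≤-refl)
          where
          special : ∀ b c → rep (1 ℕ.+ p) ≡ letter b → rep (2 ℕ.+ p) ≡ letter c → b ≡ 1F × c ≡ 0F × r ≡ next (residue p) → Visible (φ₁ (σ r) p (3 ℕ.+ p))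
          special _ _ e1 e2 (refl , refl , refl) = collapsed-ends e1 e2
          go : Letter 1 → Letter 2 → Visible (φ₀ (σ r) p (3 ℕ.+ p)) ⊎ Visible (φ₁ (σ r) p (3 ℕ.+ p))
          go (b , e1) (c , e2) = [ (λ st → ⊥-elim (no-stutter {spell (1F ∷ b ∷ c ∷ [])} spelt st)) , [ (λ z → inj₂ (special b c e1 e2 z)) , (λ ind → inj₁ (word-visible (spell (1F ∷ b ∷ c ∷ [])) r spelt ind)) ]′ ]′ (word₃ (residue p) r b c)
            where
            spelt : Spells (spell (1F ∷ b ∷ c ∷ []))
            spelt 0 _ = refl
            spelt 1 _ = e1
            spelt 2 _ = e2
            spelt 3 _ = refl
            spelt (suc (suc (suc (suc _)))) (s≤s (s≤s (s≤s ())))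

      module Words4 (p : ℕ) (q<n : 4 ℕ.+ p ℕ.< n) (links : ∀ i → i ℕ.< 4 → Lk (i ℕ.+ p)) (tag : ∀ i → 0 ℕ.< i → i ℕ.< 4 → rep (i ℕ.+ p) ≡ rep p ⊎ rep (i ℕ.+ p) ≡ rep (4 ℕ.+ p)) where
        open Chain p 4 q<n links (s≤s (s≤s z≤n)) tag

        visible : ∀ r → Visible (φ₀ (σ r) p (4 ℕ.+ p))
        visible r = go (letter-at 1 (s≤s z≤n) (s≤s (s≤s z≤n))) (letter-at 2 (s≤s z≤n) (ℕₚ.n≤1+n 3)) (letter-at 3 (s≤s z≤n) ℕₚ.≤-refl)
          where
          go : Letter 1 → Letter 2 → Letter 3 → Visible (φ₀ (σ r) p (4 ℕ.+ p))
          go (b , e1) (c , e2) (d , e3) = [ (λ st → ⊥-elim (no-stutter {spell (1F ∷ b ∷ c ∷ d ∷ [])} spelt st)) , word-visible (spell (1F ∷ b ∷ c ∷ d ∷ [])) r spelt ]′ (word₄ (residue p) r b c d)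
            where
            spelt : Spells (spell (1F ∷ b ∷ c ∷ d ∷ []))
            spelt 0 _ = refl
            spelt 1 _ = e1
            spelt 2 _ = e2
            spelt 3 _ = e3
            spelt 4 _ = refl
            spelt (suc (suc (suc (suc (suc _))))) (s≤s (s≤s (s≤s (s≤s ()))))

      module Words5 (p : ℕ) (q<n : 5 ℕ.+ p ℕ.< n) (links : ∀ i → i ℕ.< 5 → Lk (i ℕ.+ p)) (tag : ∀ i → 0 ℕ.< i → i ℕ.< 5 → rep (i ℕ.+ p) ≡ rep p ⊎ rep (i ℕ.+ p) ≡ rep (5 ℕ.+ p)) where
        open Chain p 5 q<n links (s≤s (s≤s z≤n)) tag

        visible : ∀ r → Visible (φ₀ (σ r) p (5 ℕ.+ p))
        visible r = go (letter-at 1 (s≤s z≤n) (s≤s (s≤s z≤n))) (letter-at 2 (s≤s z≤n) (s≤s (s≤s (s≤s z≤n)))) (letter-at 3 (s≤s z≤n) (ℕₚ.n≤1+n 4)) (letter-at 4 (s≤s z≤n) ℕₚ.≤-refl)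
          where
          go : Letter 1 → Letter 2 → Letter 3 → Letter 4 → Visible (φ₀ (σ r) p (5 ℕ.+ p))
          go (b , e1) (c , e2) (d , e3) (f , e4) = [ (λ st → ⊥-elim (no-stutter {spell (1F ∷ b ∷ c ∷ d ∷ f ∷ [])} spelt st)) , word-visible (spell (1F ∷ b ∷ c ∷ d ∷ f ∷ [])) r spelt ]′ (word₅ (residue p) r b c d f)
            where
            spelt : Spells (spell (1F ∷ b ∷ c ∷ d ∷ f ∷ []))
            spelt 0 _ = refl
            spelt 1 _ = e1
            spelt 2 _ = e2
            spelt 3 _ = e3
            spelt 4 _ = e4
            spelt 5 _ = refl
            spelt (suc (suc (suc (suc (suc (suc _)))))) (s≤s (s≤s (s≤s (s≤s (s≤s ())))))

      -- Three of the first five interior vertices share a class with an end of the segment, and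
      -- that end is linked: one vertex too many for `class-small`.
      module Long (p j : ℕ) (q<n : j ℕ.+ p ℕ.< n) (links : ∀ i → i ℕ.< j → Lk (i ℕ.+ p)) (6≤j : 6 ℕ.≤ j)
                  (tag : ∀ i → 0 ℕ.< i → i ℕ.< j → rep (i ℕ.+ p) ≡ rep p ⊎ rep (i ℕ.+ p) ≡ rep (j ℕ.+ p)) where
        open Chain p j q<n links (ℕₚ.≤-trans (s≤s (s≤s z≤n)) 6≤j) tag

        impossible : ⊥
        impossible = recurs (word₆ (code 1) (code 2) (code 3) (code 4) (code 5))
          where
          at : ∀ i → ∃ λ b → 0 ℕ.< i → i ℕ.< j → rep (i ℕ.+ p) ≡ letter b
          at i with 0 <? i | i <? j
          ... | yes a | yes b = proj₁ (letter-at i a b) , λ _ _ → proj₂ (letter-at i a b)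
          ... | no a | _ = 0F , λ a′ _ → ⊥-elim (a a′)
          ... | yes _ | no b = 0F , λ _ b′ → ⊥-elim (b b′)
          code : ℕ → Fin 2
          code i = proj₁ (at i)
          word : ℕ → Fin 2
          word = spell (1F ∷ code 1 ∷ code 2 ∷ code 3 ∷ code 4 ∷ code 5 ∷ [])
          spelt : ∀ (i : Fin 6) → 0 ℕ.< toℕ i → rep (toℕ i ℕ.+ p) ≡ letter (word (toℕ i))
          spelt 1F 0<i = proj₂ (at 1) 0<i (ℕₚ.<-≤-trans (s≤s (s≤s z≤n)) 6≤j)
          spelt 2F 0<i = proj₂ (at 2) 0<i (ℕₚ.<-≤-trans (s≤s (s≤s (s≤s z≤n))) 6≤j)
          spelt 3F 0<i = proj₂ (at 3) 0<i (ℕₚ.<-≤-trans (s≤s (s≤s (s≤s (s≤s z≤n)))) 6≤j)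
          spelt (suc 3F) 0<i = proj₂ (at 4) 0<i (ℕₚ.<-≤-trans (ℕₚ.n≤1+n 5) 6≤j)
          spelt (suc (suc 3F)) 0<i = proj₂ (at 5) 0<i 6≤j
          recurs : ¬ Recurrent word
          recurs (i , k , l , 0<i , i<k , k<l , e , e′) = few (word (toℕ l)) 0<i i<k k<l (ℕₚ.<-≤-trans (Finₚ.toℕ<n l) 6≤j)
            (trans (spelt i 0<i) (cong letter (trans e e′))) (trans (spelt k 0<k) (cong letter e′)) (spelt l (ℕₚ.<-trans 0<k k<l))
            where
            0<k = ℕₚ.<-trans 0<i i<k

    -- A break between p and q moves one of them alone, and a vertex of a third class between them
    -- sees the form by `pair-apart`. What remains is a segment with only two classes, which has at
    -- most five links.
    steep-visible : ∀ {p q} r → p ℕ.< q → q ℕ.< n → ¬ A p q → Visible (φ₀ (σ r) p q) ⊎ Visible (φ₁ (σ r) p q)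
    steep-visible {p} {q} r p<q q<n ¬pq with ℕₚ.anyUpTo? (λ l → (p ℕ.≤? l) ×-dec ¬? (A? l (suc l))) q
    ... | yes (l , l<q , p≤l , br) = inj₁ (stepDatum l , step (ℕₚ.<-trans l<q q<n) , λ e → 1≢0
          (trans (sym (trans (cong₂ (λ x y → (x - y) - σ r * 0ℤ) (trans (Y-step br q) (θ-< l<q)) (trans (Y-step br p) (θ-≥ p≤l))) (cong (λ z → (1ℤ - 0ℤ) - z) (ℤₚ.*-zeroʳ (σ r))))) e))
      where
      1≢0 : 1ℤ ≢ 0ℤ
      1≢0 ()
    ... | no unbroken with ℕₚ.anyUpTo? (λ l → (p <? l) ×-dec (¬? (rep l ℕ.≟ rep p) ×-dec ¬? (rep l ℕ.≟ rep q))) q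
    ...   | yes (l , l<q , p<l , np , nq) = inj₁ (sees (pair-apart p<l l<q q<n np nq))
      where
      sees : (∃ λ b → Basic b × Y b q - Y b p ≢ 0ℤ × X b p ≡ 0ℤ × X b q ≡ 0ℤ) → Visible (φ₀ (σ r) p q)
      sees (b , basic , ne , xp , xq) = b , basic , λ e → ne (trans (sym (trans (cong₂ (λ x y → (Y b q - Y b p) - σ r * (x - y)) xq xp)
          (trans (cong (λ z → (Y b q - Y b p) - z) (ℤₚ.*-zeroʳ (σ r))) (ℤₚ.+-identityʳ (Y b q - Y b p))))) e)
    ...   | no tagged = go (q ℕ.∸ p) (sym (ℕₚ.m∸n+n≡m (ℕₚ.<⇒≤ p<q)))
      where
      links : ∀ {j} → q ≡ j ℕ.+ p → ∀ i → i ℕ.< j → Lk (i ℕ.+ p)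
      links refl i i<j with A? (i ℕ.+ p) (suc (i ℕ.+ p))
      ... | yes lk = lk
      ... | no br = ⊥-elim (unbroken (i ℕ.+ p , ℕₚ.+-monoˡ-< p i<j , ℕₚ.m≤n+m p i , br))
      tags : ∀ {j} → q ≡ j ℕ.+ p → ∀ i → 0 ℕ.< i → i ℕ.< j → rep (i ℕ.+ p) ≡ rep p ⊎ rep (i ℕ.+ p) ≡ rep (j ℕ.+ p)
      tags {j} refl i 0<i i<j with rep (i ℕ.+ p) ℕ.≟ rep p | rep (i ℕ.+ p) ℕ.≟ rep (j ℕ.+ p)
      ... | yes e | _ = inj₁ e
      ... | no _ | yes e = inj₂ e
      ... | no np | no nq = ⊥-elim (tagged (i ℕ.+ p , ℕₚ.+-monoˡ-< p i<j , ℕₚ.+-monoˡ-< p 0<i , np , nq))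
      go : ∀ j → q ≡ j ℕ.+ p → Visible (φ₀ (σ r) p q) ⊎ Visible (φ₁ (σ r) p q)
      go 0 refl = ⊥-elim (ℕₚ.<-irrefl refl p<q)
      go 1 e@refl = ⊥-elim (¬pq (links e 0 (s≤s z≤n)))
      go 2 e@refl = Words2.visible p q<n (links e) (tags e) r
      go 3 e@refl = Words3.visible p q<n (links e) (tags e) r
      go 4 e@refl = inj₁ (Words4.visible p q<n (links e) (tags e) r)
      go 5 e@refl = inj₁ (Words5.visible p q<n (links e) (tags e) r)
      go j@(suc (suc (suc (suc (suc (suc j′)))))) e@refl = ⊥-elim (Long.impossible p j q<n (links e) (s≤s (s≤s (s≤s (s≤s (s≤s (s≤s z≤n)))))) (tags e))

-- Error estimates for finite N.

module Estimate where
  open LinAlg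
  open Arrange using (Layout)
  open Classes
  open Numbers
  open Limit
  open Visible
  open ClassForms
  open SteepForms
  open Transfer using (Hits)
  open import Data.Integer using (+_; -_; _+_; _*_; _-_)
  open import Data.Integer.Tactic.RingSolver using (solve-∀)
  open import Data.Vec using (Vec; []; _∷_)
  open import Relation.Binary.PropositionalEquality

  natSum : ℕ → (ℕ → ℕ) → ℕ
  natSum zero f = 0
  natSum (suc k) f = natSum k f ℕ.+ f k

  ≤natSum : ∀ k f {l} → l ℕ.< k → f l ℕ.≤ natSum k f
  ≤natSum (suc k) f {l} l<k with ℕₚ.m≤n⇒m<n∨m≡n (ℕₚ.≤-pred l<k)
  ... | inj₁ lt = ℕₚ.≤-trans (≤natSum k f lt) (ℕₚ.m≤m+n _ _)
  ... | inj₂ refl = ℕₚ.m≤n+m _ _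

  natSum≤ : ∀ k f {b} → (∀ {l} → l ℕ.< k → f l ℕ.≤ b) → natSum k f ℕ.≤ k ℕ.* b
  natSum≤ zero f le = z≤n
  natSum≤ (suc k) f {b} le = ℕₚ.≤-trans (ℕₚ.+-mono-≤ (natSum≤ k f (λ lt → le (ℕₚ.<-trans lt (ℕₚ.n<1+n k)))) (le (ℕₚ.n<1+n k))) (ℕₚ.≤-reflexive (ℕₚ.+-comm (k ℕ.* b) b))

  natSum-scale : ∀ k c f → natSum k (λ l → c ℕ.* f l) ≡ c ℕ.* natSum k f
  natSum-scale zero c f = sym (ℕₚ.*-zeroʳ c)
  natSum-scale (suc k) c f = trans (cong (ℕ._+ c ℕ.* f k) (natSum-scale k c f)) (sym (ℕₚ.*-distribˡ-+ c (natSum k f) (f k)))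

  coordinate : ∀ {m} → Vec ℤ m → ℕ → ℤ
  coordinate [] _ = 0ℤ
  coordinate (x ∷ _) zero = x
  coordinate (_ ∷ v) (suc l) = coordinate v l

  coordinate-linear : ∀ {m} t (v w : Vec ℤ m) l → coordinate (vcomb t v w) l ≡ t * coordinate v l + coordinate w l
  coordinate-linear t [] [] l = sym (trans (ℤₚ.+-identityʳ _) (ℤₚ.*-zeroʳ t))
  coordinate-linear t (_ ∷ _) (_ ∷ _) zero = refl
  coordinate-linear t (_ ∷ v) (_ ∷ w) (suc l) = coordinate-linear t v w l

  coordinate-zero : ∀ {m} (v : Vec ℤ m) → (∀ l → l ℕ.< m → coordinate v l ≡ 0ℤ) → v ≡ Vec.replicate m 0ℤ
  coordinate-zero [] z = refl
  coordinate-zero (x ∷ v) z = cong₂ _∷_ (z 0 (s≤s z≤n)) (coordinate-zero v (λ l lt → z (suc l) (s≤s lt)))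

  ∣-∣≤ : ∀ {a b x y} → ∣ a ∣ ℕ.≤ x → ∣ b ∣ ℕ.≤ y → ∣ a - b ∣ ℕ.≤ x ℕ.+ y
  ∣-∣≤ {a} {b} p q = ℕₚ.≤-trans (ℤₚ.∣i-j∣≤∣i∣+∣j∣ a b) (ℕₚ.+-mono-≤ p q)

  ∣+∣≤ : ∀ {a b x y} → ∣ a ∣ ℕ.≤ x → ∣ b ∣ ℕ.≤ y → ∣ a + b ∣ ℕ.≤ x ℕ.+ y
  ∣+∣≤ {a} {b} p q = ℕₚ.≤-trans (ℤₚ.∣i+j∣≤∣i∣+∣j∣ a b) (ℕₚ.+-mono-≤ p q)

  ∣*∣≤ : ∀ {a b x y} → ∣ a ∣ ℕ.≤ x → ∣ b ∣ ℕ.≤ y → ∣ a * b ∣ ℕ.≤ x ℕ.* y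
  ∣*∣≤ {a} {b} p q = ℕₚ.≤-trans (ℕₚ.≤-reflexive (ℤₚ.abs-* a b)) (ℕₚ.*-mono-≤ p q)

  module Estimation {n : ℕ} {A : ℕ → ℕ → Set} (L : Layout n A) (base : ℕ) (large : 10 ℕ.+ 4 ℕ.* n ℕ.≤ base) where
    open SteepLineForms L base large

    -- An exact solution, whose abscissae are d X + e with e of order d / N, inherits every
    -- inequality that its limit datum w satisfies to zeroth or first order.
    module Estimates (w : Datum) (M C K slack N : ℕ)
      (steep≤ : ∀ r → steep r ℕ.≤ M) (C-large : 2 ℕ.* n ℕ.* M ℕ.≤ C) (Ξ≤ : ∀ {u} → u ℕ.< n → ∣ Ξ w u ∣ ℕ.≤ K)
      (slack₁ : 20 ℕ.* C ℕ.≤ slack) (slack₂ : 16 ℕ.* C ℕ.* C ℕ.+ 16 ℕ.* M ℕ.* C ℕ.≤ slack)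
      (N-large : 8 ℕ.* n ℕ.* C ℕ.+ suc slack ℕ.* suc (n ℕ.* K) ℕ.≤ N)
      (ψ<N : ∀ {k u v} → k ℕ.≤ 2 → u ℕ.< n → v ℕ.< n → ∣ ψ k u v w ∣ ℕ.< N)
      (φ₁<N : ∀ {u v} r → u ℕ.< n → v ℕ.< n → ∣ φ₁ (σ r) u v w ∣ ℕ.< N)
      (sees-X : ∀ {u v} → u ℕ.< n → v ℕ.< n → Visible (λ b → X b u - X b v) → X w u - X w v ≢ 0ℤ)
      (sees-Y : ∀ {u v} → u ℕ.< n → v ℕ.< n → Visible (λ b → Y b u - Y b v) → Y w u - Y w v ≢ 0ℤ)
      (sees-ψ : ∀ {k u v} → k ℕ.≤ 2 → u ℕ.< n → v ℕ.< n → Visible (ψ k u v) → ψ k u v w ≢ 0ℤ)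
      (sees-φ₀ : ∀ {u v} r → u ℕ.< n → v ℕ.< n → Visible (φ₀ (σ r) u v) → φ₀ (σ r) u v w ≢ 0ℤ)
      (sees-φ₁ : ∀ {u v} r → u ℕ.< n → v ℕ.< n → Visible (φ₁ (σ r) u v) → φ₁ (σ r) u v w ≢ 0ℤ)
      (d : ℤ) (px : ℕ → ℤ) (nontrivial : d ≡ 0ℤ → (∀ {l} → l ℕ.< n → px l ≡ 0ℤ) → ⊥)
      (at-root : ∀ {u} → u ℕ.< n → Root u → px u ≡ d * X w u)
      (at-child : ∀ {u m} → u ℕ.< n → Par u m → + N * (px u - px m) ≡
         + colour u * (path px (λ l → d * proj₂ w l) u - path px (λ l → d * proj₂ w l) m)) where

      private
        S : ℕ → ℤ
        S = proj₂ w

        T : ℕ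
        T = suc slack ℕ.* suc (n ℕ.* K)

      -- `e` and `h` are the errors of the abscissae and ordinates against d times the limit; `ζ`
      -- and `g` are what remains of N times these errors after the first-order terms.
      py e h ζ g : ℕ → ℤ
      py = path px (λ l → d * S l)
      e l = px l - d * X w l
      h = path e (λ _ → 0ℤ)
      ζ l = + N * e l - d * Ξ w l
      g = path ζ (λ _ → 0ℤ)

      E : ℕ
      E = natSum n (λ l → ∣ e l ∣)

      px≡ : ∀ l → px l ≡ d * X w l + e l
      px≡ l = ring (px l) (d * X w l)
        where
        ring : ∀ a b → a ≡ b + (a - b)
        ring = solve-∀

      py≡ : ∀ l → py l ≡ d * Y w l + h l
      py≡ l = trans (path-cong px≡ (λ i → sym (ℤₚ.+-identityʳ (d * S i))) l) (path-linear d (X w) S e (λ _ → 0ℤ) l)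

      Ne≡ : ∀ l → + N * e l ≡ d * Ξ w l + ζ l
      Ne≡ l = ring (+ N * e l) (d * Ξ w l)
        where
        ring : ∀ a b → a ≡ b + (a - b)
        ring = solve-∀

      Nh≡ : ∀ l → + N * h l ≡ d * H w l + g l
      Nh≡ l = trans (scale l) (trans (path-cong Ne≡ (λ _ → sym (trans (ℤₚ.+-identityʳ _) (ℤₚ.*-zeroʳ d))) l) (path-linear d (Ξ w) (λ _ → 0ℤ) ζ (λ _ → 0ℤ) l))
        where
        path-zero : ∀ l → path (λ _ → 0ℤ) (λ _ → 0ℤ) l ≡ 0ℤ
        path-zero zero = refl
        path-zero (suc l) = trans (cong₂ _+_ (path-zero l) (cong₂ _+_ (ℤₚ.*-zeroʳ (slope l)) (jump-0 l))) refl
        scale : ∀ l → + N * h l ≡ path (λ i → + N * e i) (λ _ → 0ℤ) l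
        scale l = sym (trans (path-cong (λ i → sym (ℤₚ.+-identityʳ (+ N * e i))) (λ _ → sym (trans (ℤₚ.+-identityʳ _) (ℤₚ.*-zeroʳ (+ N)))) l)
          (trans (path-linear (+ N) e (λ _ → 0ℤ) (λ _ → 0ℤ) (λ _ → 0ℤ) l) (trans (cong (_+_ (+ N * h l)) (path-zero l)) (ℤₚ.+-identityʳ _))))

      e-root : ∀ {u} → u ℕ.< n → Root u → e u ≡ 0ℤ
      e-root {u} u<n r = trans (cong (_- d * X w u) (at-root u<n r)) (ℤₚ.+-inverseʳ (d * X w u))

      step-e : ∀ {u} → u ℕ.< n → + N * (e u - e (p u)) ≡ d * κ w u + + colour u * (h u - h (p u))
      step-e {u} u<n = [ (λ r → subst Step (sym (p-root r)) (ring (+ N) (e u) d (+ colour u) (Y w u) (h u)))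
                       , (λ (m , q) → subst Step (sym (p-par q)) (child-step m q)) ]′ (root-or-child (parent? u))
        where
        Step : ℕ → Set
        Step m = + N * (e u - e m) ≡ d * (+ colour u * (Y w u - Y w m)) + + colour u * (h u - h m)
        root-or-child : Dec (∃ λ m → Par u m) → Root u ⊎ (∃ λ m → Par u m)
        root-or-child (yes q) = inj₂ q
        root-or-child (no none) = inj₁ (λ m q → none (m , q))
        ring : ∀ N e d c y h → N * (e - e) ≡ d * (c * (y - y)) + c * (h - h)
        ring = solve-∀
        ring₁ : ∀ N a b c → N * ((a - c) - (b - c)) ≡ N * (a - b)
        ring₁ = solve-∀
        ring₂ : ∀ c d y y′ h h′ → c * ((d * y + h) - (d * y′ + h′)) ≡ d * (c * (y - y′)) + c * (h - h′)
        ring₂ = solve-∀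
        child-step : ∀ m → Par u m → Step m
        child-step m q = trans (trans (cong (λ z → + N * ((px u - d * X w u) - (px m - d * z))) (sym X≡)) (ring₁ (+ N) (px u) (px m) (d * X w u)))
            (trans (at-child u<n q) (trans (cong₂ (λ a b → + colour u * (a - b)) (py≡ u) (py≡ m)) (ring₂ (+ colour u) d (Y w u) (Y w m) (h u) (h m))))
          where
          X≡ : X w u ≡ X w m
          X≡ = cong (proj₁ w) (rep-par q)

      rep-is-root : ∀ u → Root (p (p u))
      rep-is-root u with view u
      ... | root r = subst Root (sym (rep-root r)) r
      ... | child q r = subst Root (sym (rep-child q r)) r
      ... | nephew l k = subst Root (sym (rep-nephew l k)) (close-root k)

      -- Telescoping the edge equations up to the root, where `e` vanishes, cancels the first-order
      -- terms. What is left involves only `h`, so `ζ` is bounded by a multiple of `E` independent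
      -- of N.
      ζ≡ : ∀ {u} → u ℕ.< n → ζ u ≡ + colour u * (h u - h (p u)) + + colour (p u) * (h (p u) - h (p (p u)))
      ζ≡ {u} u<n = trans (cong (_- d * Ξ w u) (trans (ring₁ (+ N) (e u) (e (p u)) (e (p (p u))) (e-root (rep-< u<n) (rep-is-root u)))
          (cong₂ _+_ (step-e u<n) (step-e (p-< u<n))))) (ring₂ d (κ w u) (κ w (p u)) (+ colour u * (h u - h (p u))) (+ colour (p u) * (h (p u) - h (p (p u)))))
        where
        ring₁ : ∀ N a b c → c ≡ 0ℤ → N * a ≡ N * (a - b) + N * (b - c)
        ring₁ N a b _ refl = ring N a b
          where
          ring : ∀ N a b → N * a ≡ N * (a - b) + N * (b - 0ℤ)
          ring = solve-∀
        ring₂ : ∀ d k k′ a b → (d * k + a) + (d * k′ + b) - d * (k + k′) ≡ a + b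
        ring₂ = solve-∀

      slope≤ : ∀ l → ∣ slope l ∣ ℕ.≤ M
      slope≤ l = steep≤ (residue l)

      path-bound : ∀ (f : ℕ → ℤ) b → (∀ {l} → l ℕ.< n → ∣ f l ∣ ℕ.≤ b) → ∀ {u} → u ℕ.< n → ∣ path f (λ _ → 0ℤ) u ∣ ℕ.≤ C ℕ.* b
      path-bound f b f≤ {u} u<n = ℕₚ.≤-trans (go u u<n) (ℕₚ.*-monoˡ-≤ b (ℕₚ.≤-trans (ℕₚ.*-monoˡ-≤ M (ℕₚ.*-monoʳ-≤ 2 (ℕₚ.<⇒≤ u<n))) C-large))
        where
        ring : ∀ l m b → 2 ℕ.* l ℕ.* m ℕ.* b ℕ.+ (m ℕ.* (b ℕ.+ b) ℕ.+ 0) ≡ 2 ℕ.* (1 ℕ.+ l) ℕ.* m ℕ.* b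
        ring = ℕSolver.solve-∀
        go : ∀ u → u ℕ.< n → ∣ path f (λ _ → 0ℤ) u ∣ ℕ.≤ 2 ℕ.* u ℕ.* M ℕ.* b
        go zero _ = z≤n
        go (suc l) lt = ℕₚ.≤-trans (∣+∣≤ {path f (λ _ → 0ℤ) l} (go l l<n) (∣+∣≤ {slope l * (f (suc l) - f l)} (∣*∣≤ {slope l} (slope≤ l) (∣-∣≤ {f (suc l)} (f≤ lt) (f≤ l<n))) (ℕₚ.≤-reflexive (cong ∣_∣ (jump-0 l)))))
          (ℕₚ.≤-reflexive (ring l M b))
          where
          l<n = ℕₚ.<-trans (ℕₚ.n<1+n l) lt

      e≤ : ∀ {l} → l ℕ.< n → ∣ e l ∣ ℕ.≤ E
      e≤ = ≤natSum n (λ l → ∣ e l ∣)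

      h≤ : ∀ {u} → u ℕ.< n → ∣ h u ∣ ℕ.≤ C ℕ.* E
      h≤ = path-bound e E e≤

      hh≤ : ∀ {u u′} → u ℕ.< n → u′ ℕ.< n → ∣ h u - h u′ ∣ ℕ.≤ C ℕ.* E ℕ.+ C ℕ.* E
      hh≤ {u} {u′} lt lt′ = ∣-∣≤ {h u} {h u′} (h≤ lt) (h≤ lt′)

      ζ≤ : ∀ {u} → u ℕ.< n → ∣ ζ u ∣ ℕ.≤ 8 ℕ.* C ℕ.* E
      ζ≤ {u} u<n = ℕₚ.≤-trans (ℕₚ.≤-reflexive (cong ∣_∣ (ζ≡ u<n))) (ℕₚ.≤-trans (∣+∣≤ {+ colour u * (h u - h (p u))}
          (∣*∣≤ {+ colour u} (colour≤2 u) (hh≤ u<n (p-< u<n))) (∣*∣≤ {+ colour (p u)} (colour≤2 (p u)) (hh≤ (p-< u<n) (rep-< u<n)))) (ℕₚ.≤-reflexive (ring C E)))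
        where
        ring : ∀ C E → 2 ℕ.* (C ℕ.* E ℕ.+ C ℕ.* E) ℕ.+ 2 ℕ.* (C ℕ.* E ℕ.+ C ℕ.* E) ≡ 8 ℕ.* C ℕ.* E
        ring = ℕSolver.solve-∀

      g≤ : ∀ {u} → u ℕ.< n → ∣ g u ∣ ℕ.≤ C ℕ.* (8 ℕ.* C ℕ.* E)
      g≤ = path-bound ζ (8 ℕ.* C ℕ.* E) ζ≤

      Ne≤ : ∀ {u} → u ℕ.< n → N ℕ.* ∣ e u ∣ ℕ.≤ ∣ d ∣ ℕ.* K ℕ.+ 8 ℕ.* C ℕ.* E
      Ne≤ {u} u<n = ℕₚ.≤-trans (ℕₚ.≤-reflexive (trans (sym (ℤₚ.abs-* (+ N) (e u))) (cong ∣_∣ (Ne≡ u))))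
        (∣+∣≤ {d * Ξ w u} (∣*∣≤ {d} ℕₚ.≤-refl (Ξ≤ u<n)) (ζ≤ u<n))

      -- Sum the bounds on N times the errors over all vertices; the part 8 n C of `N` absorbs the
      -- errors that reappear on the right.
      TE≤ : T ℕ.* E ℕ.≤ ∣ d ∣ ℕ.* (n ℕ.* K)
      TE≤ = ℕₚ.+-cancelˡ-≤ (8 ℕ.* n ℕ.* C ℕ.* E) _ _ (ℕₚ.≤-trans (ℕₚ.≤-reflexive (sym (ℕₚ.*-distribʳ-+ E (8 ℕ.* n ℕ.* C) T)))
          (ℕₚ.≤-trans (ℕₚ.*-monoˡ-≤ E N-large) (ℕₚ.≤-trans (ℕₚ.≤-reflexive (sym (natSum-scale n N (λ l → ∣ e l ∣))))
            (ℕₚ.≤-trans (natSum≤ n (λ l → N ℕ.* ∣ e l ∣) Ne≤) (ℕₚ.≤-reflexive (ring n ∣ d ∣ K C E))))))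
        where
        ring : ∀ n d K C E → n ℕ.* (d ℕ.* K ℕ.+ 8 ℕ.* C ℕ.* E) ≡ 8 ℕ.* n ℕ.* C ℕ.* E ℕ.+ d ℕ.* (n ℕ.* K)
        ring = ℕSolver.solve-∀

      -- With d = 0 the last estimate forces all errors to vanish and hence the whole solution,
      -- which is nontrivial.
      d≢0 : d ≢ 0ℤ
      d≢0 d≡0 = nontrivial d≡0 λ {l} lt → trans (px≡ l) (trans (cong₂ (λ a b → a * X w l + b) d≡0
          (ℤₚ.∣i∣≡0⇒i≡0 (ℕₚ.n≤0⇒n≡0 (subst (∣ e l ∣ ℕ.≤_) E≡0 (e≤ lt))))) (trans (ℤₚ.+-identityʳ _) (ℤₚ.*-zeroˡ (X w l))))
        where
        E≡0 : E ≡ 0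
        E≡0 = [ (λ ()) , (λ z → z) ]′ (ℕₚ.m*n≡0⇒m≡0∨n≡0 T (ℕₚ.n≤0⇒n≡0 (subst (λ z → T ℕ.* E ℕ.≤ ∣ z ∣ ℕ.* (n ℕ.* K)) d≡0 TE≤)))

      slackE<d : slack ℕ.* E ℕ.< ∣ d ∣
      slackE<d = ℕₚ.≤-<-trans (ℕₚ.m≤n+m _ E) (ℕₚ.*-cancelˡ-< (suc (n ℕ.* K)) (suc slack ℕ.* E) ∣ d ∣
          (ℕₚ.≤-<-trans (ℕₚ.≤-trans (ℕₚ.≤-reflexive (ring (suc (n ℕ.* K)) (suc slack) E)) TE≤)
            (ℕₚ.<-≤-trans (ℕₚ.m<n+m (∣ d ∣ ℕ.* (n ℕ.* K)) (ℕₚ.n≢0⇒n>0 (λ z → d≢0 (ℤₚ.∣i∣≡0⇒i≡0 z)))) (ℕₚ.≤-reflexive (ring₂ ∣ d ∣ (n ℕ.* K))))))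
        where
        ring : ∀ a s E → a ℕ.* (s ℕ.* E) ≡ s ℕ.* a ℕ.* E
        ring = ℕSolver.solve-∀
        ring₂ : ∀ d a → d ℕ.+ d ℕ.* a ≡ (1 ℕ.+ a) ℕ.* d
        ring₂ = ℕSolver.solve-∀

      -- N (x_u - x_v) = k (y_u - y_v) would force X_u = X_v and ψ k u v = 0.
      near-vertical : ∀ {k u v} → k ℕ.≤ 2 → u ℕ.< n → v ℕ.< n →
                      Visible (λ b → X b u - X b v) ⊎ Visible (ψ k u v) → + N * (px u - px v) - + k * (py u - py v) ≢ 0ℤ
      near-vertical {k} {u} {v} k≤2 u<n v<n seen eq = dominant d (+ N * (X w u - X w v) + ψ k u v w) rest main rest< (trans (sym expand) eq)
        where
        rest : ℤ
        rest = (ζ u - ζ v) - + k * (h u - h v)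
        main : + N * (X w u - X w v) + ψ k u v w ≢ 0ℤ
        main with (X w u - X w v) ℤₚ.≟ 0ℤ
        ... | no ne = dominant (+ N) (X w u - X w v) (ψ k u v w) ne (ψ<N {k} {u} {v} k≤2 u<n v<n)
        ... | yes z = λ e → [ (λ s → sees-X u<n v<n s z)
                            , (λ s → sees-ψ {k} {u} {v} k≤2 u<n v<n s (trans (sym (trans (cong (λ a → + N * a + ψ k u v w) z) (trans (cong (_+ ψ k u v w) (ℤₚ.*-zeroʳ (+ N))) (ℤₚ.+-identityˡ _)))) e)) ]′ seen
        expand : + N * (px u - px v) - + k * (py u - py v) ≡ d * (+ N * (X w u - X w v) + ψ k u v w) + rest
        expand = trans (cong₂ (λ a b → + N * a - + k * b) (cong₂ _-_ (px≡ u) (px≡ v)) (cong₂ _-_ (py≡ u) (py≡ v)))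
          (trans (ring₁ (+ N) (+ k) d (X w u) (X w v) (e u) (e v) (Y w u) (Y w v) (h u) (h v))
          (trans (cong₂ (λ a b → + N * (d * (X w u - X w v)) + (a - b) - + k * (d * (Y w u - Y w v) + (h u - h v))) (Ne≡ u) (Ne≡ v))
            (ring₂ (+ N) (+ k) d (X w u) (X w v) (Y w u) (Y w v) (h u) (h v) (Ξ w u) (Ξ w v) (ζ u) (ζ v))))
          where
          ring₁ : ∀ N k d X X′ e e′ Y Y′ h h′ → N * ((d * X + e) - (d * X′ + e′)) - k * ((d * Y + h) - (d * Y′ + h′)) ≡ N * (d * (X - X′)) + (N * e - N * e′) - k * (d * (Y - Y′) + (h - h′))
          ring₁ = solve-∀
          ring₂ : ∀ N k d X X′ Y Y′ h h′ Ξ Ξ′ ζ ζ′ → N * (d * (X - X′)) + ((d * Ξ + ζ) - (d * Ξ′ + ζ′)) - k * (d * (Y - Y′) + (h - h′)) ≡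
                  d * (N * (X - X′) + ((Ξ - Ξ′) - k * (Y - Y′))) + ((ζ - ζ′) - k * (h - h′))
          ring₂ = solve-∀
        rest< : ∣ rest ∣ ℕ.< ∣ d ∣
        rest< = ℕₚ.≤-<-trans (ℕₚ.≤-trans (∣-∣≤ {ζ u - ζ v} {+ k * (h u - h v)} (∣-∣≤ {ζ u} {ζ v} (ζ≤ u<n) (ζ≤ v<n)) (∣*∣≤ {+ k} k≤2 (hh≤ u<n v<n)))
            (ℕₚ.≤-trans (ℕₚ.≤-reflexive (ring C E)) (ℕₚ.*-monoˡ-≤ E slack₁))) slackE<d
          where
          ring : ∀ C E → (8 ℕ.* C ℕ.* E ℕ.+ 8 ℕ.* C ℕ.* E) ℕ.+ 2 ℕ.* (C ℕ.* E ℕ.+ C ℕ.* E) ≡ 20 ℕ.* C ℕ.* E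
          ring = ℕSolver.solve-∀

      -- Multiplied by N, the deviation is d (N φ₀ + φ₁) plus a remainder smaller than d. Two uses
      -- of `dominant` conclude: N outweighs `φ₁` where `φ₀` is nonzero, and d outweighs the
      -- remainder.
      steep-line : ∀ {u v} r → u ℕ.< n → v ℕ.< n → Visible (φ₀ (σ r) u v) ⊎ Visible (φ₁ (σ r) u v) → (py v - py u) - σ r * (px v - px u) ≢ 0ℤ
      steep-line {u} {v} r u<n v<n seen eq = dominant d (+ N * φ₀ (σ r) u v w + φ₁ (σ r) u v w) rest main rest<
          (trans (sym expand) (trans (cong (+ N *_) eq) (ℤₚ.*-zeroʳ (+ N))))
        where
        rest : ℤ
        rest = (g v - g u) - σ r * (ζ v - ζ u)
        main : + N * φ₀ (σ r) u v w + φ₁ (σ r) u v w ≢ 0ℤ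
        main with φ₀ (σ r) u v w ℤₚ.≟ 0ℤ
        ... | no ne = dominant (+ N) (φ₀ (σ r) u v w) (φ₁ (σ r) u v w) ne (φ₁<N r u<n v<n)
        ... | yes z = λ e → [ (λ s → sees-φ₀ r u<n v<n s z)
                            , (λ s → sees-φ₁ r u<n v<n s (trans (sym (trans (cong (λ a → + N * a + φ₁ (σ r) u v w) z) (trans (cong (_+ φ₁ (σ r) u v w) (ℤₚ.*-zeroʳ (+ N))) (ℤₚ.+-identityˡ _)))) e)) ]′ seen
        expand : + N * ((py v - py u) - σ r * (px v - px u)) ≡ d * (+ N * φ₀ (σ r) u v w + φ₁ (σ r) u v w) + rest
        expand = trans (cong₂ (λ a b → + N * (b - σ r * a)) (cong₂ _-_ (px≡ v) (px≡ u)) (cong₂ _-_ (py≡ v) (py≡ u)))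
          (trans (ring₁ (+ N) (σ r) d (X w u) (X w v) (e u) (e v) (Y w u) (Y w v) (h u) (h v))
          (trans (cong₂ (λ a b → + N * (d * φ₀ (σ r) u v w) + (a - σ r * b)) (cong₂ _-_ (Nh≡ v) (Nh≡ u)) (cong₂ _-_ (Ne≡ v) (Ne≡ u)))
            (ring₂ (+ N) (σ r) d (φ₀ (σ r) u v w) (H w u) (H w v) (g u) (g v) (Ξ w u) (Ξ w v) (ζ u) (ζ v))))
          where
          ring₁ : ∀ N m d X X′ e e′ Y Y′ h h′ → N * (((d * Y′ + h′) - (d * Y + h)) - m * ((d * X′ + e′) - (d * X + e))) ≡
                  N * (d * ((Y′ - Y) - m * (X′ - X))) + ((N * h′ - N * h) - m * (N * e′ - N * e))
          ring₁ = solve-∀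
          ring₂ : ∀ N m d f H H′ g g′ Ξ Ξ′ ζ ζ′ → N * (d * f) + (((d * H′ + g′) - (d * H + g)) - m * ((d * Ξ′ + ζ′) - (d * Ξ + ζ))) ≡
                  d * (N * f + ((H′ - H) - m * (Ξ′ - Ξ))) + ((g′ - g) - m * (ζ′ - ζ))
          ring₂ = solve-∀
        rest< : ∣ rest ∣ ℕ.< ∣ d ∣
        rest< = ℕₚ.≤-<-trans (ℕₚ.≤-trans (∣-∣≤ {g v - g u} {σ r * (ζ v - ζ u)} (∣-∣≤ {g v} {g u} (g≤ v<n) (g≤ u<n)) (∣*∣≤ {σ r} (steep≤ r) (∣-∣≤ {ζ v} {ζ u} (ζ≤ v<n) (ζ≤ u<n))))
            (ℕₚ.≤-trans (ℕₚ.≤-reflexive (ring C M E)) (ℕₚ.*-monoˡ-≤ E slack₂))) slackE<d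
          where
          ring : ∀ C M E → (C ℕ.* (8 ℕ.* C ℕ.* E) ℕ.+ C ℕ.* (8 ℕ.* C ℕ.* E)) ℕ.+ M ℕ.* (8 ℕ.* C ℕ.* E ℕ.+ 8 ℕ.* C ℕ.* E) ≡ (16 ℕ.* C ℕ.* C ℕ.+ 16 ℕ.* M ℕ.* C) ℕ.* E
          ring = ℕSolver.solve-∀

      apart-vertically : ∀ {u v} → u ℕ.< n → v ℕ.< n → Visible (λ b → Y b u - Y b v) → py u - py v ≢ 0ℤ
      apart-vertically {u} {v} u<n v<n seen eq = dominant d (Y w u - Y w v) (h u - h v) (sees-Y u<n v<n seen) rest<
          (trans (sym (trans (cong₂ _-_ (py≡ u) (py≡ v)) (ring d (Y w u) (Y w v) (h u) (h v)))) eq)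
        where
        ring : ∀ d y y′ h h′ → (d * y + h) - (d * y′ + h′) ≡ d * (y - y′) + (h - h′)
        ring = solve-∀
        rest< : ∣ h u - h v ∣ ℕ.< ∣ d ∣
        rest< = ℕₚ.≤-<-trans (ℕₚ.≤-trans (hh≤ u<n v<n) (ℕₚ.≤-trans (ℕₚ.≤-reflexive (ring₂ C E)) (ℕₚ.*-monoˡ-≤ E
            (ℕₚ.≤-trans (ℕₚ.*-monoˡ-≤ C {2} {20} (s≤s (s≤s z≤n))) slack₁)))) slackE<d
          where
          ring₂ : ∀ C E → C ℕ.* E ℕ.+ C ℕ.* E ≡ 2 ℕ.* C ℕ.* E
          ring₂ = ℕSolver.solve-∀

-- The exact line equations and the drawing without K₄ components.

module Exact where
  open LinAlg
  open Arrange using (Layout)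
  open Classes
  open Numbers
  open Limit
  open Visible
  open ClassForms
  open SteepForms
  open Estimate
  open Transfer using (Hits)
  open import Data.Integer using (+_; -_; _+_; _*_; _-_)
  open import Data.Integer.Tactic.RingSolver using (solve-∀)
  open import Data.List using (concat)
  open import Data.List.Properties using (length-map; length-upTo)
  open import Data.List.Membership.Propositional.Properties using (∈-concat⁺′)
  open import Data.Vec using (Vec; []; _∷_)
  open import Relation.Binary.PropositionalEquality

  -- The large slope N is taken as 2 N′, so that N / 2 is an integer as well.
  slopeList : ℕ → ℕ → List (Maybe ℕ)
  slopeList base N′ = nothing ∷ just (2 ℕ.* N′) ∷ just N′ ∷
    just 1 ∷ just 2 ∷ just (2 ℕ.+ base) ∷ just (2 ℕ.+ (base ℕ.+ base ℕ.* base)) ∷ []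

  hits-sym : ∀ σ {P Q} → Hits σ P Q → Hits σ Q P
  hits-sym nothing h = sym h
  hits-sym (just m) {x₁ , y₁} {x₂ , y₂} h = trans (ring₁ y₁ y₂) (trans (cong -_ h) (ring₂ (+ m) x₁ x₂))
    where
    ring₁ : ∀ a b → a - b ≡ - (b - a)
    ring₁ = solve-∀
    ring₂ : ∀ m a b → - (m * (b - a)) ≡ m * (a - b)
    ring₂ = solve-∀

  record IndexDrawing (n : ℕ) (A : ℕ → ℕ → Set) : Set where
    field
      base N′  : ℕ
      place    : ℕ → ℤ × ℤ
      distinct : ∀ {u v} → u ℕ.< n → v ℕ.< n → u ≢ v → place u ≢ place v
      edge     : ∀ {u v} → A u v → ∃ λ σ → σ ∈ slopeList base N′ × Hits σ (place u) (place v)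
      nonedge  : ∀ {u v} → u ℕ.< n → v ℕ.< n → u ≢ v → ¬ A u v → ∀ {σ} → σ ∈ slopeList base N′ → ¬ Hits σ (place u) (place v)

  module ExactDrawing {n : ℕ} {A : ℕ → ℕ → Set} (L : Layout n A) (base : ℕ) (large : 10 ℕ.+ 4 ℕ.* n ℕ.≤ base) where
    open Estimation L base large
    open SteepLineForms L base large

    private
      steep-∈ : ∀ N′ r → just (steep r) ∈ slopeList base N′
      steep-∈ N′ 0F = there (there (there (here refl)))
      steep-∈ N′ 1F = there (there (there (there (here refl))))
      steep-∈ N′ 2F = there (there (there (there (there (here refl)))))
      steep-∈ N′ 3F = there (there (there (there (there (there (here refl))))))

    -- The line equations of the drawing, with the links already built into the ordinates.
    module Lines (N′ : ℕ) (N′≢0 : N′ ≢ 0) (d : ℤ) (s px : ℕ → ℤ) where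

      py : ℕ → ℤ
      py = path px (λ l → d * s l)

      module _
        (at-child : ∀ {u m} → u ℕ.< n → Par u m → + (2 ℕ.* N′) * (px u - px m) ≡ + colour u * (py u - py m))
        (near-vertical : ∀ {k u v} → k ℕ.≤ 2 → u ℕ.< n → v ℕ.< n → Visible (λ b → X b u - X b v) ⊎ Visible (ψ k u v) →
           + (2 ℕ.* N′) * (px u - px v) - + k * (py u - py v) ≢ 0ℤ)
        (steep-line : ∀ {u v} r → u ℕ.< n → v ℕ.< n → Visible (φ₀ (σ r) u v) ⊎ Visible (φ₁ (σ r) u v) → (py v - py u) - σ r * (px v - px u) ≢ 0ℤ)
        (apart-vertically : ∀ {u v} → u ℕ.< n → v ℕ.< n → Visible (λ b → Y b u - Y b v) → py u - py v ≢ 0ℤ) where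

        private
          pos : ℕ → ℤ × ℤ
          pos u = px u , py u

          2N′≢0 : + (2 ℕ.* N′) ≢ 0ℤ
          2N′≢0 e = N′≢0 (ℕₚ.m+n≡0⇒m≡0 N′ (ℤₚ.+-injective e))

          link-hits : ∀ {u} → Lk u → Hits (just (steep (residue u))) (pos u) (pos (suc u))
          link-hits {u} lk = trans (cong (λ j → py u + (slope u * (px (suc u) - px u) + j) - py u) (jump-link (d * s u) lk)) (ring (py u) (slope u * (px (suc u) - px u)))
            where
            ring : ∀ a b → a + (b + 0ℤ) - a ≡ b
            ring = solve-∀

          Edge : ℕ → ℕ → Set
          Edge u v = ∃ λ σ → σ ∈ slopeList base N′ × Hits σ (pos u) (pos v)

          edge-sym : ∀ {u v} → Edge u v → Edge v u
          edge-sym {u} {v} (σ , σ∈ , h) = σ , σ∈ , hits-sym σ {pos u} {pos v} h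

          coloured : ∀ {u m} c → c ℕ.≤ 2 → + (2 ℕ.* N′) * (px u - px m) ≡ + c * (py u - py m) → Edge m u
          coloured {u} {m} 0 _ e = nothing , here refl , sym (ℤₚ.i-j≡0⇒i≡j (px u) (px m)
            ([ (λ z → ⊥-elim (2N′≢0 z)) , (λ z → z) ]′ (ℤₚ.i*j≡0⇒i≡0∨j≡0 (+ (2 ℕ.* N′)) (trans e (ℤₚ.*-zeroˡ (py u - py m))))))
          coloured {u} {m} 1 _ e = just (2 ℕ.* N′) , there (here refl) , sym (trans e (ℤₚ.*-identityˡ (py u - py m)))
          coloured {u} {m} 2 _ e = just N′ , there (there (here refl)) , ℤₚ.*-cancelˡ-≡ (+ 2) (py u - py m) (+ N′ * (px u - px m))
            (sym (trans (sym (ℤₚ.*-assoc (+ 2) (+ N′) (px u - px m))) (trans (cong (_* (px u - px m)) (sym (ℤₚ.pos-* 2 N′))) e)))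
          coloured (suc (suc (suc c))) (s≤s (s≤s ())) e

          R-edge : ∀ {u v} → R u v → Edge u v
          R-edge {u} {v} r with orient r
          ... | inj₁ q = edge-sym {v} {u} (coloured {u} {v} (colour u) (colour≤2 u) (at-child (R-< r) q))
          ... | inj₂ q = coloured {v} {u} (colour v) (colour≤2 v) (at-child (R-<′ r) q)

          kind : ∀ {u v} → A u v → v ≡ suc u ⊎ u ≡ suc v ⊎ R u v
          kind {u} {v} a with v ℕ.≟ suc u | u ℕ.≟ suc v
          ... | yes e | _ = inj₁ e
          ... | no _ | yes e = inj₂ (inj₁ e)
          ... | no ne | no ne′ = inj₂ (inj₂ (a , ne , ne′))

          x-differ : ∀ {u v} → u ℕ.< n → v ℕ.< n → Visible (λ b → X b u - X b v) ⊎ Visible (ψ 0 u v) → px u ≢ px v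
          x-differ {u} {v} u<n v<n seen e = near-vertical {0} {u} {v} z≤n u<n v<n seen (trans (cong (λ z → + (2 ℕ.* N′) * (z - px v) - 0ℤ * (py u - py v)) e) (ring (+ (2 ℕ.* N′)) (px v) (py u - py v)))
            where
            ring : ∀ N x y → N * (x - x) - 0ℤ * y ≡ 0ℤ
            ring = solve-∀

          link-visible : ∀ {u} → Lk u → Visible (λ b → X b u - X b (suc u)) ⊎ Visible (ψ 0 u (suc u))
          link-visible {u} lk with rep u ℕ.≟ rep (suc u)
          ... | no ne = inj₁ (class-visible (A-< lk) ne)
          ... | yes e = inj₂ (visible-cong (λ b → ring (Ξ b u) (Ξ b (suc u)) (Y b u - Y b (suc u))) (visible-neg (collapsed-visible lk e)))
            where
            ring : ∀ a b c → - (b - a) ≡ (a - b) - 0ℤ * c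
            ring = solve-∀

          nonedge-visible : ∀ {u v} → u ℕ.< n → u ≢ v → ¬ A u v → ∀ {k} → k ℕ.≤ 2 → Visible (λ b → X b u - X b v) ⊎ Visible (ψ k u v)
          nonedge-visible {u} {v} u<n u≢v ¬a k≤2 with rep u ℕ.≟ rep v
          ... | no ne = inj₁ (class-visible u<n ne)
          ... | yes e = inj₂ (same-class-visible u≢v (λ r → ¬a (proj₁ r)) e k≤2)

          R-distinct : ∀ {u v} → R u v → pos u ≢ pos v
          R-distinct {u} {v} r e with orient r
          ... | inj₁ q = apart-vertically (R-< r) (R-<′ r) (parent-visible q) (trans (cong (_- py v) (cong proj₂ e)) (ℤₚ.+-inverseʳ (py v)))
          ... | inj₂ q = apart-vertically (R-<′ r) (R-< r) (parent-visible q) (trans (cong (_- py u) (cong proj₂ (sym e))) (ℤₚ.+-inverseʳ (py u)))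

          steep-miss : ∀ {u v} r → u ℕ.< v → v ℕ.< n → ¬ A u v → ¬ Hits (just (steep r)) (pos u) (pos v)
          steep-miss {u} {v} r u<v v<n ¬a h = steep-line r (ℕₚ.<-trans u<v v<n) v<n (steep-visible r u<v v<n ¬a)
            (trans (cong (_- σ r * (px v - px u)) h) (ℤₚ.+-inverseʳ (σ r * (px v - px u))))

          steep-miss′ : ∀ {u v} r → u ℕ.< n → v ℕ.< n → u ≢ v → ¬ A u v → ¬ Hits (just (steep r)) (pos u) (pos v)
          steep-miss′ {u} {v} r u<n v<n u≢v ¬a h with ℕₚ.<-cmp u v
          ... | tri< lt _ _ = steep-miss r lt v<n ¬a h
          ... | tri≈ _ e _ = u≢v e
          ... | tri> _ _ gt = steep-miss r gt u<n (λ a → ¬a (A-sym a)) (hits-sym (just (steep r)) {pos u} {pos v} h)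

        drawing : IndexDrawing n A
        drawing = record
          { base = base
          ; N′ = N′
          ; place = pos
          ; distinct = λ {u} {v} → distinct u v
          ; edge = λ {u} {v} → edge u v
          ; nonedge = λ {u} {v} u<n v<n u≢v ¬a → nonedge u v u<n v<n u≢v ¬a
          }
          where
          edge : ∀ u v → A u v → Edge u v
          edge u v a with kind a
          ... | inj₁ refl = just (steep (residue u)) , steep-∈ N′ (residue u) , link-hits a
          ... | inj₂ (inj₁ refl) = edge-sym {v} {u} (just (steep (residue v)) , steep-∈ N′ (residue v) , link-hits (A-sym a))
          ... | inj₂ (inj₂ r) = R-edge r
          -- Non-adjacent and linked pairs differ in abscissa. Remaining edges may be vertical, so
          -- their ends are told apart by the ordinate.
          distinct : ∀ u v → u ℕ.< n → v ℕ.< n → u ≢ v → pos u ≢ pos v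
          distinct u v u<n v<n u≢v e with A? u v
          ... | no ¬a = x-differ u<n v<n (nonedge-visible u<n u≢v ¬a z≤n) (cong proj₁ e)
          ... | yes a with kind a
          ...   | inj₁ refl = x-differ u<n v<n (link-visible a) (cong proj₁ e)
          ...   | inj₂ (inj₁ refl) = x-differ v<n u<n (link-visible (A-sym a)) (cong proj₁ (sym e))
          ...   | inj₂ (inj₂ r) = R-distinct r e
          nonedge : ∀ u v → u ℕ.< n → v ℕ.< n → u ≢ v → ¬ A u v → ∀ {σ} → σ ∈ slopeList base N′ → ¬ Hits σ (pos u) (pos v)
          nonedge u v u<n v<n u≢v ¬a (here refl) h = x-differ u<n v<n (nonedge-visible u<n u≢v ¬a z≤n) h
          nonedge u v u<n v<n u≢v ¬a (there (here refl)) h = near-vertical {1} {u} {v} (s≤s z≤n) u<n v<n (nonedge-visible u<n u≢v ¬a (s≤s z≤n))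
            (trans (ring₁ (+ (2 ℕ.* N′)) (px u) (px v) (py u) (py v)) (trans (cong (λ z → z - + (2 ℕ.* N′) * (px v - px u)) h) (ℤₚ.+-inverseʳ (+ (2 ℕ.* N′) * (px v - px u)))))
            where
            ring₁ : ∀ N x x′ y y′ → N * (x - x′) - 1ℤ * (y - y′) ≡ (y′ - y) - N * (x′ - x)
            ring₁ = solve-∀
          nonedge u v u<n v<n u≢v ¬a (there (there (here refl))) h = near-vertical {2} {u} {v} ℕₚ.≤-refl u<n v<n (nonedge-visible u<n u≢v ¬a ℕₚ.≤-refl)
            (trans (cong (λ N → N * (px u - px v) - + 2 * (py u - py v)) (ℤₚ.pos-* 2 N′)) (trans (ring₁ (+ N′) (px u) (px v) (py u) (py v))
              (trans (cong (λ z → + 2 * (z - + N′ * (px v - px u))) h) (trans (cong (+ 2 *_) (ℤₚ.+-inverseʳ (+ N′ * (px v - px u)))) refl))))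
            where
            ring₁ : ∀ N x x′ y y′ → + 2 * N * (x - x′) - + 2 * (y - y′) ≡ + 2 * ((y′ - y) - N * (x′ - x))
            ring₁ = solve-∀
          nonedge u v u<n v<n u≢v ¬a (there (there (there (here refl)))) = steep-miss′ 0F u<n v<n u≢v ¬a
          nonedge u v u<n v<n u≢v ¬a (there (there (there (there (here refl))))) = steep-miss′ 1F u<n v<n u≢v ¬a
          nonedge u v u<n v<n u≢v ¬a (there (there (there (there (there (here refl)))))) = steep-miss′ 2F u<n v<n u≢v ¬a
          nonedge u v u<n v<n u≢v ¬a (there (there (there (there (there (there (here refl))))))) = steep-miss′ 3F u<n v<n u≢v ¬a

    open Linear comb

    private
      Xᶠ Yᶠ κᶠ Ξᶠ Hᶠ : ℕ → Functional
      Xᶠ l = functional (λ w → X w l) λ t v w → refl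
      Yᶠ l = functional (λ w → Y w l) λ t v w → path-linear t (X v) (proj₂ v) (X w) (proj₂ w) l
      κᶠ u = + colour u ⊡ (Yᶠ u ⊟ Yᶠ (p u))
      Ξᶠ u = κᶠ u ⊞ κᶠ (p u)
      Hᶠ l = functional (λ w → H w l) λ t v w → trans
        (path-cong (λ i → linear (Ξᶠ i) t v w) (λ _ → sym (trans (ℤₚ.+-identityʳ (t * 0ℤ)) (ℤₚ.*-zeroʳ t))) l)
        (path-linear t (Ξ v) (λ _ → 0ℤ) (Ξ w) (λ _ → 0ℤ) l)

      φ₀ᶠ φ₁ᶠ : ℤ → ℕ → ℕ → Functional
      φ₀ᶠ m p q = (Yᶠ q ⊟ Yᶠ p) ⊟ (m ⊡ (Xᶠ q ⊟ Xᶠ p))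
      φ₁ᶠ m p q = (Hᶠ q ⊟ Hᶠ p) ⊟ (m ⊡ (Ξᶠ q ⊟ Ξᶠ p))

      ψᶠ : ℕ → ℕ → ℕ → Functional
      ψᶠ k u v = (Ξᶠ u ⊟ Ξᶠ v) ⊟ (+ k ⊡ (Yᶠ u ⊟ Yᶠ v))

      pairForms : ℕ → ℕ → List Functional
      pairForms u v = (Xᶠ u ⊟ Xᶠ v) ∷ (Yᶠ u ⊟ Yᶠ v) ∷ ψᶠ 0 u v ∷ ψᶠ 1 u v ∷ ψᶠ 2 u v ∷
        φ₀ᶠ (σ 0F) u v ∷ φ₁ᶠ (σ 0F) u v ∷ φ₀ᶠ (σ 1F) u v ∷ φ₁ᶠ (σ 1F) u v ∷
        φ₀ᶠ (σ 2F) u v ∷ φ₁ᶠ (σ 2F) u v ∷ φ₀ᶠ (σ 3F) u v ∷ φ₁ᶠ (σ 3F) u v ∷ []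

      forms : List Functional
      forms = concat (cartesianProductWith pairForms (upTo n) (upTo n))

      ∈-forms : ∀ {u v f} → u ℕ.< n → v ℕ.< n → f ∈ pairForms u v → f ∈ forms
      ∈-forms u<n v<n f∈ = ∈-concat⁺′ f∈ (∈-cartesianProductWith⁺ pairForms (∈-upTo⁺ u<n) (∈-upTo⁺ v<n))

      ψ∈ : ∀ {k u v} → k ℕ.≤ 2 → ψᶠ k u v ∈ pairForms u v
      ψ∈ {0} _ = there (there (here refl))
      ψ∈ {1} _ = there (there (there (here refl)))
      ψ∈ {2} _ = there (there (there (there (here refl))))
      ψ∈ {suc (suc (suc k))} (s≤s (s≤s ()))

      φ₀∈ : ∀ {u v} r → φ₀ᶠ (σ r) u v ∈ pairForms u v
      φ₀∈ 0F = there (there (there (there (there (here refl)))))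
      φ₀∈ 1F = there (there (there (there (there (there (there (here refl)))))))
      φ₀∈ 2F = there (there (there (there (there (there (there (there (there (here refl)))))))))
      φ₀∈ 3F = there (there (there (there (there (there (there (there (there (there (there (here refl)))))))))))

      φ₁∈ : ∀ {u v} r → φ₁ᶠ (σ r) u v ∈ pairForms u v
      φ₁∈ 0F = there (there (there (there (there (there (here refl))))))
      φ₁∈ 1F = there (there (there (there (there (there (there (there (here refl))))))))
      φ₁∈ 2F = there (there (there (there (there (there (there (there (there (there (here refl))))))))))
      φ₁∈ 3F = there (there (there (there (there (there (there (there (there (there (there (there (here refl))))))))))))

      formSum : Datum → List Functional → ℕ
      formSum w [] = 0
      formSum w (f ∷ fs) = ∣ apply f w ∣ ℕ.+ formSum w fs

      ≤formSum : ∀ w {f fs} → f ∈ fs → ∣ apply f w ∣ ℕ.≤ formSum w fs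
      ≤formSum w (here refl) = ℕₚ.m≤m+n _ _
      ≤formSum w {fs = f ∷ fs} (there f∈) = ℕₚ.≤-trans (≤formSum w f∈) (ℕₚ.m≤n+m _ _)

      genericDatum : ∃ λ w → All (Generic basis w) forms
      genericDatum = generic ((λ _ → 0ℤ) , (λ _ → 0ℤ)) basis forms

    private
      -- The unknowns are the common factor d, as coordinate 0, and one abscissa for each vertex.
      -- Each vertex gives one equation: a root is put at d times its limit abscissa, any other
      -- vertex on the line to its parent. There is one unknown more than equations.
      module ExactSystem (w : Datum) (N : ℕ) where
        module V = Linear (vcomb {suc n})

        D : Vec ℤ (suc n) → ℤ
        D v = coordinate v 0

        x y : Vec ℤ (suc n) → ℕ → ℤ
        x v l = coordinate v (suc l)
        y v = path (x v) (λ l → D v * proj₂ w l)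

        abstract
          y-linear : ∀ l t v v′ → y (vcomb t v v′) l ≡ t * y v l + y v′ l
          y-linear l t v v′ = trans
            (path-cong (λ i → coordinate-linear t v v′ (suc i))
              (λ i → trans (cong (_* proj₂ w i) (coordinate-linear t v v′ 0)) (ring t (D v) (D v′) (proj₂ w i))) l)
            (path-linear t (x v) (λ i → D v * proj₂ w i) (x v′) (λ i → D v′ * proj₂ w i) l)
            where
            ring : ∀ t d d′ s → (t * d + d′) * s ≡ t * (d * s) + d′ * s
            ring = solve-∀

        Dᶠ : V.Functional
        Dᶠ = V.functional D λ t v v′ → coordinate-linear t v v′ 0

        xᶠ yᶠ equation : ℕ → V.Functional
        xᶠ l = V.functional (λ v → x v l) λ t v v′ → coordinate-linear t v v′ (suc l)
        yᶠ l = V.functional (λ v → y v l) (y-linear l)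
        equation u = choose (parent? u) ((+ N V.⊡ (xᶠ u V.⊟ xᶠ (p u))) V.⊟ (+ colour u V.⊡ (yᶠ u V.⊟ yᶠ (p u)))) (xᶠ u V.⊟ (X w u V.⊡ Dᶠ))

        Solution : Vec ℤ (suc n) → Set
        Solution v = ¬ (v ≡ Vec.replicate (suc n) 0ℤ) × All (λ f → V.apply f v ≡ 0ℤ) (map equation (upTo n))

        solution : ∃ Solution
        solution = Homogeneous.solve (map equation (upTo n)) (s≤s (ℕₚ.≤-reflexive (trans (length-map equation (upTo n)) (length-upTo n))))

        module Solved (v : Vec ℤ (suc n)) (solves : Solution v) where

          equation-holds : ∀ {u} → u ℕ.< n → V.apply (equation u) v ≡ 0ℤ
          equation-holds u<n = All.lookup (proj₂ solves) (∈-map⁺ equation (∈-upTo⁺ u<n))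

          nontrivial : D v ≡ 0ℤ → (∀ {l} → l ℕ.< n → x v l ≡ 0ℤ) → ⊥
          nontrivial d≡0 x≡0 = proj₁ solves (coordinate-zero v zero-at)
            where
            zero-at : ∀ l → l ℕ.< suc n → coordinate v l ≡ 0ℤ
            zero-at zero _ = d≡0
            zero-at (suc l) (s≤s lt) = x≡0 lt

          at-root : ∀ {u} → u ℕ.< n → Root u → x v u ≡ D v * X w u
          at-root {u} u<n r = trans (ℤₚ.i-j≡0⇒i≡j (x v u) (X w u * D v)
              (subst (λ f → V.apply f v ≡ 0ℤ) (choose-no (parent? u) (λ (m , q) → r m q)) (equation-holds u<n))) (ℤₚ.*-comm (X w u) (D v))

          at-child : ∀ {u m} → u ℕ.< n → Par u m → + N * (x v u - x v m) ≡ + colour u * (y v u - y v m)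
          at-child {u} {m} u<n q = subst (λ m → + N * (x v u - x v m) ≡ + colour u * (y v u - y v m)) (p-par q)
            (ℤₚ.i-j≡0⇒i≡j (+ N * (x v u - x v (p u))) (+ colour u * (y v u - y v (p u)))
              (subst (λ f → V.apply f v ≡ 0ℤ) (choose-yes (parent? u) (m , q)) (equation-holds u<n)))

      -- `M` bounds the slopes, `C` the growth along paths, `K` the first-order abscissae and `F`
      -- all forms at `w`. None of them depends on N, which can therefore be chosen last.
      draw : ∀ (w : Datum) (sees : ∀ {f} → f ∈ forms → Visible (apply f) → apply f w ≢ 0ℤ) (M C K slack N′ F : ℕ)
        (steep≤ : ∀ r → steep r ℕ.≤ M) (C-large : 2 ℕ.* n ℕ.* M ℕ.≤ C) (Ξ≤ : ∀ {u} → u ℕ.< n → ∣ Ξ w u ∣ ℕ.≤ K)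
        (slack₁ : 20 ℕ.* C ℕ.≤ slack) (slack₂ : 16 ℕ.* C ℕ.* C ℕ.+ 16 ℕ.* M ℕ.* C ℕ.≤ slack)
        (form≤ : ∀ {f} → f ∈ forms → ∣ apply f w ∣ ℕ.≤ F)
        (N′-large : suc (8 ℕ.* n ℕ.* C ℕ.+ suc slack ℕ.* suc (n ℕ.* K) ℕ.+ F) ℕ.≤ N′) → IndexDrawing n A
      draw w sees M C K slack N′ F steep≤ C-large Ξ≤ slack₁ slack₂ form≤ N′-large = go (ExactSystem.solution w N)
        where
        N = 2 ℕ.* N′
        N′≤N : N′ ℕ.≤ N
        N′≤N = ℕₚ.m≤m+n N′ (N′ ℕ.+ 0)
        form<N : ∀ {f} → f ∈ forms → ∣ apply f w ∣ ℕ.< N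
        form<N f∈ = ℕₚ.≤-trans (s≤s (ℕₚ.≤-trans (form≤ f∈) (ℕₚ.m≤n+m F _))) (ℕₚ.≤-trans N′-large N′≤N)
        N′≢0 : N′ ≢ 0
        N′≢0 e = ℕₚ.n≮0 (subst (suc _ ℕ.≤_) e N′-large)
        go : ∃ (ExactSystem.Solution w N) → IndexDrawing n A
        go (v , solves) = Lines.drawing N′ N′≢0 (coordinate v 0) (proj₂ w) (λ l → coordinate v (suc l)) Sol.at-child Est.near-vertical Est.steep-line Est.apart-vertically
          where
          module Sol = ExactSystem.Solved w N v solves
          module Est = Estimates w M C K slack N steep≤ C-large Ξ≤ slack₁ slack₂
            (ℕₚ.≤-trans (ℕₚ.≤-trans (ℕₚ.m≤m+n _ F) (ℕₚ.n≤1+n _)) (ℕₚ.≤-trans N′-large N′≤N))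
            (λ {k} {u} {v} k≤2 u<n v<n → form<N (∈-forms u<n v<n (ψ∈ {k} {u} {v} k≤2)))
            (λ {u} {v} r u<n v<n → form<N (∈-forms u<n v<n (φ₁∈ {u} {v} r)))
            (λ u<n v<n → sees (∈-forms u<n v<n (here refl)))
            (λ u<n v<n → sees (∈-forms u<n v<n (there (here refl))))
            (λ {k} {u} {v} k≤2 u<n v<n → sees (∈-forms u<n v<n (ψ∈ {k} {u} {v} k≤2)))
            (λ {u} {v} r u<n v<n → sees (∈-forms u<n v<n (φ₀∈ {u} {v} r)))
            (λ {u} {v} r u<n v<n → sees (∈-forms u<n v<n (φ₁∈ {u} {v} r)))
            (coordinate v 0) (λ l → coordinate v (suc l)) Sol.nontrivial Sol.at-root Sol.at-child

      choose-constants : ∀ (w : Datum) (sees : ∀ {f} → f ∈ forms → Visible (apply f) → apply f w ≢ 0ℤ) (M K F : ℕ) (steep≤ : ∀ r → steep r ℕ.≤ M)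
        (Ξ≤ : ∀ {u} → u ℕ.< n → ∣ Ξ w u ∣ ℕ.≤ K) (form≤ : ∀ {f} → f ∈ forms → ∣ apply f w ∣ ℕ.≤ F) → IndexDrawing n A
      choose-constants w sees M K F steep≤ Ξ≤ form≤ = with-C (2 ℕ.* n ℕ.* M) ℕₚ.≤-refl
        where
        with-slack : ∀ C slack → 2 ℕ.* n ℕ.* M ℕ.≤ C → 20 ℕ.* C ℕ.≤ slack → 16 ℕ.* C ℕ.* C ℕ.+ 16 ℕ.* M ℕ.* C ℕ.≤ slack → IndexDrawing n A
        with-slack C slack C-large slack₁ slack₂ =
          draw w sees M C K slack (suc (8 ℕ.* n ℕ.* C ℕ.+ suc slack ℕ.* suc (n ℕ.* K) ℕ.+ F)) F steep≤ C-large Ξ≤ slack₁ slack₂ form≤ ℕₚ.≤-refl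
        with-C : ∀ C → 2 ℕ.* n ℕ.* M ℕ.≤ C → IndexDrawing n A
        with-C C C-large = with-slack C (16 ℕ.* C ℕ.* C ℕ.+ 16 ℕ.* M ℕ.* C ℕ.+ 20 ℕ.* C) C-large
          (ℕₚ.m≤n+m (20 ℕ.* C) (16 ℕ.* C ℕ.* C ℕ.+ 16 ℕ.* M ℕ.* C)) (ℕₚ.m≤m+n (16 ℕ.* C ℕ.* C ℕ.+ 16 ℕ.* M ℕ.* C) (20 ℕ.* C))

    drawing : IndexDrawing n A
    drawing = choose-constants w (λ f∈ (b , basic , ne) → All.lookup (All.lookup (proj₂ genericDatum) f∈) (basic-∈ basic) ne)
        (steep 3F) (natSum n (λ u → ∣ Ξ w u ∣)) (formSum w forms) steep≤ (≤natSum n (λ u → ∣ Ξ w u ∣)) (≤formSum w)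
      where
      w : Datum
      w = proj₁ genericDatum
      steep≤ : ∀ r → steep r ℕ.≤ steep 3F
      steep≤ 0F = s≤s z≤n
      steep≤ 1F = s≤s (s≤s z≤n)
      steep≤ 2F = s≤s (s≤s (ℕₚ.m≤m+n base (base ℕ.* base)))
      steep≤ 3F = ℕₚ.≤-refl

-- Removing and restoring the K₄ components.

module Main where
  open LinAlg
  open Transfer
  open Order
  open Arrange
  open Limit using (choose; choose-yes; choose-no)
  open Estimate using (∣-∣≤; ∣*∣≤)
  open Exact
  open import Data.Integer using (+_; -_; _+_; _*_; _-_)
  open import Data.Integer.Tactic.RingSolver using (solve-∀)
  open import Data.Bool using (_∨_; not)
  open import Data.Maybe using (fromMaybe)
  open import Relation.Binary.PropositionalEquality

  private
    ∧-true : ∀ {a b} → a ∧ b ≡ true → a ≡ true × b ≡ true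
    ∧-true {true} {true} _ = refl , refl

    false≢true : ∀ {b} → b ≡ false → b ≡ true → ⊥
    false≢true refl ()

    bool-iff : ∀ {a b} → (a ≡ true → b ≡ true) → (b ≡ true → a ≡ true) → a ≡ b
    bool-iff {true} {b} f g = sym (f refl)
    bool-iff {false} {false} f g = refl
    bool-iff {false} {true} f g = g refl

    ¬true : ∀ {b} → ¬ (b ≡ true) → b ≡ false
    ¬true {true} ne = ⊥-elim (ne refl)
    ¬true {false} _ = refl

  module Quads {n : ℕ} (G : Graph n) (deg : MaxDegreeAtMost G 3) where
    open Graph G renaming (sym to E-sym)

    Edge : Fin n → Fin n → Set
    Edge u v = E u v ≡ true

    edge-sym : ∀ {u v} → Edge u v → Edge v u
    edge-sym {u} {v} e = trans (E-sym v u) e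

    edge≢ : ∀ {u v} → Edge u v → u ≢ v
    edge≢ {u} e refl = false≢true (irrefl u) e

    Quad : Fin n → Set
    Quad u = ∃ λ a → ∃₂ λ b c → (Edge u a × Edge u b × Edge u c) × (Edge a b × Edge a c × Edge b c)

    abstract
      quad? : ∀ u → Dec (Quad u)
      quad? u = Finₚ.any? λ a → Finₚ.any? λ b → Finₚ.any? λ c →
        (edge? u a ×-dec (edge? u b ×-dec edge? u c)) ×-dec (edge? a b ×-dec (edge? a c ×-dec edge? b c))
        where
        edge? : ∀ u v → Dec (Edge u v)
        edge? u v = E u v Boolₚ.≟ true

    only-three : ∀ {u a b c t} → Edge u a → Edge u b → Edge u c → a ≢ b → a ≢ c → b ≢ c → Edge u t → t ≡ a ⊎ t ≡ b ⊎ t ≡ c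
    only-three {u} {a} {b} {c} {t} ua ub uc ab ac bc ut with t Fin.≟ a | t Fin.≟ b | t Fin.≟ c
    ... | yes e | _ | _ = inj₁ e
    ... | no _ | yes e | _ = inj₂ (inj₁ e)
    ... | no _ | no _ | yes e = inj₂ (inj₂ e)
    ... | no ta | no tb | no tc = ⊥-elim (ℕₚ.<⇒≱ (unique-length {ys = t ∷ a ∷ b ∷ c ∷ []}
        ((ta ∷ tb ∷ tc ∷ []) ∷ (ab ∷ ac ∷ []) ∷ (bc ∷ []) ∷ [] ∷ [])
        λ { (here refl) → ∈-members (E u) ut ; (there (here refl)) → ∈-members (E u) ua
          ; (there (there (here refl))) → ∈-members (E u) ub ; (there (there (there (here refl)))) → ∈-members (E u) uc }) (deg u))

    Closed : Fin n → Fin n → Set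
    Closed u t = t ≡ u ⊎ Edge u t

    -- In degree three a vertex of a K₄ has no neighbours outside it, so its neighbours have the
    -- same closed neighbourhood.
    quad-step : ∀ {u v} → Quad u → Edge u v → Quad v × (∀ {t} → Closed u t → Closed v t)
    quad-step {u} {v} (a , b , c , (ua , ub , uc) , (ab , ac , bc)) uv with only-three ua ub uc (edge≢ ab) (edge≢ ac) (edge≢ bc) uv
    ... | inj₁ refl = (u , b , c , (edge-sym ua , ab , ac) , (ub , uc , bc)) , step
      where
      step : ∀ {t} → Closed u t → Closed a t
      step (inj₁ refl) = inj₂ (edge-sym ua)
      step (inj₂ ut) with only-three ua ub uc (edge≢ ab) (edge≢ ac) (edge≢ bc) ut
      ... | inj₁ refl = inj₁ refl
      ... | inj₂ (inj₁ refl) = inj₂ ab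
      ... | inj₂ (inj₂ refl) = inj₂ ac
    ... | inj₂ (inj₁ refl) = (u , a , c , (edge-sym ub , edge-sym ab , bc) , (ua , uc , ac)) , step
      where
      step : ∀ {t} → Closed u t → Closed b t
      step (inj₁ refl) = inj₂ (edge-sym ub)
      step (inj₂ ut) with only-three ua ub uc (edge≢ ab) (edge≢ ac) (edge≢ bc) ut
      ... | inj₁ refl = inj₂ (edge-sym ab)
      ... | inj₂ (inj₁ refl) = inj₁ refl
      ... | inj₂ (inj₂ refl) = inj₂ bc
    ... | inj₂ (inj₂ refl) = (u , a , b , (edge-sym uc , edge-sym ac , edge-sym bc) , (ua , ub , ab)) , step
      where
      step : ∀ {t} → Closed u t → Closed c t
      step (inj₁ refl) = inj₂ (edge-sym uc)
      step (inj₂ ut) with only-three ua ub uc (edge≢ ab) (edge≢ ac) (edge≢ bc) ut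
      ... | inj₁ refl = inj₂ (edge-sym ac)
      ... | inj₂ (inj₁ refl) = inj₂ (edge-sym bc)
      ... | inj₂ (inj₂ refl) = inj₁ refl

    quad-edge : ∀ {u v} → Quad u → Edge u v → Quad v
    quad-edge q e = proj₁ (quad-step q e)

    private
      kept : Fin n → Bool
      kept u = not (does (quad? u))

      kept-quad : ∀ {u} → kept u ≡ true → ¬ Quad u
      kept-quad {u} k q with quad? u
      ... | no ¬q = ¬q q

      quad-kept : ∀ {u} → ¬ Quad u → kept u ≡ true
      quad-kept {u} ¬q with quad? u
      ... | yes q = ⊥-elim (¬q q)
      ... | no _ = refl

    pruned : Graph n
    pruned = record
      { E = λ u v → E u v ∧ (kept u ∧ kept v)
      ; sym = λ u v → cong₂ _∧_ (E-sym u v) (Boolₚ.∧-comm (kept u) (kept v))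
      ; irrefl = λ v → cong (_∧ (kept v ∧ kept v)) (irrefl v)
      }

    pruned-edge : ∀ {u v} → Graph.E pruned u v ≡ true → Edge u v × ¬ Quad u
    pruned-edge {u} {v} e = proj₁ (∧-true {E u v} e) , kept-quad (proj₁ (∧-true {kept u} (proj₂ (∧-true {E u v} e))))

    edge-pruned : ∀ {u v} → Edge u v → ¬ Quad u → Graph.E pruned u v ≡ true
    edge-pruned e ¬q = cong₂ _∧_ e (cong₂ _∧_ (quad-kept ¬q) (quad-kept λ q → ¬q (quad-edge q (edge-sym e))))

    pruned-degree : MaxDegreeAtMost pruned 3
    pruned-degree v = ℕₚ.≤-trans (unique-length (members-unique (Graph.E pruned v))
      λ x∈ → ∈-members (E v) (proj₁ (pruned-edge (members-∈ (Graph.E pruned v) x∈)))) (deg v)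

    pruned-K₄-free : ∀ {a b c d} → Graph.E pruned a b ≡ true → Graph.E pruned a c ≡ true → Graph.E pruned a d ≡ true →
                     Graph.E pruned b c ≡ true → Graph.E pruned b d ≡ true → Graph.E pruned c d ≡ true → ⊥
    pruned-K₄-free ab ac ad bc bd cd = proj₂ (pruned-edge ab) (_ , _ , _ ,
      (proj₁ (pruned-edge ab) , proj₁ (pruned-edge ac) , proj₁ (pruned-edge ad)) , (proj₁ (pruned-edge bc) , proj₁ (pruned-edge bd) , proj₁ (pruned-edge cd)))

    private
      closedᵇ : Fin n → Fin n → Bool
      closedᵇ u t = does (t Fin.≟ u) ∨ E u t

      closedᵇ-sound : ∀ {u t} → closedᵇ u t ≡ true → Closed u t
      closedᵇ-sound {u} {t} e with t Fin.≟ u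
      ... | yes p = inj₁ p
      ... | no _ = inj₂ e

      closedᵇ-complete : ∀ {u t} → Closed u t → closedᵇ u t ≡ true
      closedᵇ-complete {u} {t} c with t Fin.≟ u
      ... | yes _ = refl
      closedᵇ-complete (inj₁ e) | no ne = ⊥-elim (ne e)
      closedᵇ-complete (inj₂ e) | no _ = e

      first : Fin n → Fin n
      first u = fromMaybe u (head (members (closedᵇ u)))

      first-closed : ∀ u → Closed u (first u)
      first-closed u = go (members (closedᵇ u)) (λ x∈ → closedᵇ-sound (members-∈ (closedᵇ u) x∈))
        where
        go : ∀ xs → (∀ {x} → x ∈ xs → Closed u x) → Closed u (fromMaybe u (head xs))
        go [] _ = inj₁ refl
        go (x ∷ _) f = f (here refl)

      first-cong : ∀ {u v} → Quad u → Edge u v → first u ≡ first v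
      first-cong {u} {v} q e = go (members (closedᵇ u)) (members (closedᵇ v)) (members-cong same (allFin n)) (∈-members (closedᵇ u) (closedᵇ-complete (inj₁ refl)))
        where
        same : ∀ t → closedᵇ u t ≡ closedᵇ v t
        same t = bool-iff (λ c → closedᵇ-complete (proj₂ (quad-step q e) (closedᵇ-sound c)))
          (λ c → closedᵇ-complete (proj₂ (quad-step (quad-edge q e) (edge-sym e)) (closedᵇ-sound c)))
        go : ∀ xs ys → xs ≡ ys → u ∈ xs → fromMaybe u (head xs) ≡ fromMaybe v (head ys)
        go (x ∷ _) _ refl _ = refl

    -- The closed neighbourhood is the same for the four vertices of a K₄, hence so is its first
    -- member; the whole component is collapsed to that vertex.
    centre : Fin n → Fin n
    centre u = choose (quad? u) (first u) u

    centre-quad : ∀ {u} → Quad u → centre u ≡ first u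
    centre-quad {u} q = choose-yes (quad? u) q

    centre-plain : ∀ {u} → ¬ Quad u → centre u ≡ u
    centre-plain {u} ¬q = choose-no (quad? u) ¬q

    centre-is-quad : ∀ {u} → Quad u → Quad (centre u)
    centre-is-quad {u} q = subst Quad (sym (centre-quad q)) ([ (λ e → subst Quad (sym e) q) , quad-edge q ]′ (first-closed u))

    centre-edge : ∀ {u v} → Quad u → Edge u v → centre u ≡ centre v
    centre-edge q e = trans (centre-quad q) (trans (first-cong q e) (sym (centre-quad (quad-edge q e))))

    closed-sym : ∀ {u t} → Quad u → Closed u t → ∀ {s} → Closed t s → Closed u s
    closed-sym q (inj₁ refl) c = c
    closed-sym q (inj₂ e) c = proj₂ (quad-step (quad-edge q e) (edge-sym e)) c

    centre-injective : ∀ {u v} → u ≢ v → centre u ≡ centre v → Quad u × Edge u v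
    centre-injective {u} {v} u≢v e = go (quad? u) (quad? v)
      where
      back : Closed (first v) v
      back = [ (λ e′ → inj₁ (sym e′)) , (λ e′ → inj₂ (edge-sym e′)) ]′ (first-closed v)
      go : Dec (Quad u) → Dec (Quad v) → Quad u × Edge u v
      go (no ¬q) (no ¬q′) = ⊥-elim (u≢v (trans (sym (centre-plain ¬q)) (trans e (centre-plain ¬q′))))
      go (yes q) (no ¬q′) = ⊥-elim (¬q′ (subst Quad (trans e (centre-plain ¬q′)) (centre-is-quad q)))
      go (no ¬q) (yes q′) = ⊥-elim (¬q (subst Quad (trans (sym e) (centre-plain ¬q)) (centre-is-quad q′)))
      go (yes q) (yes q′) = q , [ (λ v≡u → ⊥-elim (u≢v (sym v≡u))) , (λ z → z) ]′
          (closed-sym q (first-closed u) (subst (λ t → Closed t v) (sym (trans (sym (centre-quad q)) (trans e (centre-quad q′)))) back))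

    private
      slopeSum : List (Maybe ℕ) → ℕ
      slopeSum [] = 0
      slopeSum (nothing ∷ σs) = slopeSum σs
      slopeSum (just m ∷ σs) = m ℕ.+ slopeSum σs

      ≤slopeSum : ∀ {m σs} → just m ∈ σs → m ℕ.≤ slopeSum σs
      ≤slopeSum (here refl) = ℕₚ.m≤m+n _ _
      ≤slopeSum {σs = nothing ∷ σs} (there m∈) = ≤slopeSum m∈
      ≤slopeSum {σs = just _ ∷ σs} (there m∈) = ℕₚ.≤-trans (≤slopeSum m∈) (ℕₚ.m≤n+m _ _)

    -- The vertices of a K₄ component are isolated in the pruned graph; spread them along a line
    -- of slope 1 through one of them, on a scale too small to disturb the other slopes.
    module Restore {slopes : List (Maybe ℕ)} (one∈ : just 1 ∈ slopes) (Dr : IntegerDrawing pruned slopes)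
                   (scale : ℤ) (scale-large : (n ℕ.+ n) ℕ.* suc (suc (slopeSum slopes)) ℕ.< ∣ scale ∣) where
      open IntegerDrawing Dr

      private
        shift : Fin n → ℤ
        shift u = choose (quad? u) (+ toℕ u) 0ℤ

        shift≤ : ∀ u → ∣ shift u ∣ ℕ.≤ n
        shift≤ u with quad? u
        ... | yes _ = ℕₚ.<⇒≤ (Finₚ.toℕ<n u)
        ... | no _ = z≤n

        x y : Fin n → ℤ
        x u = proj₁ (pos (centre u))
        y u = proj₂ (pos (centre u))

        spread : Fin n → ℤ × ℤ
        spread u = scale * x u + shift u , scale * y u + shift u

        gap≤ : ∀ u v → ∣ shift v - shift u ∣ ℕ.≤ n ℕ.+ n
        gap≤ u v = ∣-∣≤ {shift v} {shift u} (shift≤ v) (shift≤ u)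

        -- Two shifts differ by at most 2 n. The factor `c` is 1 for a coordinate and 1 - m for the
        -- line equation of slope m.
        within-scale : ∀ u v c → ∣ c ∣ ℕ.≤ suc (suc (slopeSum slopes)) → ∣ (shift v - shift u) * c ∣ ℕ.< ∣ scale ∣
        within-scale u v c c≤ = ℕₚ.≤-<-trans (∣*∣≤ {shift v - shift u} {c} (gap≤ u v) c≤) scale-large

        x-diff : ∀ u v → (scale * x v + shift v) - (scale * x u + shift u) ≡ scale * (x v - x u) + (shift v - shift u) * 1ℤ
        x-diff u v = ring scale (x u) (x v) (shift u) (shift v)
          where
          ring : ∀ s a b p q → (s * b + q) - (s * a + p) ≡ s * (b - a) + (q - p) * 1ℤ
          ring = solve-∀

        apart : ∀ {u v} a b → scale * (b - a) + (shift v - shift u) * 1ℤ ≡ 0ℤ → a ≡ b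
        apart {u} {v} a b e with (b - a) ℤₚ.≟ 0ℤ
        ... | yes z = sym (ℤₚ.i-j≡0⇒i≡j b a z)
        ... | no ne = ⊥-elim (dominant scale (b - a) ((shift v - shift u) * 1ℤ) ne (within-scale u v 1ℤ (s≤s z≤n)) e)

        same-x : ∀ u v → scale * x u + shift u ≡ scale * x v + shift v → x u ≡ x v
        same-x u v e = apart {u} {v} (x u) (x v) (trans (sym (x-diff u v)) (trans (cong (_- (scale * x u + shift u)) (sym e)) (ℤₚ.+-inverseʳ (scale * x u + shift u))))

        same-y : ∀ u v → scale * y u + shift u ≡ scale * y v + shift v → y u ≡ y v
        same-y u v e = apart {u} {v} (y u) (y v) (trans (ring scale (y u) (y v) (shift u) (shift v)) (trans (cong (_- (scale * y u + shift u)) (sym e)) (ℤₚ.+-inverseʳ (scale * y u + shift u))))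
          where
          ring : ∀ s a b p q → s * (b - a) + (q - p) * 1ℤ ≡ (s * b + q) - (s * a + p)
          ring = solve-∀

        -- Shifting along slope 1 changes the deviation from slope m by a multiple of 1 - m that is
        -- smaller than `scale`, while a nonzero deviation of the centres is multiplied by `scale`.
        hits-centres : ∀ σ u v → σ ∈ slopes → Hits σ (spread u) (spread v) → Hits σ (pos (centre u)) (pos (centre v))
        hits-centres nothing u v _ h = same-x u v h
        hits-centres (just m) u v m∈ h with ((y v - y u) - + m * (x v - x u)) ℤₚ.≟ 0ℤ
        ... | yes z = ℤₚ.i-j≡0⇒i≡j (y v - y u) (+ m * (x v - x u)) z
        ... | no ne = ⊥-elim (dominant scale ((y v - y u) - + m * (x v - x u)) ((shift v - shift u) * (1ℤ - + m)) ne
            (within-scale u v (1ℤ - + m) (ℕₚ.≤-trans (∣-∣≤ {1ℤ} {+ m} ℕₚ.≤-refl (≤slopeSum m∈)) (ℕₚ.n≤1+n _)))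
            (trans (ring scale (+ m) (x u) (x v) (y u) (y v) (shift u) (shift v)) (trans (cong (_- + m * ((scale * x v + shift v) - (scale * x u + shift u))) h) (ℤₚ.+-inverseʳ (+ m * ((scale * x v + shift v) - (scale * x u + shift u)))))))
          where
          ring : ∀ s m x x′ y y′ p q → s * ((y′ - y) - m * (x′ - x)) + (q - p) * (1ℤ - m) ≡ ((s * y′ + q) - (s * y + p)) - m * ((s * x′ + q) - (s * x + p))
          ring = solve-∀

        shift-plain : ∀ {u} → ¬ Quad u → shift u ≡ 0ℤ
        shift-plain {u} ¬q = choose-no (quad? u) ¬q

        shift-quad : ∀ {u} → Quad u → shift u ≡ + toℕ u
        shift-quad {u} q = choose-yes (quad? u) q

        spread-plain : ∀ {u} → ¬ Quad u → spread u ≡ (scale * proj₁ (pos u) , scale * proj₂ (pos u))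
        spread-plain {u} ¬q = cong₂ _,_ (plain proj₁) (plain proj₂)
          where
          plain : (f : ℤ × ℤ → ℤ) → scale * f (pos (centre u)) + shift u ≡ scale * f (pos u)
          plain f = trans (cong₂ (λ c s → scale * f (pos c) + s) (centre-plain ¬q) (shift-plain ¬q)) (ℤₚ.+-identityʳ (scale * f (pos u)))

        hits-scaled : ∀ σ {P Q : ℤ × ℤ} → Hits σ P Q → Hits σ (scale * proj₁ P , scale * proj₂ P) (scale * proj₁ Q , scale * proj₂ Q)
        hits-scaled nothing h = cong (scale *_) h
        hits-scaled (just m) {x₁ , y₁} {x₂ , y₂} h = trans (ring₁ scale y₁ y₂) (trans (cong (scale *_) h) (ring₂ scale (+ m) x₁ x₂))
          where
          ring₁ : ∀ s a b → s * b - s * a ≡ s * (b - a)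
          ring₁ = solve-∀
          ring₂ : ∀ s m a b → s * (m * (b - a)) ≡ m * (s * b - s * a)
          ring₂ = solve-∀

      restored : IntegerDrawing G slopes
      restored = record { pos = spread ; distinct = λ {u} {v} → distinct′ u v ; edge = λ {u} {v} → edge′ u v ; nonedge = λ {u} {v} → nonedge′ u v }
        where
        distinct′ : ∀ u v → u ≢ v → spread u ≢ spread v
        distinct′ u v u≢v e with centre u Fin.≟ centre v
        ... | no ne = distinct ne (cong₂ _,_ (same-x u v (cong proj₁ e)) (same-y u v (cong proj₂ e)))
        ... | yes c = u≢v (Finₚ.toℕ-injective (ℤₚ.+-injective (trans (sym (shift-quad q)) (trans shifts (shift-quad (quad-edge q (proj₂ (centre-injective u≢v c))))))))
          where
          q = proj₁ (centre-injective u≢v c)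
          shifts : shift u ≡ shift v
          shifts = trans (ring (scale * x u) (shift u)) (trans (cong (_- scale * x u) (trans (cong proj₁ e) (cong (λ t → scale * proj₁ (pos t) + shift v) (sym c)))) (sym (ring (scale * x u) (shift v))))
            where
            ring : ∀ a s → s ≡ (a + s) - a
            ring = solve-∀
        edge′ : ∀ u v → Edge u v → ∃ λ σ → σ ∈ slopes × Hits σ (spread u) (spread v)
        edge′ u v e = go (quad? u)
          where
          ring : ∀ s a b p q → (s * b + q) - (s * b + p) ≡ 1ℤ * ((s * a + q) - (s * a + p))
          ring = solve-∀
          go : Dec (Quad u) → ∃ λ σ → σ ∈ slopes × Hits σ (spread u) (spread v)
          go (yes q) = just 1 , one∈ , trans (cong (λ t → (scale * proj₂ (pos t) + shift v) - (scale * y u + shift u)) (sym (centre-edge q e)))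
              (trans (ring scale (x u) (y u) (shift u) (shift v)) (cong (λ t → 1ℤ * ((scale * proj₁ (pos t) + shift v) - (scale * x u + shift u))) (centre-edge q e)))
          go (no ¬q) with edge (edge-pruned e ¬q)
          ... | σ , σ∈ , h = σ , σ∈ , subst₂ (Hits σ) (sym (spread-plain ¬q)) (sym (spread-plain λ q → ¬q (quad-edge q (edge-sym e)))) (hits-scaled σ {pos u} {pos v} h)
        nonedge′ : ∀ u v → u ≢ v → E u v ≡ false → ∀ {σ} → σ ∈ slopes → ¬ Hits σ (spread u) (spread v)
        nonedge′ u v u≢v ne {σ} σ∈ h = nonedge (λ c → false≢true ne (proj₂ (centre-injective u≢v c))) missing σ∈ (hits-centres σ u v σ∈ h)
          where
          missing : Graph.E pruned (centre u) (centre v) ≡ false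
          missing = ¬true λ e → absurd e (quad? u) (quad? v)
            where
            absurd : Graph.E pruned (centre u) (centre v) ≡ true → Dec (Quad u) → Dec (Quad v) → ⊥
            absurd e (yes q) _ = proj₂ (pruned-edge e) (centre-is-quad q)
            absurd e (no ¬q) (yes q′) = proj₂ (pruned-edge e) (quad-edge (centre-is-quad q′) (edge-sym (proj₁ (pruned-edge e))))
            absurd e (no ¬q) (no ¬q′) = false≢true ne (subst₂ Edge (centre-plain ¬q) (centre-plain ¬q′) (proj₁ (pruned-edge e)))

    restore : ∀ {slopes} → just 1 ∈ slopes → IntegerDrawing pruned slopes → IntegerDrawing G slopes
    restore {slopes} one∈ Dr = Restore.restored one∈ Dr (+ suc ((n ℕ.+ n) ℕ.* suc (suc (slopeSum slopes)))) ℕₚ.≤-refl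

  module _ {n : ℕ} (G : Graph n) (deg : MaxDegreeAtMost G 3)
           (K₄-free : ∀ {a b c d} → Graph.E G a b ≡ true → Graph.E G a c ≡ true → Graph.E G a d ≡ true →
                      Graph.E G b c ≡ true → Graph.E G b d ≡ true → Graph.E G c d ≡ true → ⊥) where
    open Weighted (weight G deg K₄-free) (weight-sym G deg K₄-free) using (total)

    private
      from-order : (xs : List (Fin n)) → Unique xs → (∀ v → v ∈ xs) → (∀ {ys} → ys ↭ xs → total ys ℕ.≤ total xs) →
                   ∃₂ λ base N′ → IntegerDrawing G (slopeList base N′)
      from-order xs u complete maximal = transport (ExactDrawing.drawing layout (10 ℕ.+ 4 ℕ.* length xs) ℕₚ.≤-refl)
        where
        open Positions G deg K₄-free xs u complete maximal
        index : Fin n → ℕ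
        index v = proj₁ (∈-at (complete v))
        at-index : ∀ v → at xs (index v) ≡ just v
        at-index v = proj₂ (∈-at (complete v))
        index-injective : ∀ {v v′} → index v ≡ index v′ → v ≡ v′
        index-injective {v} {v′} e = just-injective (trans (sym (at-index v)) (trans (cong (at xs) e) (at-index v′)))
        adjacent : ∀ {v v′} → Adj (index v) (index v′) → Graph.E G v v′ ≡ true
        adjacent {v} {v′} (x , y , p , q , e) with just-injective (trans (sym p) (at-index v)) | just-injective (trans (sym q) (at-index v′))
        ... | refl | refl = e
        transport : IndexDrawing (length xs) Adj → ∃₂ λ base N′ → IntegerDrawing G (slopeList base N′)
        transport D = I.base , I.N′ , record
          { pos = λ v → I.place (index v)
          ; distinct = λ {v} {v′} ne → I.distinct (at-< xs _ (at-index v)) (at-< xs _ (at-index v′)) (λ e → ne (index-injective e))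
          ; edge = λ {v} {v′} e → I.edge (v , v′ , at-index v , at-index v′ , e)
          ; nonedge = λ {v} {v′} ne e → I.nonedge (at-< xs _ (at-index v)) (at-< xs _ (at-index v′)) (λ e′ → ne (index-injective e′)) (λ a → false≢true e (adjacent a))
          }
          where module I = IndexDrawing D

    drawing-K₄-free : ∃₂ λ base N′ → IntegerDrawing G (slopeList base N′)
    drawing-K₄-free with best-order total
    ... | xs , u , complete , maximal = from-order xs u complete maximal

open import Relation.Binary.PropositionalEquality using (refl)
open Transfer using (IntegerDrawing; realize)
open Exact using (slopeList)
open Main

theorem7p1 : (R : RealField) (n : ℕ) (G : Graph n) →
    MaxDegreeAtMost G 3 → SlopeParamAtMost R G 7
theorem7p1 R n G deg = conclude (drawing-K₄-free (Quads.pruned G deg) (Quads.pruned-degree G deg) (Quads.pruned-K₄-free G deg))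
  where
  conclude : (∃₂ λ base N′ → IntegerDrawing (Quads.pruned G deg) (slopeList base N′)) → SlopeParamAtMost R G 7
  -- The smallest steep slope is 1, so the short lines that carry the K₄ components need no eighth
  -- slope.
  conclude (base , N′ , D) = _ , ℕₚ.≤-refl , realize R (Quads.restore G deg (there (there (there (here refl)))) D)
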